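{- Let $n\ge 6$ and let $\mathcal{G}=\{G_1,G_2,\ldots,G_n\}$ be a family of graphs on the same vertex set $[n]$ such that $\rho_S(G_i)>2n-4$ for every $i=1,\ldots,n$. Then $\mathcal{G}$ admits a rainbow Hamiltonian cycle, unless $G_1=G_2=\cdots=G_n\cong K_1\vee(K_{n-2}\cup K_1)$.
   Context: For a graph $G$, the signless Laplacian is $S(G)=D(G)+A(G)$ with $D(G)$ the diagonal degree matrix and $A(G)$ the adjacency matrix; $\rho_S(G)$ is the largest eigenvalue of $S(G)$. $K_1\vee(K_{n-2}\cup K_1)$ is $K_{n-1}$ plus one pendant vertex adjacent to one vertex of the $K_{n-1}$. $G_i=G_j$ means equal vertex and edge sets. A rainbow Hamiltonian cycle in $\mathcal{G}$ is a Hamiltonian cycle on the common vertex set whose $n$ edges can be labeled $e_1,\ldots,e_n$ with $e_i\in E(G_i)$ for each $i$. -}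

module Defs where

open import Algebra.Bundles using (CommutativeMonoid)
import Algebra.Properties.CommutativeSemigroup as CommutativeSemigroupProperties
open import Data.Bool.Base using (Bool; true; false; T; not; if_then_else_)
open import Data.Empty using (⊥-elim)
open import Data.Fin.Base using (Fin; toℕ; splitAt)
open import Data.Fin.Properties using (_≟_)
open import Data.Fin.Permutation using (Permutation; Permutation′; _⟨$⟩ʳ_)
open import Data.Fin.Subset using (Subset; ∣_∣)
open import Data.Integer.Base using (+_)
open import Data.Nat.Base as ℕ using (ℕ; suc)
open import Data.Nat.DivMod using (_mod_)
import Data.Nat.Properties as ℕₚ
open import Data.Product.Base using (Σ-syntax; ∃-syntax; _×_; _,_)
open import Data.Rational.Base as ℚ using (ℚ; 0ℚ; 1ℚ; ½)
import Data.Rational.Properties as ℚₚ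
open import Data.Sum.Base using (_⊎_; inj₁; inj₂)
open import Data.Unit.Base using (tt)
open import Data.Vec.Base using (tabulate)
open import Data.Vec.Functional as Vector using (Vector)
open import Relation.Binary.Definitions using (Symmetric; Irreflexive)
open import Relation.Binary.PropositionalEquality
  using (_≡_; refl; sym; trans; cong; cong₂; subst; module ≡-Reasoning)
open import Relation.Nullary using (¬_; yes; no)
open import Relation.Nullary.Decidable using (⌊_⌋)

-- Real numbers: Cauchy sequences of rationals, taken up to _≃_.

IsCauchy : (ℕ → ℚ) → Set
IsCauchy x = ∀ ε → 0ℚ ℚ.< ε →
  ∃[ N ] (∀ m n → N ℕ.≤ m → N ℕ.≤ n → ℚ.∣ x m ℚ.- x n ∣ ℚ.< ε)

record ℝ : Set where
  constructor mkℝ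
  field
    seq    : ℕ → ℚ
    cauchy : IsCauchy seq

open ℝ public

infix  4 _≃_ _<ᴿ_ _≤ᴿ_
infixl 6 _+ᴿ_
infixl 7 _*ᴿ_

_≃_ : ℝ → ℝ → Set
x ≃ y = ∀ ε → 0ℚ ℚ.< ε →
  ∃[ N ] (∀ n → N ℕ.≤ n → ℚ.∣ seq x n ℚ.- seq y n ∣ ℚ.< ε)

-- The gap ε makes this the strict order of the limits, not of the sequences.
_<ᴿ_ : ℝ → ℝ → Set
x <ᴿ y = ∃[ ε ] (0ℚ ℚ.< ε ×
  ∃[ N ] (∀ n → N ℕ.≤ n → seq x n ℚ.+ ε ℚ.< seq y n))

_≤ᴿ_ : ℝ → ℝ → Set
x ≤ᴿ y = ¬ (y <ᴿ x)

fromℚ : ℚ → ℝ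
fromℚ q = mkℝ (λ _ → q) λ ε 0<ε → 0 , λ _ _ _ _ →
  subst (ℚ._< ε) (sym (cong ℚ.∣_∣ (ℚₚ.+-inverseʳ q))) 0<ε

fromℕ : ℕ → ℝ
fromℕ n = fromℚ (+ n ℚ./ 1)

0ᴿ : ℝ
0ᴿ = fromℕ 0

private
  open CommutativeSemigroupProperties
    (CommutativeMonoid.commutativeSemigroup ℚₚ.+-0-commutativeMonoid)
    using (interchange)

  half-pos : ∀ ε → 0ℚ ℚ.< ε → 0ℚ ℚ.< ½ ℚ.* ε
  half-pos ε 0<ε = subst (ℚ._< ½ ℚ.* ε) (ℚₚ.*-zeroʳ ½) (ℚₚ.*-monoʳ-<-pos ½ 0<ε)

  half+half : ∀ ε → ½ ℚ.* ε ℚ.+ ½ ℚ.* ε ≡ ε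
  half+half ε = trans (sym (ℚₚ.*-distribʳ-+ ε ½ ½)) (ℚₚ.*-identityˡ ε)

  +-cauchy : ∀ x y → IsCauchy x → IsCauchy y → IsCauchy (λ n → x n ℚ.+ y n)
  +-cauchy x y cx cy ε 0<ε
    with cx (½ ℚ.* ε) (half-pos ε 0<ε) | cy (½ ℚ.* ε) (half-pos ε 0<ε)
  ... | M , hx | N , hy = M ℕ.⊔ N , λ m n p q → begin-strict
    ℚ.∣ (x m ℚ.+ y m) ℚ.- (x n ℚ.+ y n) ∣
      ≡⟨ cong ℚ.∣_∣ (rearrange (x m) (y m) (x n) (y n)) ⟩
    ℚ.∣ (x m ℚ.- x n) ℚ.+ (y m ℚ.- y n) ∣
      ≤⟨ ℚₚ.∣p+q∣≤∣p∣+∣q∣ (x m ℚ.- x n) (y m ℚ.- y n) ⟩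
    ℚ.∣ x m ℚ.- x n ∣ ℚ.+ ℚ.∣ y m ℚ.- y n ∣
      <⟨ ℚₚ.+-mono-< (hx m n (ℕₚ.m⊔n≤o⇒m≤o M N p) (ℕₚ.m⊔n≤o⇒m≤o M N q))
                     (hy m n (ℕₚ.m⊔n≤o⇒n≤o M N p) (ℕₚ.m⊔n≤o⇒n≤o M N q)) ⟩
    ½ ℚ.* ε ℚ.+ ½ ℚ.* ε
      ≡⟨ half+half ε ⟩
    ε ∎
    where
    open ℚₚ.≤-Reasoning
    rearrange : ∀ a b c d → (a ℚ.+ b) ℚ.- (c ℚ.+ d) ≡ (a ℚ.- c) ℚ.+ (b ℚ.- d)
    rearrange a b c d = trans (cong ((a ℚ.+ b) ℚ.+_) (ℚₚ.neg-distrib-+ c d))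
      (interchange a b (ℚ.- c) (ℚ.- d))

  split : ∀ a b → a ≡ (a ℚ.- b) ℚ.+ b
  split a b = sym (trans (ℚₚ.+-assoc a (ℚ.- b) b)
    (trans (cong (a ℚ.+_) (ℚₚ.+-inverseˡ b)) (ℚₚ.+-identityʳ a)))

  bounded : ∀ x → IsCauchy x →
    ∃[ B ] (0ℚ ℚ.< B × ∃[ N ] (∀ n → N ℕ.≤ n → ℚ.∣ x n ∣ ℚ.≤ B))
  bounded x cx with cx 1ℚ (ℚₚ.positive⁻¹ 1ℚ)
  ... | N , h = 1ℚ ℚ.+ ℚ.∣ x N ∣
              , ℚₚ.+-mono-<-≤ (ℚₚ.positive⁻¹ 1ℚ) (ℚₚ.0≤∣p∣ (x N))
              , N , λ n p → begin
    ℚ.∣ x n ∣                          ≡⟨ cong ℚ.∣_∣ (split (x n) (x N)) ⟩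
    ℚ.∣ (x n ℚ.- x N) ℚ.+ x N ∣        ≤⟨ ℚₚ.∣p+q∣≤∣p∣+∣q∣ (x n ℚ.- x N) (x N) ⟩
    ℚ.∣ x n ℚ.- x N ∣ ℚ.+ ℚ.∣ x N ∣    ≤⟨ ℚₚ.+-monoˡ-≤ ℚ.∣ x N ∣ (ℚₚ.<⇒≤ (h n N p ℕₚ.≤-refl)) ⟩
    1ℚ ℚ.+ ℚ.∣ x N ∣                   ∎
    where
    open ℚₚ.≤-Reasoning

  *-cauchy : ∀ x y → IsCauchy x → IsCauchy y → IsCauchy (λ n → x n ℚ.* y n)
  *-cauchy x y cx cy ε 0<ε with bounded x cx | bounded y cy
  ... | B , 0<B , M , hB | C , 0<C , N , hC = result
    where
    instance
      B-pos : ℚ.Positive B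
      B-pos = ℚ.positive 0<B
      C-pos : ℚ.Positive C
      C-pos = ℚ.positive 0<C
      B+C-pos : ℚ.Positive (B ℚ.+ C)
      B+C-pos = ℚ.positive (ℚₚ.+-mono-< 0<B 0<C)
      B+C-nonZero : ℚ.NonZero (B ℚ.+ C)
      B+C-nonZero = ℚₚ.pos⇒nonZero (B ℚ.+ C)
    δ : ℚ
    δ = (ℚ.1/ (B ℚ.+ C)) ℚ.* ε
    0<δ : 0ℚ ℚ.< δ
    0<δ = subst (ℚ._< δ) (ℚₚ.*-zeroʳ (ℚ.1/ (B ℚ.+ C)))
      (ℚₚ.*-monoʳ-<-pos (ℚ.1/ (B ℚ.+ C)) {{ℚₚ.1/pos⇒pos (B ℚ.+ C)}} 0<ε)
    Bδ+Cδ : B ℚ.* δ ℚ.+ C ℚ.* δ ≡ ε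
    Bδ+Cδ = trans (sym (ℚₚ.*-distribʳ-+ δ B C))
      (trans (sym (ℚₚ.*-assoc (B ℚ.+ C) (ℚ.1/ (B ℚ.+ C)) ε))
      (trans (cong (ℚ._* ε) (ℚₚ.*-inverseʳ (B ℚ.+ C))) (ℚₚ.*-identityˡ ε)))
    rearrange : ∀ a b c d →
      a ℚ.* b ℚ.- c ℚ.* d ≡ a ℚ.* (b ℚ.- d) ℚ.+ d ℚ.* (a ℚ.- c)
    rearrange a b c d = sym (begin
      a ℚ.* (b ℚ.- d) ℚ.+ d ℚ.* (a ℚ.- c)
        ≡⟨ cong₂ ℚ._+_ (distrib a b d) (distrib d a c) ⟩
      (a ℚ.* b ℚ.- a ℚ.* d) ℚ.+ (d ℚ.* a ℚ.- d ℚ.* c)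
        ≡⟨ cong₂ (λ p q → (a ℚ.* b ℚ.- a ℚ.* d) ℚ.+ (p ℚ.- q)) (ℚₚ.*-comm d a) (ℚₚ.*-comm d c) ⟩
      (a ℚ.* b ℚ.- a ℚ.* d) ℚ.+ (a ℚ.* d ℚ.- c ℚ.* d)
        ≡⟨ ℚₚ.+-assoc (a ℚ.* b ℚ.- a ℚ.* d) (a ℚ.* d) (ℚ.- (c ℚ.* d)) ⟨
      ((a ℚ.* b ℚ.- a ℚ.* d) ℚ.+ a ℚ.* d) ℚ.- c ℚ.* d
        ≡⟨ cong (ℚ._- c ℚ.* d) (split (a ℚ.* b) (a ℚ.* d)) ⟨
      a ℚ.* b ℚ.- c ℚ.* d ∎)
      where
      open ≡-Reasoning
      distrib : ∀ p q r → p ℚ.* (q ℚ.- r) ≡ p ℚ.* q ℚ.- p ℚ.* r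
      distrib p q r = trans (ℚₚ.*-distribˡ-+ p q (ℚ.- r))
        (cong (p ℚ.* q ℚ.+_) (sym (ℚₚ.neg-distribʳ-* p r)))
    term : ∀ a d K → .{{ℚ.Positive K}} → ℚ.∣ a ∣ ℚ.≤ K → ℚ.∣ d ∣ ℚ.< δ →
      ℚ.∣ a ℚ.* d ∣ ℚ.< K ℚ.* δ
    term a d K a≤K d<δ = begin-strict
      ℚ.∣ a ℚ.* d ∣         ≡⟨ ℚₚ.∣p*q∣≡∣p∣*∣q∣ a d ⟩
      ℚ.∣ a ∣ ℚ.* ℚ.∣ d ∣   ≤⟨ ℚₚ.*-monoʳ-≤-nonNeg ℚ.∣ d ∣ {{ℚ.nonNegative (ℚₚ.0≤∣p∣ d)}} a≤K ⟩
      K ℚ.* ℚ.∣ d ∣         <⟨ ℚₚ.*-monoʳ-<-pos K d<δ ⟩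
      K ℚ.* δ               ∎
      where open ℚₚ.≤-Reasoning
    result : ∃[ L ] (∀ m n → L ℕ.≤ m → L ℕ.≤ n →
      ℚ.∣ x m ℚ.* y m ℚ.- x n ℚ.* y n ∣ ℚ.< ε)
    result with cx δ 0<δ | cy δ 0<δ
    ... | P , hx | Q , hy = (M ℕ.⊔ N) ℕ.⊔ (P ℕ.⊔ Q) , λ m n p q →
      let MN≤m = ℕₚ.m⊔n≤o⇒m≤o (M ℕ.⊔ N) (P ℕ.⊔ Q) p
          MN≤n = ℕₚ.m⊔n≤o⇒m≤o (M ℕ.⊔ N) (P ℕ.⊔ Q) q
          PQ≤m = ℕₚ.m⊔n≤o⇒n≤o (M ℕ.⊔ N) (P ℕ.⊔ Q) p
          PQ≤n = ℕₚ.m⊔n≤o⇒n≤o (M ℕ.⊔ N) (P ℕ.⊔ Q) q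
      in begin-strict
      ℚ.∣ x m ℚ.* y m ℚ.- x n ℚ.* y n ∣
        ≡⟨ cong ℚ.∣_∣ (rearrange (x m) (y m) (x n) (y n)) ⟩
      ℚ.∣ x m ℚ.* (y m ℚ.- y n) ℚ.+ y n ℚ.* (x m ℚ.- x n) ∣
        ≤⟨ ℚₚ.∣p+q∣≤∣p∣+∣q∣ (x m ℚ.* (y m ℚ.- y n)) (y n ℚ.* (x m ℚ.- x n)) ⟩
      ℚ.∣ x m ℚ.* (y m ℚ.- y n) ∣ ℚ.+ ℚ.∣ y n ℚ.* (x m ℚ.- x n) ∣
        <⟨ ℚₚ.+-mono-<
             (term (x m) (y m ℚ.- y n) B (hB m (ℕₚ.m⊔n≤o⇒m≤o M N MN≤m))
               (hy m n (ℕₚ.m⊔n≤o⇒n≤o P Q PQ≤m) (ℕₚ.m⊔n≤o⇒n≤o P Q PQ≤n)))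
             (term (y n) (x m ℚ.- x n) C (hC n (ℕₚ.m⊔n≤o⇒n≤o M N MN≤n))
               (hx m n (ℕₚ.m⊔n≤o⇒m≤o P Q PQ≤m) (ℕₚ.m⊔n≤o⇒m≤o P Q PQ≤n))) ⟩
      B ℚ.* δ ℚ.+ C ℚ.* δ
        ≡⟨ Bδ+Cδ ⟩
      ε ∎
      where open ℚₚ.≤-Reasoning

_+ᴿ_ : ℝ → ℝ → ℝ
mkℝ x cx +ᴿ mkℝ y cy = mkℝ (λ n → x n ℚ.+ y n) (+-cauchy x y cx cy)

_*ᴿ_ : ℝ → ℝ → ℝ
mkℝ x cx *ᴿ mkℝ y cy = mkℝ (λ n → x n ℚ.* y n) (*-cauchy x y cx cy)

Matrix : Set → ℕ → Set
Matrix A n = Fin n → Fin n → A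

∑ : ∀ {n} → Vector ℝ n → ℝ
∑ = Vector.foldr _+ᴿ_ 0ᴿ

_·_ : ∀ {n} → Matrix ℝ n → Vector ℝ n → Vector ℝ n
(M · x) i = ∑ (λ j → M i j *ᴿ x j)

-- "Nonzero eigenvector" is read negatively (not all entries vanish); classically
-- this is the same as some entry being nonzero.
IsEigenvalue : ∀ {n} → Matrix ℝ n → ℝ → Set
IsEigenvalue M μ = ∃[ x ] (¬ (∀ i → x i ≃ 0ᴿ) × (∀ i → (M · x) i ≃ μ *ᴿ x i))

IsLargestEigenvalue : ∀ {n} → Matrix ℝ n → ℝ → Set
IsLargestEigenvalue M ρ = IsEigenvalue M ρ × (∀ μ → IsEigenvalue M μ → μ ≤ᴿ ρ)

record Graph (n : ℕ) : Set where
  field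
    adj : Fin n → Fin n → Bool

  Adj : Fin n → Fin n → Set
  Adj u v = T (adj u v)

  field
    symmetric   : Symmetric Adj
    irreflexive : Irreflexive _≡_ Adj

  neighbours : Fin n → Subset n
  neighbours v = tabulate (adj v)

  degree : Fin n → ℕ
  degree v = ∣ neighbours v ∣

open Graph public

infix 4 _≐_ _≅_

_≐_ : ∀ {n} → Graph n → Graph n → Set
G ≐ H = ∀ u v → adj G u v ≡ adj H u v

_≅_ : ∀ {m n} → Graph m → Graph n → Set
_≅_ {m} {n} G H = Σ[ π ∈ Permutation m n ]
  (∀ u v → adj G u v ≡ adj H (π ⟨$⟩ʳ u) (π ⟨$⟩ʳ v))

K : ∀ n → Graph n
K n = record
  { adj         = λ u v → not ⌊ u ≟ v ⌋
  ; symmetric   = λ {u} {v} → K-sym u v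
  ; irreflexive = λ {u} {v} → K-irrefl u v
  }
  where
  K-sym : ∀ u v → T (not ⌊ u ≟ v ⌋) → T (not ⌊ v ≟ u ⌋)
  K-sym u v p with v ≟ u
  ... | no _ = tt
  ... | yes refl with u ≟ u
  ...   | no u≢u = ⊥-elim (u≢u refl)
  K-irrefl : ∀ u v → u ≡ v → ¬ T (not ⌊ u ≟ v ⌋)
  K-irrefl u v u≡v p with u ≟ v
  ... | no u≢v = u≢v u≡v

-- Vertices of the first graph come first in Fin (m + n); the Bool says whether
-- vertices on different sides are adjacent.
private
  combine : ∀ {m n} → Bool → Graph m → Graph n → Graph (m ℕ.+ n)
  combine {m} {n} b G H = record
    { adj         = λ u v → adj⊎ (splitAt m u) (splitAt m v)
    ; symmetric   = λ {u} {v} → sym⊎ (splitAt m u) (splitAt m v)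
    ; irreflexive = λ { {u} refl → irrefl⊎ (splitAt m u) }
    }
    where
    adj⊎ : Fin m ⊎ Fin n → Fin m ⊎ Fin n → Bool
    adj⊎ (inj₁ u) (inj₁ v) = adj G u v
    adj⊎ (inj₁ _) (inj₂ _) = b
    adj⊎ (inj₂ _) (inj₁ _) = b
    adj⊎ (inj₂ u) (inj₂ v) = adj H u v
    sym⊎ : ∀ s t → T (adj⊎ s t) → T (adj⊎ t s)
    sym⊎ (inj₁ _) (inj₁ _) = symmetric G
    sym⊎ (inj₁ _) (inj₂ _) p = p
    sym⊎ (inj₂ _) (inj₁ _) p = p
    sym⊎ (inj₂ _) (inj₂ _) = symmetric H
    irrefl⊎ : ∀ s → ¬ T (adj⊎ s s)
    irrefl⊎ (inj₁ _) = irreflexive G refl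
    irrefl⊎ (inj₂ _) = irreflexive H refl

infixr 6 _∨_
infixr 7 _∪_

_∨_ : ∀ {m n} → Graph m → Graph n → Graph (m ℕ.+ n)
_∨_ = combine true

_∪_ : ∀ {m n} → Graph m → Graph n → Graph (m ℕ.+ n)
_∪_ = combine false

degreeMatrix : ∀ {n} → Graph n → Matrix ℕ n
degreeMatrix G u v = if ⌊ u ≟ v ⌋ then degree G u else 0

adjacencyMatrix : ∀ {n} → Graph n → Matrix ℕ n
adjacencyMatrix G u v = if adj G u v then 1 else 0

signlessLaplacian : ∀ {n} → Graph n → Matrix ℝ n
signlessLaplacian G u v = fromℕ (degreeMatrix G u v ℕ.+ adjacencyMatrix G u v)

-- A relation rather than a function of G: it determines ρ up to _≃_.
IsSpectralRadiusS : ∀ {n} → Graph n → ℝ → Set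
IsSpectralRadiusS G ρ = IsLargestEigenvalue (signlessLaplacian G) ρ

next : ∀ {n} → Fin n → Fin n
next {suc n} i = suc (toℕ i) mod suc n

-- For n ≥ 3, a Hamiltonian cycle on Fin n is given by a cyclic ordering σ of the
-- vertices; its n distinct edges are {σ k , σ (next k)}.  The edge labelled i
-- is the one at position τ i.
RainbowHamiltonianCycle : ∀ {n} → (Fin n → Graph n) → Set
RainbowHamiltonianCycle {n} G =
  Σ[ σ ∈ Permutation′ n ] Σ[ τ ∈ Permutation′ n ]
    (∀ i → Adj (G i) (σ ⟨$⟩ʳ (τ ⟨$⟩ʳ i)) (σ ⟨$⟩ʳ next (τ ⟨$⟩ʳ i)))

{-# OPTIONS --safe #-}

-- Collatz–Wielandt with weights max(deg, 1) and the bound deg² + Σ (degrees of the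
-- neighbours) ≤ (2n - 4) deg, valid for graphs with at most (n-1)(n-2)/2 edges,
-- show that every Gᵢ lacks at most n - 2 edges. Kelmans transformations, applied to
-- all Gᵢ at once, preserve the numbers of edges, and a rainbow Hamiltonian cycle of
-- the transformed family can be rerouted to one of the original family. When no
-- transformation changes the family, the missing edges form threshold graphs, and
-- a zigzag cycle 0, n-1, 1, n-3, 2, n-4, …, n-2 uses at most one missing edge,
-- namely {n-2, 0}, whose label can be chosen freely; it fails only if every
-- complement is the star with centre 0 avoiding n-1. A family whose transform
-- consists of equal stars is itself of this form or has an explicit cycle.
module Submission where

open import Defs
open import Data.Bool.Base using (Bool; true; false; if_then_else_; not; T; _∧_) renaming (_∨_ to _∨ᵇ_)
import Data.Bool.Properties as Boolₚ
open import Data.Empty using (⊥-elim)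
open import Data.Fin.Base using (Fin; zero; suc; toℕ; splitAt; _↑ʳ_; cast)
open import Data.Fin.Permutation as Perm
  using (Permutation; Permutation′; cast-id; transpose; flip; _∘ₚ_; _⟨$⟩ʳ_; _⟨$⟩ˡ_; inverseʳ; inverseˡ)
import Data.Fin.Properties as Finₚ
open import Data.Fin.Properties using (_≟_)
open import Data.Fin.Subset using (∣_∣)
import Data.Integer.Base as ℤ
import Data.Integer.Properties as ℤₚ
open import Data.List.Base
  using (List; []; _∷_; _++_; _∷ʳ_; allFin; drop; iterate; length; lookup; map; tabulate; take)
import Data.List.Extrema
open import Data.List.Membership.DecPropositional using (_∈?_)
open import Data.List.Membership.Propositional using (_∈_; _∉_)
open import Data.List.Membership.Propositional.Properties using (∈-allFin; ∈-++⁺ˡ; ∈-++⁺ʳ; ∈-∃++)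
import Data.List.Properties as Listₚ
import Data.List.Relation.Binary.Permutation.Homogeneous as Homogeneous
open import Data.List.Relation.Binary.Permutation.Propositional
  using (_↭_; prep; swap; ↭-refl; ↭-reflexive; ↭-sym; ↭-trans; ↭⇒↭ₛ)
import Data.List.Relation.Binary.Permutation.Propositional.Properties as Permₚ
import Data.List.Relation.Binary.Permutation.Setoid.Properties as PermₛProperties
open import Data.List.Relation.Unary.All as All using (All; []; _∷_)
import Data.List.Relation.Unary.All.Properties as Allₚ
open import Data.List.Relation.Unary.AllPairs using ([]; _∷_)
open import Data.List.Relation.Unary.Any using (here; there)
open import Data.List.Relation.Unary.Linked using (Linked; []; [-]; _∷_)
import Data.List.Relation.Unary.Linked.Properties as Linkedₚ
open import Data.List.Relation.Unary.Unique.Propositional using (Unique)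
open import Data.List.Relation.Unary.Unique.Propositional.Properties using (allFin⁺)
open import Data.Nat.Base as ℕ using (ℕ; zero; suc; z≤n; s≤s; _+_; _*_; _∸_; _⊔_; _≤_; _<_)
import Data.Nat.DivMod as DivMod
open import Data.Nat.DivMod using (_mod_; m<n⇒m%n≡m)
open import Data.Nat.Induction using (<-wellFounded)
import Data.Nat.Properties as ℕₚ
open import Data.Nat.Tactic.RingSolver using (solve-∀)
open import Data.Product.Base using (Σ-syntax; ∃-syntax; _×_; _,_; proj₁; proj₂)
open import Data.Rational.Base as ℚ using (ℚ; 0ℚ; 1ℚ; _/_)
import Data.Rational.Properties as ℚₚ
open import Data.Rational.Solver using (module +-*-Solver)
import Data.Rational.Unnormalised.Base as ℚᵘ
import Data.Rational.Unnormalised.Properties as ℚᵘₚ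
open import Data.Sum.Base using (_⊎_; inj₁; inj₂; [_,_]′)
import Data.Vec.Base as Vec
open import Function.Base using (_∘_)
open import Induction.WellFounded using (Acc; acc)
open import Relation.Binary.Bundles using (DecTotalOrder)
open import Relation.Binary.Definitions using (tri<; tri≈; tri>)
open import Relation.Binary.PropositionalEquality
  using (_≡_; _≢_; refl; sym; trans; cong; cong₂; subst; subst₂; setoid; module ≡-Reasoning)
open import Relation.Nullary using (¬_; Dec; yes; no; contradiction)
open import Relation.Nullary.Decidable using (⌊_⌋; ¬?; _×-dec_)

open import Algebra.Properties.Semiring.Sum ℕₚ.+-*-semiring
  using (sum; sum-cong-≗; sum-replicate-zero; *-distribˡ-sum; *-distribʳ-sum; ∑-comm; ∑-distrib-+; ∑-permute)

-- Real approximants and eigenvalues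

-- The spectral bound is sharp for `K (n ∸ 1)` with an isolated vertex, and the extremal graph lacks
-- exactly `n - 2` edges; so counting alone cannot exclude it, and the structure of the missing
-- edges must decide. Rerouting works because every edge that a cycle of the transform has at `u`
-- exists, under the same label, at both `u` and `v` in the original, and every edge that it has at
-- `v` exists at one of them: the pieces between `u` and `v` can be reattached without touching a
-- label. The obstacle is that the exception does not pull back. Equal stars may arise from graphs
-- whose missing edges form double stars, with the leaves divided between the two centres
-- differently for each label. Two labels that divide them differently, or one label that divides
-- them properly, then leave enough freedom for a cycle. Labels are a minor matter throughout: all
-- edges of the explicit cycles but two are present in every graph, so only two labels have to be
-- chosen.

⟦_⟧ : ℕ → ℚ
⟦ n ⟧ = ℤ.+ n / 1

⟦⟧-homo-+ : ∀ m n → ⟦ m ℕ.+ n ⟧ ≡ ⟦ m ⟧ ℚ.+ ⟦ n ⟧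
⟦⟧-homo-+ m n = ℚₚ.toℚᵘ-injective (begin
  ℚ.toℚᵘ ⟦ m ℕ.+ n ⟧                  ≈⟨ ℚₚ.toℚᵘ-fromℚᵘ _ ⟩
  ℚᵘ.mkℚᵘ (ℤ.+ (m ℕ.+ n)) 0             ≈⟨ ℚᵘ.*≡* (cong (ℤ._* ℤ.+ 1) (sym (cong₂ ℤ._+_ (ℤₚ.*-identityʳ (ℤ.+ m)) (ℤₚ.*-identityʳ (ℤ.+ n))))) ⟩
  ℚᵘ.mkℚᵘ (ℤ.+ m) 0 ℚᵘ.+ ℚᵘ.mkℚᵘ (ℤ.+ n) 0 ≈⟨ ℚᵘₚ.+-cong (ℚₚ.toℚᵘ-fromℚᵘ (ℚᵘ.mkℚᵘ (ℤ.+ m) 0)) (ℚₚ.toℚᵘ-fromℚᵘ (ℚᵘ.mkℚᵘ (ℤ.+ n) 0)) ⟨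
  ℚ.toℚᵘ ⟦ m ⟧ ℚᵘ.+ ℚ.toℚᵘ ⟦ n ⟧      ≈⟨ ℚₚ.toℚᵘ-homo-+ ⟦ m ⟧ ⟦ n ⟧ ⟨
  ℚ.toℚᵘ (⟦ m ⟧ ℚ.+ ⟦ n ⟧)            ∎)
  where open ℚᵘₚ.≃-Reasoning

⟦⟧-homo-* : ∀ m n → ⟦ m ℕ.* n ⟧ ≡ ⟦ m ⟧ ℚ.* ⟦ n ⟧
⟦⟧-homo-* m n = ℚₚ.toℚᵘ-injective (begin
  ℚ.toℚᵘ ⟦ m ℕ.* n ⟧                  ≈⟨ ℚₚ.toℚᵘ-fromℚᵘ _ ⟩
  ℚᵘ.mkℚᵘ (ℤ.+ (m ℕ.* n)) 0             ≈⟨ ℚᵘ.*≡* (cong (ℤ._* ℤ.+ 1) (ℤₚ.pos-* m n)) ⟩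
  ℚᵘ.mkℚᵘ (ℤ.+ m) 0 ℚᵘ.* ℚᵘ.mkℚᵘ (ℤ.+ n) 0 ≈⟨ ℚᵘₚ.*-cong (ℚₚ.toℚᵘ-fromℚᵘ (ℚᵘ.mkℚᵘ (ℤ.+ m) 0)) (ℚₚ.toℚᵘ-fromℚᵘ (ℚᵘ.mkℚᵘ (ℤ.+ n) 0)) ⟨
  ℚ.toℚᵘ ⟦ m ⟧ ℚᵘ.* ℚ.toℚᵘ ⟦ n ⟧      ≈⟨ ℚₚ.toℚᵘ-homo-* ⟦ m ⟧ ⟦ n ⟧ ⟨
  ℚ.toℚᵘ (⟦ m ⟧ ℚ.* ⟦ n ⟧)            ∎)
  where open ℚᵘₚ.≃-Reasoning

⟦⟧-nonNeg : ∀ n → 0ℚ ℚ.≤ ⟦ n ⟧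
⟦⟧-nonNeg n = ℚₚ.nonNegative⁻¹ ⟦ n ⟧ {{ℚₚ.normalize-nonNeg n 1}}

⟦⟧-mono-≤ : ∀ {m n} → m ℕ.≤ n → ⟦ m ⟧ ℚ.≤ ⟦ n ⟧
⟦⟧-mono-≤ {m} {n} m≤n = begin
  ⟦ m ⟧                     ≡⟨ ℚₚ.+-identityʳ ⟦ m ⟧ ⟨
  ⟦ m ⟧ ℚ.+ 0ℚ              ≤⟨ ℚₚ.+-monoʳ-≤ ⟦ m ⟧ (⟦⟧-nonNeg (n ℕ.∸ m)) ⟩
  ⟦ m ⟧ ℚ.+ ⟦ n ℕ.∸ m ⟧     ≡⟨ ⟦⟧-homo-+ m (n ℕ.∸ m) ⟨
  ⟦ m ℕ.+ (n ℕ.∸ m) ⟧       ≡⟨ cong ⟦_⟧ (ℕₚ.m+[n∸m]≡n m≤n) ⟩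
  ⟦ n ⟧                     ∎
  where open ℚₚ.≤-Reasoning

*-monoˡ : ∀ {r p q} → 0ℚ ℚ.≤ r → p ℚ.≤ q → r ℚ.* p ℚ.≤ r ℚ.* q
*-monoˡ {r} 0≤r = ℚₚ.*-monoˡ-≤-nonNeg r {{ℚ.nonNegative 0≤r}}

*-monoʳ : ∀ {r p q} → 0ℚ ℚ.≤ r → p ℚ.≤ q → p ℚ.* r ℚ.≤ q ℚ.* r
*-monoʳ {r} 0≤r = ℚₚ.*-monoʳ-≤-nonNeg r {{ℚ.nonNegative 0≤r}}

argmax : ∀ {n} → Fin n → (f : Fin n → ℚ) → ∃[ u ] (∀ v → f v ℚ.≤ f u)
argmax {n} v₀ f = Extrema.argmax f v₀ (allFin n)
                , λ v → All.lookup (Extrema.f[xs]≤f[argmax] {f = f} v₀ (allFin n)) (∈-allFin v)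
  where module Extrema = Data.List.Extrema (DecTotalOrder.totalOrder ℚₚ.≤-decTotalOrder)

reciprocal : ∀ n → 1 ℕ.≤ n → ∃[ q ] (0ℚ ℚ.< q × q ℚ.* ⟦ n ⟧ ≡ 1ℚ)
reciprocal (suc n) _ = ℚ.1/ ⟦ suc n ⟧ , ℚₚ.positive⁻¹ _ {{ℚₚ.1/pos⇒pos ⟦ suc n ⟧}} , ℚₚ.*-inverseˡ ⟦ suc n ⟧
  where
  instance
    positive : ℚ.Positive ⟦ suc n ⟧
    positive = ℚₚ.normalize-pos (suc n) 1
    nonZero : ℚ.NonZero ⟦ suc n ⟧
    nonZero = ℚₚ.pos⇒nonZero ⟦ suc n ⟧

≤sum : ∀ {n} (f : Fin n → ℕ) i → f i ℕ.≤ sum f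
≤sum f zero    = ℕₚ.m≤m+n _ _
≤sum f (suc i) = ℕₚ.≤-trans (≤sum (f ∘ suc) i) (ℕₚ.m≤n+m _ _)

-- The Collatz–Wielandt bound, on rational approximants: if M x = μ x up to δ and
-- μ > c + γ, then all entries of x are O(δ), as one sees at a coordinate u
-- maximising |x u| / w u.
module _ {n} (S : Matrix ℝ n) (M : Fin n → Fin n → ℕ)
         (S≡M : ∀ u v k → seq (S u v) k ≡ ⟦ M u v ⟧) (w : Fin n → ℕ) (c : ℕ)
         (w≥1 : ∀ u → 1 ℕ.≤ w u)
         (Mw≤cw : ∀ u → sum (λ v → M u v ℕ.* w v) ℕ.≤ c ℕ.* w u) where

  approximate-row : ∀ {m} (s : Fin m → ℝ) (a : Fin m → ℕ) (x : Fin m → ℝ) R k →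
    (∀ v → seq (s v) k ≡ ⟦ a v ⟧) →
    (f : Fin m → ℕ) → (∀ v → ℚ.∣ seq (x v) k ∣ ℚ.≤ R ℚ.* ⟦ f v ⟧) →
    ℚ.∣ seq (∑ (λ v → s v *ᴿ x v)) k ∣ ℚ.≤ R ℚ.* ⟦ sum (λ v → a v ℕ.* f v) ⟧
  approximate-row {zero}  s a x R k s≡a f x≤ = ℚₚ.≤-reflexive (sym (ℚₚ.*-zeroʳ R))
  approximate-row {suc m} s a x R k s≡a f x≤ = begin
    ℚ.∣ seq (s zero) k ℚ.* x₀ ℚ.+ rest ∣
      ≡⟨ cong (λ z → ℚ.∣ z ℚ.* x₀ ℚ.+ rest ∣) (s≡a zero) ⟩
    ℚ.∣ ⟦ a zero ⟧ ℚ.* x₀ ℚ.+ rest ∣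
      ≤⟨ ℚₚ.∣p+q∣≤∣p∣+∣q∣ (⟦ a zero ⟧ ℚ.* x₀) rest ⟩
    ℚ.∣ ⟦ a zero ⟧ ℚ.* x₀ ∣ ℚ.+ ℚ.∣ rest ∣
      ≤⟨ ℚₚ.+-mono-≤ head≤ (approximate-row (s ∘ suc) (a ∘ suc) (x ∘ suc) R k (s≡a ∘ suc) (f ∘ suc) (x≤ ∘ suc)) ⟩
    R ℚ.* ⟦ a zero ℕ.* f zero ⟧ ℚ.+ R ℚ.* ⟦ tail ⟧
      ≡⟨ ℚₚ.*-distribˡ-+ R ⟦ a zero ℕ.* f zero ⟧ ⟦ tail ⟧ ⟨
    R ℚ.* (⟦ a zero ℕ.* f zero ⟧ ℚ.+ ⟦ tail ⟧)
      ≡⟨ cong (R ℚ.*_) (⟦⟧-homo-+ (a zero ℕ.* f zero) tail) ⟨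
    R ℚ.* ⟦ a zero ℕ.* f zero ℕ.+ tail ⟧ ∎
    where
    open ℚₚ.≤-Reasoning
    x₀ = seq (x zero) k
    rest = seq (∑ (λ v → s (suc v) *ᴿ x (suc v))) k
    tail = sum (λ v → a (suc v) ℕ.* f (suc v))
    head≤ : ℚ.∣ ⟦ a zero ⟧ ℚ.* x₀ ∣ ℚ.≤ R ℚ.* ⟦ a zero ℕ.* f zero ⟧
    head≤ = begin
      ℚ.∣ ⟦ a zero ⟧ ℚ.* x₀ ∣              ≡⟨ ℚₚ.∣p*q∣≡∣p∣*∣q∣ ⟦ a zero ⟧ x₀ ⟩
      ℚ.∣ ⟦ a zero ⟧ ∣ ℚ.* ℚ.∣ x₀ ∣        ≡⟨ cong (ℚ._* ℚ.∣ x₀ ∣) (ℚₚ.0≤p⇒∣p∣≡p (⟦⟧-nonNeg (a zero))) ⟩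
      ⟦ a zero ⟧ ℚ.* ℚ.∣ x₀ ∣              ≤⟨ *-monoˡ (⟦⟧-nonNeg (a zero)) (x≤ zero) ⟩
      ⟦ a zero ⟧ ℚ.* (R ℚ.* ⟦ f zero ⟧)    ≡⟨ solve 3 (λ a r f → a :* (r :* f) := r :* (a :* f)) refl ⟦ a zero ⟧ R ⟦ f zero ⟧ ⟩
      R ℚ.* (⟦ a zero ⟧ ℚ.* ⟦ f zero ⟧)    ≡⟨ cong (R ℚ.*_) (⟦⟧-homo-* (a zero) (f zero)) ⟨
      R ℚ.* ⟦ a zero ℕ.* f zero ⟧          ∎
      where open +-*-Solver using (solve; _:*_; _:=_)

  module _ (x : Fin n → ℝ) (μ : ℝ) (k : ℕ) {γ δ : ℚ} (0<γ : 0ℚ ℚ.< γ)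
           (gap : ⟦ c ⟧ ℚ.+ γ ℚ.< seq μ k)
           (close : ∀ u → ℚ.∣ seq (∑ (λ v → S u v *ᴿ x v)) k ℚ.- seq (μ *ᴿ x u) k ∣ ℚ.< δ) where

    open ℚₚ.≤-Reasoning
    open +-*-Solver using (solve; _:+_; _:*_; :-_; _:=_)

    ∣x∣ : Fin n → ℚ
    ∣x∣ v = ℚ.∣ seq (x v) k ∣

    entry-small : ∀ v → γ ℚ.* ∣x∣ v ℚ.< δ ℚ.* ⟦ sum w ⟧
    entry-small v₀ = begin-strict
      γ ℚ.* ∣x∣ v₀                       ≤⟨ *-monoˡ (ℚₚ.<⇒≤ 0<γ) x₀≤ ⟩
      γ ℚ.* (∣x∣ u ℚ.* ⟦ sum w ⟧)        ≡⟨ ℚₚ.*-assoc γ (∣x∣ u) ⟦ sum w ⟧ ⟨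
      γ ℚ.* ∣x∣ u ℚ.* ⟦ sum w ⟧          <⟨ ℚₚ.*-monoˡ-<-pos ⟦ sum w ⟧ {{T>0}} xᵤ-small ⟩
      δ ℚ.* ⟦ sum w ⟧                    ∎
      where
      w⁻¹ : Fin n → ℚ
      w⁻¹ v = proj₁ (reciprocal (w v) (w≥1 v))
      0≤w⁻¹ : ∀ v → 0ℚ ℚ.≤ w⁻¹ v
      0≤w⁻¹ v = ℚₚ.<⇒≤ (proj₁ (proj₂ (reciprocal (w v) (w≥1 v))))
      ratio : Fin n → ℚ
      ratio v = ∣x∣ v ℚ.* w⁻¹ v
      ratio*w : ∀ v → ratio v ℚ.* ⟦ w v ⟧ ≡ ∣x∣ v
      ratio*w v = begin-equality
        ∣x∣ v ℚ.* w⁻¹ v ℚ.* ⟦ w v ⟧     ≡⟨ ℚₚ.*-assoc (∣x∣ v) (w⁻¹ v) ⟦ w v ⟧ ⟩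
        ∣x∣ v ℚ.* (w⁻¹ v ℚ.* ⟦ w v ⟧)   ≡⟨ cong (∣x∣ v ℚ.*_) (proj₂ (proj₂ (reciprocal (w v) (w≥1 v)))) ⟩
        ∣x∣ v ℚ.* 1ℚ                    ≡⟨ ℚₚ.*-identityʳ (∣x∣ v) ⟩
        ∣x∣ v                           ∎
      u = proj₁ (argmax v₀ ratio)
      R = ratio u
      ≤Rw : ∀ v → ∣x∣ v ℚ.≤ R ℚ.* ⟦ w v ⟧
      ≤Rw v = begin
        ∣x∣ v               ≡⟨ ratio*w v ⟨
        ratio v ℚ.* ⟦ w v ⟧ ≤⟨ *-monoʳ (⟦⟧-nonNeg (w v)) (proj₂ (argmax v₀ ratio) v) ⟩
        R ℚ.* ⟦ w v ⟧       ∎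
      0≤R : 0ℚ ℚ.≤ R
      0≤R = ℚₚ.≤-trans (ℚₚ.≤-reflexive (sym (ℚₚ.*-zeroˡ (w⁻¹ u)))) (*-monoʳ (0≤w⁻¹ u) (ℚₚ.0≤∣p∣ (seq (x u) k)))
      -- Weights of at least 1 bound the maximal ratio by the entry at `u` itself, so a bound on
      -- this single entry controls all others up to the factor `sum w`.
      R≤xᵤ : R ℚ.≤ ∣x∣ u
      R≤xᵤ = begin
        R               ≡⟨ ℚₚ.*-identityʳ R ⟨
        R ℚ.* 1ℚ        ≤⟨ *-monoˡ 0≤R (⟦⟧-mono-≤ (w≥1 u)) ⟩
        R ℚ.* ⟦ w u ⟧   ≡⟨ ratio*w u ⟩
        ∣x∣ u           ∎
      x₀≤ : ∣x∣ v₀ ℚ.≤ ∣x∣ u ℚ.* ⟦ sum w ⟧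
      x₀≤ = begin
        ∣x∣ v₀                  ≤⟨ ≤Rw v₀ ⟩
        R ℚ.* ⟦ w v₀ ⟧          ≤⟨ *-monoʳ (⟦⟧-nonNeg (w v₀)) R≤xᵤ ⟩
        ∣x∣ u ℚ.* ⟦ w v₀ ⟧      ≤⟨ *-monoˡ (ℚₚ.0≤∣p∣ (seq (x u) k)) (⟦⟧-mono-≤ (≤sum w v₀)) ⟩
        ∣x∣ u ℚ.* ⟦ sum w ⟧     ∎
      T>0 : ℚ.Positive ⟦ sum w ⟧
      T>0 = ℚ.positive (ℚₚ.<-≤-trans (ℚₚ.positive⁻¹ 1ℚ) (⟦⟧-mono-≤ (ℕₚ.≤-trans (w≥1 v₀) (≤sum w v₀))))
      Mx = seq (∑ (λ v → S u v *ᴿ x v)) k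
      μx = seq μ k ℚ.* seq (x u) k
      ∣Mx∣≤ : ℚ.∣ Mx ∣ ℚ.≤ ⟦ c ⟧ ℚ.* ∣x∣ u
      ∣Mx∣≤ = begin
        ℚ.∣ Mx ∣                               ≤⟨ approximate-row (S u) (M u) x R k (λ v → S≡M u v k) w ≤Rw ⟩
        R ℚ.* ⟦ sum (λ v → M u v ℕ.* w v) ⟧    ≤⟨ *-monoˡ 0≤R (⟦⟧-mono-≤ (Mw≤cw u)) ⟩
        R ℚ.* ⟦ c ℕ.* w u ⟧                    ≡⟨ cong (R ℚ.*_) (⟦⟧-homo-* c (w u)) ⟩
        R ℚ.* (⟦ c ⟧ ℚ.* ⟦ w u ⟧)              ≡⟨ solve 3 (λ r c w → r :* (c :* w) := c :* (r :* w)) refl R ⟦ c ⟧ ⟦ w u ⟧ ⟩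
        ⟦ c ⟧ ℚ.* (R ℚ.* ⟦ w u ⟧)              ≡⟨ cong (⟦ c ⟧ ℚ.*_) (ratio*w u) ⟩
        ⟦ c ⟧ ℚ.* ∣x∣ u                        ∎
      0≤⟦c⟧+γ : 0ℚ ℚ.≤ ⟦ c ⟧ ℚ.+ γ
      0≤⟦c⟧+γ = ℚₚ.+-mono-≤ (⟦⟧-nonNeg c) (ℚₚ.<⇒≤ 0<γ)
      cx+γx<cx+δ : ⟦ c ⟧ ℚ.* ∣x∣ u ℚ.+ γ ℚ.* ∣x∣ u ℚ.< ⟦ c ⟧ ℚ.* ∣x∣ u ℚ.+ δ
      cx+γx<cx+δ = begin-strict
        ⟦ c ⟧ ℚ.* ∣x∣ u ℚ.+ γ ℚ.* ∣x∣ u        ≡⟨ ℚₚ.*-distribʳ-+ (∣x∣ u) ⟦ c ⟧ γ ⟨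
        (⟦ c ⟧ ℚ.+ γ) ℚ.* ∣x∣ u                ≤⟨ *-monoʳ (ℚₚ.0≤∣p∣ (seq (x u) k)) (ℚₚ.<⇒≤ gap) ⟩
        seq μ k ℚ.* ∣x∣ u                      ≡⟨ cong (ℚ._* ∣x∣ u) (ℚₚ.0≤p⇒∣p∣≡p (ℚₚ.≤-trans 0≤⟦c⟧+γ (ℚₚ.<⇒≤ gap))) ⟨
        ℚ.∣ seq μ k ∣ ℚ.* ∣x∣ u                ≡⟨ ℚₚ.∣p*q∣≡∣p∣*∣q∣ (seq μ k) (seq (x u) k) ⟨
        ℚ.∣ μx ∣                               ≡⟨ cong ℚ.∣_∣ (solve 2 (λ m p → p := m :+ (:- (m :+ (:- p)))) refl Mx μx) ⟩
        ℚ.∣ Mx ℚ.- (Mx ℚ.- μx) ∣               ≤⟨ ℚₚ.∣p-q∣≤∣p∣+∣q∣ Mx (Mx ℚ.- μx) ⟩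
        ℚ.∣ Mx ∣ ℚ.+ ℚ.∣ Mx ℚ.- μx ∣           <⟨ ℚₚ.+-mono-≤-< ∣Mx∣≤ (close u) ⟩
        ⟦ c ⟧ ℚ.* ∣x∣ u ℚ.+ δ                  ∎
      xᵤ-small : γ ℚ.* ∣x∣ u ℚ.< δ
      xᵤ-small = begin-strict
        γ ℚ.* ∣x∣ u                                  ≡⟨ cancel (⟦ c ⟧ ℚ.* ∣x∣ u) (γ ℚ.* ∣x∣ u) ⟩
        (⟦ c ⟧ ℚ.* ∣x∣ u ℚ.+ γ ℚ.* ∣x∣ u) ℚ.- ⟦ c ⟧ ℚ.* ∣x∣ u <⟨ ℚₚ.+-monoˡ-< (ℚ.- (⟦ c ⟧ ℚ.* ∣x∣ u)) cx+γx<cx+δ ⟩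
        (⟦ c ⟧ ℚ.* ∣x∣ u ℚ.+ δ) ℚ.- ⟦ c ⟧ ℚ.* ∣x∣ u  ≡⟨ cancel (⟦ c ⟧ ℚ.* ∣x∣ u) δ ⟨
        δ                                            ∎
        where
        cancel : ∀ p q → q ≡ (p ℚ.+ q) ℚ.- p
        cancel = solve 2 (λ p q → q := (p :+ q) :+ (:- p)) refl

  -- The sum of the finitely many thresholds serves in place of their maximum.
  uniform : ∀ {m} (P : Fin m → ℕ → Set) → (∀ i → ∃[ N ] (∀ k → N ℕ.≤ k → P i k)) →
    ∃[ N ] (∀ i k → N ℕ.≤ k → P i k)
  uniform {m} P f = sum (λ i → proj₁ (f i))
    , λ i k N≤k → proj₂ (f i) k (ℕₚ.≤-trans (≤sum (λ i → proj₁ (f i)) i) N≤k)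

  -- At every large index the approximants satisfy the eigenvalue equation up to `δ`, which makes
  -- every entry small. Since being nonzero is stated negatively, it is enough that all entries
  -- vanish in the limit; no entry bounded away from zero has to be found.
  eigenvalue≤ : ∀ μ → IsEigenvalue S μ → ¬ (fromℕ c <ᴿ μ)
  eigenvalue≤ μ (x , x≢0 , Mx≃μx) (γ , 0<γ , N₀ , gap) = x≢0 x≃0
    where
    x≃0 : ∀ i → x i ≃ 0ᴿ
    x≃0 i ε 0<ε = N₀ ℕ.⊔ N₁ , λ k N≤k →
      subst (ℚ._< ε) (cong ℚ.∣_∣ (sym (ℚₚ.+-identityʳ (seq (x i) k))))
        (ℚₚ.*-cancelˡ-<-nonNeg γ {{ℚ.nonNegative (ℚₚ.<⇒≤ 0<γ)}}
          (subst (γ ℚ.* ℚ.∣ seq (x i) k ∣ ℚ.<_) δT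
            (entry-small x μ k 0<γ (gap k (ℕₚ.m⊔n≤o⇒m≤o N₀ N₁ N≤k))
              (λ u → close u k (ℕₚ.m⊔n≤o⇒n≤o N₀ N₁ N≤k)) i)))
      where
      T≥1 : 1 ℕ.≤ sum w
      T≥1 = ℕₚ.≤-trans (w≥1 i) (≤sum w i)
      T⁻¹ = proj₁ (reciprocal (sum w) T≥1)
      -- Chosen so that the bound `δ ℚ.* ⟦ sum w ⟧` of `entry-small` equals `γ ℚ.* ε`, from which
      -- `γ` cancels.
      δ = γ ℚ.* ε ℚ.* T⁻¹
      δT : δ ℚ.* ⟦ sum w ⟧ ≡ γ ℚ.* ε
      δT = trans (ℚₚ.*-assoc (γ ℚ.* ε) T⁻¹ ⟦ sum w ⟧)
        (trans (cong (γ ℚ.* ε ℚ.*_) (proj₂ (proj₂ (reciprocal (sum w) T≥1)))) (ℚₚ.*-identityʳ (γ ℚ.* ε)))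
      *-pos : ∀ {p q} → 0ℚ ℚ.< p → 0ℚ ℚ.< q → 0ℚ ℚ.< p ℚ.* q
      *-pos {p} {q} 0<p 0<q = subst (ℚ._< p ℚ.* q) (ℚₚ.*-zeroʳ p) (ℚₚ.*-monoʳ-<-pos p {{ℚ.positive 0<p}} 0<q)
      0<δ : 0ℚ ℚ.< δ
      0<δ = *-pos (*-pos 0<γ 0<ε) (proj₁ (proj₂ (reciprocal (sum w) T≥1)))
      eventually = uniform (λ u k → ℚ.∣ seq (∑ (λ v → S u v *ᴿ x v)) k ℚ.- seq (μ *ᴿ x u) k ∣ ℚ.< δ)
        (λ u → Mx≃μx u δ 0<δ)
      N₁ = proj₁ eventually
      close = proj₂ eventually

-- Degree sums

sum-mono : ∀ {n} {f g : Fin n → ℕ} → (∀ i → f i ≤ g i) → sum f ≤ sum g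
sum-mono {zero}  f≤g = z≤n
sum-mono {suc n} f≤g = ℕₚ.+-mono-≤ (f≤g zero) (sum-mono (f≤g ∘ suc))

sum-one : ∀ n → sum {n} (λ _ → 1) ≡ n
sum-one zero    = refl
sum-one (suc n) = cong suc (sum-one n)

𝟙 : Bool → ℕ
𝟙 b = if b then 1 else 0

δ : ∀ {n} → Fin n → Fin n → ℕ
δ u v = 𝟙 ⌊ u ≟ v ⌋

δ-suc : ∀ {n} (u v : Fin n) → δ (suc u) (suc v) ≡ δ u v
δ-suc u v with u ≟ v
... | yes _ = refl
... | no  _ = refl

sum-δ : ∀ {n} (u : Fin n) (f : Fin n → ℕ) → sum (λ v → δ u v * f v) ≡ f u
sum-δ {suc n} zero f = begin
  f zero + 0 + sum {n} (λ _ → 0) ≡⟨ cong (f zero + 0 +_) (sum-replicate-zero n) ⟩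
  f zero + 0 + 0                 ≡⟨ trans (ℕₚ.+-identityʳ _) (ℕₚ.+-identityʳ _) ⟩
  f zero                         ∎
  where open ≡-Reasoning
sum-δ {suc n} (suc u) f =
  trans (sum-cong-≗ (λ v → cong (_* f (suc v)) (δ-suc u v))) (sum-δ u (f ∘ suc))

sum-δ₁ : ∀ {n} (u : Fin n) → sum (δ u) ≡ 1
sum-δ₁ u = trans (sum-cong-≗ (λ v → sym (ℕₚ.*-identityʳ (δ u v)))) (sum-δ u (λ _ → 1))

-- For a vertex u: d is its degree, s the degree sum of its neighbours, e the number
-- of edges from these to the r vertices outside the closed neighbourhood; t is the
-- degree sum of the graph.
merris-arithmetic : ∀ d r s e t → 1 ≤ d →
  d + s + e ≤ t → s ≤ d * d + e → e ≤ d * r →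
  t + (d + r) ≤ (d + r) * (d + r) →
  d * d + s + 2 * d ≤ 2 * (d + r) * d
merris-arithmetic d@(suc d′) r s e t _ h₁ h₂ h₃ h₄ = ℕₚ.*-cancelˡ-≤ k scaled
  where
  open ℕₚ.≤-Reasoning
  k = d + r
  -- `d` times the edge count plus `r` times the bound on `s`: the two coefficients of `s` add up to
  -- `k`, which is why the goal is scaled by `k`.
  combined : k * s + d * d + d * e + d * k ≤ d * (k * k) + r * (d * d) + r * e
  combined = begin
    k * s + d * d + d * e + d * k          ≡⟨ solve-∀′ d r s e ⟩
    d * (d + s + e + k) + r * s            ≤⟨ ℕₚ.+-mono-≤ (ℕₚ.*-monoʳ-≤ d (ℕₚ.≤-trans (ℕₚ.+-monoˡ-≤ k h₁) h₄)) (ℕₚ.*-monoʳ-≤ r h₂) ⟩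
    d * (k * k) + r * (d * d + e)          ≡⟨ cong (d * (k * k) +_) (ℕₚ.*-distribˡ-+ r (d * d) e) ⟩
    d * (k * k) + (r * (d * d) + r * e)    ≡⟨ ℕₚ.+-assoc (d * (k * k)) (r * (d * d)) (r * e) ⟨
    d * (k * k) + r * (d * d) + r * e      ∎
    where
    solve-∀′ : ∀ d r s e → (d + r) * s + d * d + d * e + d * (d + r) ≡ d * (d + s + e + (d + r)) + r * s
    solve-∀′ = solve-∀
  -- `x` absorbs whatever part of `r * e` exceeds the `d * e` on the left; once `e` has cancelled,
  -- only an inequality between `d`, `r` and `x` remains.
  finish : ∀ x → r * e ≤ d * e + x → d * (k * k) + r * (d * d) + x + k * (d * d) + k * d ≤ 2 * k * d * k + d * d →
    k * (d * d + s + 2 * d) ≤ k * (2 * k * d)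
  finish x re≤ h = ℕₚ.+-cancelʳ-≤ (d * d + d * e) _ _ (begin
    k * (d * d + s + 2 * d) + (d * d + d * e)
      ≡⟨ e₁ d k s e ⟩
    (k * s + d * d + d * e + d * k) + (k * (d * d) + k * d)
      ≤⟨ ℕₚ.+-monoˡ-≤ (k * (d * d) + k * d) combined ⟩
    (d * (k * k) + r * (d * d) + r * e) + (k * (d * d) + k * d)
      ≤⟨ ℕₚ.+-monoˡ-≤ (k * (d * d) + k * d) (ℕₚ.+-monoʳ-≤ (d * (k * k) + r * (d * d)) re≤) ⟩
    (d * (k * k) + r * (d * d) + (d * e + x)) + (k * (d * d) + k * d)
      ≡⟨ e₂ d k r e x ⟩
    (d * (k * k) + r * (d * d) + x + k * (d * d) + k * d) + d * e
      ≤⟨ ℕₚ.+-monoˡ-≤ (d * e) h ⟩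
    2 * k * d * k + d * d + d * e
      ≡⟨ e₃ d k e ⟩
    k * (2 * k * d) + (d * d + d * e) ∎)
    where
    e₁ : ∀ d k s e → k * (d * d + s + 2 * d) + (d * d + d * e) ≡ (k * s + d * d + d * e + d * k) + (k * (d * d) + k * d)
    e₁ = solve-∀
    e₂ : ∀ d k r e x → (d * (k * k) + r * (d * d) + (d * e + x)) + (k * (d * d) + k * d) ≡ (d * (k * k) + r * (d * d) + x + k * (d * d) + k * d) + d * e
    e₂ = solve-∀
    e₃ : ∀ d k e → 2 * k * d * k + d * d + d * e ≡ k * (2 * k * d) + (d * d + d * e)
    e₃ = solve-∀
  r≤r*r : ∀ r → r ≤ r * r
  r≤r*r zero    = z≤n
  r≤r*r (suc r) = ℕₚ.m≤m+n (suc r) (r * suc r)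
  scaled : k * (d * d + s + 2 * d) ≤ k * (2 * k * d)
  scaled with ℕₚ.≤-total r d
  -- There is no excess here, and the remaining inequality amounts to `r ≤ r * r`.
  ... | inj₁ r≤d = finish 0 (ℕₚ.≤-trans (ℕₚ.*-monoˡ-≤ e r≤d) (ℕₚ.≤-reflexive (sym (ℕₚ.+-identityʳ _)))) (begin
    d * (k * k) + r * (d * d) + 0 + k * (d * d) + k * d
      ≤⟨ ℕₚ.m≤m+n _ (d * (r * r ∸ r)) ⟩
    d * (k * k) + r * (d * d) + 0 + k * (d * d) + k * d + d * (r * r ∸ r)
      ≡⟨ f₁ d r (r * r ∸ r) ⟩
    d * ((d + r) * (d + r) + r * d + (d + r) * d + d + (r + (r * r ∸ r)))
      ≡⟨ cong (λ z → d * ((d + r) * (d + r) + r * d + (d + r) * d + d + z)) (ℕₚ.m+[n∸m]≡n (r≤r*r r)) ⟩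
    d * ((d + r) * (d + r) + r * d + (d + r) * d + d + r * r)
      ≡⟨ f₂ d r ⟩
    2 * k * d * k + d * d ∎)
    where
    f₁ : ∀ d r x → d * ((d + r) * (d + r)) + r * (d * d) + 0 + (d + r) * (d * d) + (d + r) * d + d * x ≡ d * ((d + r) * (d + r) + r * d + (d + r) * d + d + (r + x))
    f₁ = solve-∀
    f₂ : ∀ d r → d * ((d + r) * (d + r) + r * d + (d + r) * d + d + r * r) ≡ 2 * (d + r) * d * (d + r) + d * d
    f₂ = solve-∀
  -- The excess `(r ∸ d) * e` is bounded through `e ≤ d * r`; the remaining inequality amounts to
  -- `r ≤ d * r`, true as `d` is positive.
  ... | inj₂ d≤r = finish (q * (d * r)) (begin
    r * e               ≡⟨ cong (_* e) (ℕₚ.m+[n∸m]≡n d≤r) ⟨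
    (d + q) * e         ≡⟨ ℕₚ.*-distribʳ-+ e d q ⟩
    d * e + q * e       ≤⟨ ℕₚ.+-monoʳ-≤ (d * e) (ℕₚ.*-monoʳ-≤ q h₃) ⟩
    d * e + q * (d * r) ∎) (begin
    d * (k * k) + r * (d * d) + q * (d * r) + k * (d * d) + k * d
      ≡⟨ g₁ d q r k ⟩
    d * (k * k + r * (d + q) + k * d + k)
      ≡⟨ cong (λ z → d * (k * k + r * z + k * d + k)) (ℕₚ.m+[n∸m]≡n d≤r) ⟩
    d * (k * k + r * r + k * d + k)
      ≤⟨ ℕₚ.m≤m+n _ (d * (d′ * r)) ⟩
    d * (k * k + r * r + k * d + k) + d * (d′ * r)
      ≡⟨ g₂ d′ r ⟩
    2 * k * d * k + d * d ∎)
    where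
    q = r ∸ d
    g₁ : ∀ d q r k → d * (k * k) + r * (d * d) + q * (d * r) + k * (d * d) + k * d ≡ d * (k * k + r * (d + q) + k * d + k)
    g₁ = solve-∀
    g₂ : ∀ x r → (1 + x) * ((1 + x + r) * (1 + x + r) + r * r + (1 + x + r) * (1 + x) + (1 + x + r)) + (1 + x) * (x * r) ≡ 2 * (1 + x + r) * (1 + x) * (1 + x + r) + (1 + x) * (1 + x)
    g₂ = solve-∀

-- Merris's degree bound at a vertex.

module DegreeSum {k} (a : Fin (suc k) → Fin (suc k) → ℕ)
         (a≤1 : ∀ u v → a u v ≤ 1) (a-sym : ∀ u v → a u v ≡ a v u) (a-irr : ∀ u → a u u ≡ 0)
         (few : sum (λ u → sum (a u)) + k ≤ k * k) where

  deg : Fin (suc k) → ℕ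
  deg u = sum (a u)

  module _ (u : Fin (suc k)) where
    open ℕₚ.≤-Reasoning

    -- Indicator of the vertices outside the closed neighbourhood of `u`; `partition` shows that the
    -- truncated subtraction is exact.
    c : Fin (suc k) → ℕ
    c v = 1 ∸ (δ u v + a u v)

    partition : ∀ v → δ u v + a u v + c v ≡ 1
    partition v = ℕₚ.m+[n∸m]≡n bound
      where
      bound : δ u v + a u v ≤ 1
      bound with u ≟ v
      ... | yes refl = ℕₚ.≤-reflexive (cong suc (a-irr u))
      ... | no _     = a≤1 u v

    sum-partition : (f : Fin (suc k) → ℕ) →
      sum f ≡ f u + sum (λ v → a u v * f v) + sum (λ v → c v * f v)
    sum-partition f = begin-equality
      sum f
        ≡⟨ sum-cong-≗ (λ v → trans (sym (ℕₚ.*-identityˡ (f v))) (cong (_* f v) (sym (partition v)))) ⟩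
      sum (λ v → (δ u v + a u v + c v) * f v)
        ≡⟨ sum-cong-≗ (λ v → expand (δ u v) (a u v) (c v) (f v)) ⟩
      sum (λ v → (δ u v * f v + a u v * f v) + c v * f v)
        ≡⟨ ∑-distrib-+ (λ v → δ u v * f v + a u v * f v) (λ v → c v * f v) ⟩
      sum (λ v → δ u v * f v + a u v * f v) + sum (λ v → c v * f v)
        ≡⟨ cong (_+ sum (λ v → c v * f v)) (∑-distrib-+ (λ v → δ u v * f v) (λ v → a u v * f v)) ⟩
      sum (λ v → δ u v * f v) + sum (λ v → a u v * f v) + sum (λ v → c v * f v)
        ≡⟨ cong (λ z → z + sum (λ v → a u v * f v) + sum (λ v → c v * f v)) (sum-δ u f) ⟩
      f u + sum (λ v → a u v * f v) + sum (λ v → c v * f v) ∎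
      where
      expand : ∀ p q r x → (p + q + r) * x ≡ (p * x + q * x) + r * x
      expand = solve-∀

    r s e : ℕ
    r = sum c
    s = sum (λ v → a u v * deg v)
    e = sum (λ v → a u v * sum (λ w → c w * a v w))

    d+r≡k : deg u + r ≡ k
    d+r≡k = ℕₚ.suc-injective (begin-equality
      1 + deg u + r                                        ≡⟨ cong₂ (λ x y → 1 + x + y) (sum-cong-≗ (λ v → sym (ℕₚ.*-identityʳ (a u v)))) (sum-cong-≗ (λ v → sym (ℕₚ.*-identityʳ (c v)))) ⟩
      1 + sum (λ v → a u v * 1) + sum (λ v → c v * 1)      ≡⟨ sum-partition (λ _ → 1) ⟨
      sum {suc k} (λ _ → 1)                                ≡⟨ sum-one (suc k) ⟩
      suc k                                                ∎)

    -- Each edge counted by `e` is also counted in the degree of its end outside the closed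
    -- neighbourhood.
    e≤ : e ≤ sum (λ v → c v * deg v)
    e≤ = begin
      sum (λ v → a u v * sum (λ w → c w * a v w))
        ≡⟨ sum-cong-≗ (λ v → *-distribˡ-sum (a u v) (λ w → c w * a v w)) ⟩
      sum (λ v → sum (λ w → a u v * (c w * a v w)))
        ≡⟨ ∑-comm (λ v w → a u v * (c w * a v w)) ⟩
      sum (λ w → sum (λ v → a u v * (c w * a v w)))
        ≤⟨ sum-mono (λ w → sum-mono (λ v → ℕₚ.≤-trans (ℕₚ.*-monoˡ-≤ (c w * a v w) (a≤1 u v)) (ℕₚ.≤-reflexive (trans (ℕₚ.*-identityˡ _) (cong (c w *_) (a-sym v w)))))) ⟩
      sum (λ w → sum (λ v → c w * a w v))
        ≡⟨ sum-cong-≗ (λ w → sym (*-distribˡ-sum (c w) (a w))) ⟩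
      sum (λ w → c w * deg w) ∎

    d+s+e≤t : deg u + s + e ≤ sum deg
    d+s+e≤t = ℕₚ.≤-trans (ℕₚ.+-monoʳ-≤ (deg u + s) e≤) (ℕₚ.≤-reflexive (sym (sum-partition deg)))

    -- `v` is a neighbour of `u` but not of itself, so its own place among the neighbours of `u`
    -- pays for the edge `vu`.
    common≤ : ∀ v → a u v ≡ 1 → a v u + sum (λ w → a u w * a v w) ≤ deg u
    common≤ v uv = ℕₚ.≤-trans (ℕₚ.+-monoˡ-≤ (sum (λ w → a u w * a v w)) (a≤1 v u)) (begin
      1 + sum (λ w → a u w * a v w)                 ≡⟨ cong (_+ sum (λ w → a u w * a v w)) (sum-δ₁ v) ⟨
      sum (δ v) + sum (λ w → a u w * a v w)         ≡⟨ ∑-distrib-+ (δ v) (λ w → a u w * a v w) ⟨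
      sum (λ w → δ v w + a u w * a v w)             ≤⟨ sum-mono pointwise ⟩
      deg u                                         ∎)
      where
      pointwise : ∀ w → δ v w + a u w * a v w ≤ a u w
      pointwise w with v ≟ w
      ... | yes refl = ℕₚ.≤-reflexive (trans (cong (λ z → 1 + a u v * z) (a-irr v)) (trans (cong suc (ℕₚ.*-zeroʳ (a u v))) (sym uv)))
      ... | no _     = ℕₚ.≤-trans (ℕₚ.*-monoʳ-≤ (a u w) (a≤1 v w)) (ℕₚ.≤-reflexive (ℕₚ.*-identityʳ (a u w)))

    -- The edges at a neighbour `v` of `u` go to `u`, to other neighbours of `u`, or to outside
    -- vertices. The first two kinds number at most `deg u` by `common≤`; the last kind makes up
    -- `e`.
    s≤ : s ≤ deg u * deg u + e
    s≤ = begin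
      sum (λ v → a u v * deg v)
        ≤⟨ sum-mono pointwise ⟩
      sum (λ v → a u v * deg u + a u v * sum (λ w → c w * a v w))
        ≡⟨ ∑-distrib-+ (λ v → a u v * deg u) (λ v → a u v * sum (λ w → c w * a v w)) ⟩
      sum (λ v → a u v * deg u) + e
        ≡⟨ cong (_+ e) (sym (*-distribʳ-sum (deg u) (a u))) ⟩
      deg u * deg u + e ∎
      where
      pointwise : ∀ v → a u v * deg v ≤ a u v * deg u + a u v * sum (λ w → c w * a v w)
      pointwise v with a u v in uv | a≤1 u v
      ... | zero  | _       = z≤n
      ... | suc zero | _ = begin
        deg v + 0                                                        ≡⟨ ℕₚ.+-identityʳ (deg v) ⟩
        deg v                                                            ≡⟨ sum-partition (a v) ⟩
        a v u + sum (λ w → a u w * a v w) + sum (λ w → c w * a v w)      ≤⟨ ℕₚ.+-monoˡ-≤ _ (common≤ v uv) ⟩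
        deg u + sum (λ w → c w * a v w)                                  ≡⟨ cong₂ _+_ (ℕₚ.+-identityʳ (deg u)) (ℕₚ.+-identityʳ (sum (λ w → c w * a v w))) ⟨
        deg u + 0 + (sum (λ w → c w * a v w) + 0) ∎
      ... | suc (suc _) | s≤s ()

    e≤dr : e ≤ deg u * r
    e≤dr = begin
      e                              ≤⟨ sum-mono (λ v → ℕₚ.*-monoʳ-≤ (a u v) (sum-mono (λ w → ℕₚ.≤-trans (ℕₚ.*-monoʳ-≤ (c w) (a≤1 v w)) (ℕₚ.≤-reflexive (ℕₚ.*-identityʳ (c w)))))) ⟩
      sum (λ v → a u v * r)          ≡⟨ *-distribʳ-sum r (a u) ⟨
      deg u * r                      ∎

    merris-bound : 1 ≤ deg u → deg u * deg u + s + 2 * deg u ≤ 2 * k * deg u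
    merris-bound d≥1 = subst (λ z → deg u * deg u + s + 2 * deg u ≤ 2 * z * deg u) d+r≡k
      (merris-arithmetic (deg u) r s e (sum deg) d≥1 d+s+e≤t s≤ e≤dr
        (subst (λ z → sum deg + z ≤ z * z) (sym d+r≡k) few))

-- The complement of a graph with large spectral radius

size : ∀ {n} → (Fin n → Fin n → Bool) → ℕ
size h = sum (λ x → sum (λ y → 𝟙 (h x y)))

T-≡ : ∀ {a b} → (T a → T b) → (T b → T a) → a ≡ b
T-≡ {false} {false} _ _ = refl
T-≡ {false} {true}  _ g = ⊥-elim (g _)
T-≡ {true}  {false} f _ = ⊥-elim (f _)
T-≡ {true}  {true}  _ _ = refl

𝟙≤1 : ∀ b → 𝟙 b ≤ 1
𝟙≤1 false = z≤n
𝟙≤1 true  = s≤s z≤n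

∣tabulate∣ : ∀ {n} (f : Fin n → Bool) → ∣ Vec.tabulate f ∣ ≡ sum (𝟙 ∘ f)
∣tabulate∣ {zero}  f = refl
∣tabulate∣ {suc n} f with f zero
... | true  = cong suc (∣tabulate∣ (f ∘ suc))
... | false = ∣tabulate∣ (f ∘ suc)

module _ {n} (G : Graph n) where

  adj-sym : ∀ u v → adj G u v ≡ adj G v u
  adj-sym u v = T-≡ (symmetric G) (symmetric G)

  adj-irr : ∀ u → adj G u u ≡ false
  adj-irr u with adj G u u | irreflexive G {u} refl
  ... | false | _ = refl
  ... | true  | f = ⊥-elim (f _)

  missing : Fin n → Fin n → Bool
  missing u v = not ⌊ u ≟ v ⌋ ∧ not (adj G u v)

  missing-sym : ∀ u v → missing u v ≡ missing v u
  missing-sym u v with u ≟ v | v ≟ u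
  ... | yes _   | yes _   = refl
  ... | yes u≡v | no v≢u  = contradiction (sym u≡v) v≢u
  ... | no u≢v  | yes v≡u = contradiction (sym v≡u) u≢v
  ... | no _    | no _    = cong not (adj-sym u v)

  missing-irr : ∀ u → missing u u ≡ false
  missing-irr u with u ≟ u
  ... | yes _  = refl
  ... | no u≢u = contradiction refl u≢u

  adj-missing : ∀ {u v} → u ≢ v → missing u v ≡ false → T (adj G u v)
  adj-missing {u} {v} u≢v p with u ≟ v | adj G u v
  ... | yes u≡v | _ = contradiction u≡v u≢v
  ... | no _ | true = _

  δ+adj+missing : ∀ u v → δ u v + 𝟙 (adj G u v) + 𝟙 (missing u v) ≡ 1
  δ+adj+missing u v with u ≟ v
  ... | yes refl rewrite adj-irr u = refl
  ... | no _ with adj G u v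
  ...   | true  = refl
  ...   | false = refl

  size-missing : n + size (adj G) + size missing ≡ n * n
  size-missing = begin
    n + size (adj G) + size missing
      ≡⟨ cong (λ z → z + size (adj G) + size missing) n≡ ⟩
    sum ones + size (adj G) + size missing
      ≡⟨ cong (_+ size missing) (sym (∑-distrib-+ ones adjs)) ⟩
    sum (λ u → ones u + adjs u) + size missing
      ≡⟨ ∑-distrib-+ (λ u → ones u + adjs u) (λ u → sum (λ v → 𝟙 (missing u v))) ⟨
    sum (λ u → ones u + adjs u + sum (λ v → 𝟙 (missing u v)))
      ≡⟨ sum-cong-≗ row ⟩
    sum {n} (λ _ → 1 * n)
      ≡⟨ *-distribʳ-sum {n} n (λ _ → 1) ⟨
    sum {n} (λ _ → 1) * n
      ≡⟨ cong (_* n) (sum-one n) ⟩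
    n * n ∎
    where
    open ≡-Reasoning
    ones adjs : Fin n → ℕ
    ones u = sum (δ u)
    adjs u = sum (λ v → 𝟙 (adj G u v))
    n≡ : n ≡ sum ones
    n≡ = trans (sym (sum-one n)) (sum-cong-≗ {n} {λ _ → 1} {ones} (λ u → sym (sum-δ₁ u)))
    row : ∀ u → sum (δ u) + sum (λ v → 𝟙 (adj G u v)) + sum (λ v → 𝟙 (missing u v)) ≡ 1 * n
    row u = begin
      sum (δ u) + sum (λ v → 𝟙 (adj G u v)) + sum (λ v → 𝟙 (missing u v))
        ≡⟨ cong (_+ sum (λ v → 𝟙 (missing u v))) (sym (∑-distrib-+ (δ u) (λ v → 𝟙 (adj G u v)))) ⟩
      sum (λ v → δ u v + 𝟙 (adj G u v)) + sum (λ v → 𝟙 (missing u v))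
        ≡⟨ ∑-distrib-+ (λ v → δ u v + 𝟙 (adj G u v)) (λ v → 𝟙 (missing u v)) ⟨
      sum (λ v → δ u v + 𝟙 (adj G u v) + 𝟙 (missing u v))
        ≡⟨ sum-cong-≗ (δ+adj+missing u) ⟩
      sum {n} (λ _ → 1)
        ≡⟨ trans (sum-one n) (sym (ℕₚ.*-identityˡ n)) ⟩
      1 * n ∎

module _ {k} (G : Graph (suc k)) (few : size (adj G) + k ≤ k * k) (c : ℕ) (c+2≡2k : c + 2 ≡ 2 * k) where

  private
    A : Fin (suc k) → Fin (suc k) → ℕ
    A = adjacencyMatrix G

    d : Fin (suc k) → ℕ
    d = degree G

    d≡ : ∀ u → d u ≡ sum (A u)
    d≡ u = ∣tabulate∣ (adj G u)

  -- With the degrees as weights, the weighted row sum of the signless Laplacian is `deg²` plus the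
  -- degree sum of the neighbours. The maximum with 1 keeps the weight of an isolated vertex
  -- positive; the row of such a vertex vanishes.
  weight : Fin (suc k) → ℕ
  weight u = d u ⊔ 1

  1≤weight : ∀ u → 1 ≤ weight u
  1≤weight u = ℕₚ.m≤n⊔m (d u) 1

  A≤degree : ∀ u v → A u v ≤ d u
  A≤degree u v = subst (A u v ≤_) (sym (d≡ u)) (≤sum (A u) v)

  -- A vertex adjacent to some `u` has degree at least 1, so the maximum has no effect there.
  A*weight : ∀ u v → A u v * weight v ≡ A u v * sum (A v)
  A*weight u v with adj G u v in uv
  ... | false = refl
  ... | true  = cong (_+ 0) (trans (ℕₚ.m≥n⇒m⊔n≡m (subst (_≤ d v) (cong 𝟙 (trans (sym (adj-sym G u v)) uv)) (A≤degree v u))) (d≡ v))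

  row-split : ∀ u → sum (λ v → (degreeMatrix G u v + A u v) * weight v)
    ≡ d u * weight u + sum (λ v → A u v * weight v)
  row-split u = begin
    sum (λ v → (degreeMatrix G u v + A u v) * weight v)
      ≡⟨ sum-cong-≗ (λ v → trans (ℕₚ.*-distribʳ-+ (weight v) (degreeMatrix G u v) (A u v)) (cong (_+ A u v * weight v) (diagonal v))) ⟩
    sum (λ v → δ u v * (d u * weight v) + A u v * weight v)
      ≡⟨ ∑-distrib-+ (λ v → δ u v * (d u * weight v)) (λ v → A u v * weight v) ⟩
    sum (λ v → δ u v * (d u * weight v)) + sum (λ v → A u v * weight v)
      ≡⟨ cong (_+ sum (λ v → A u v * weight v)) (sum-δ u (λ v → d u * weight v)) ⟩
    d u * weight u + sum (λ v → A u v * weight v) ∎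
    where
    open ≡-Reasoning
    diagonal : ∀ v → degreeMatrix G u v * weight v ≡ δ u v * (d u * weight v)
    diagonal v with u ≟ v
    ... | yes _ = sym (ℕₚ.+-identityʳ _)
    ... | no _  = refl

  row≤ : ∀ u → sum (λ v → (degreeMatrix G u v + A u v) * weight v) ≤ c * weight u
  row≤ u = ℕₚ.≤-trans (ℕₚ.≤-reflexive (row-split u)) (bound (d u) refl)
    where
    open ℕₚ.≤-Reasoning
    rest = sum (λ v → A u v * weight v)
    bound : ∀ D → d u ≡ D → d u * weight u + rest ≤ c * weight u
    bound zero du = begin
      d u * weight u + rest ≡⟨ cong₂ _+_ (cong (_* weight u) du) (trans (sum-cong-≗ vanish) (sum-replicate-zero (suc k))) ⟩
      0                     ≤⟨ z≤n ⟩
      c * weight u          ∎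
      where
      vanish : ∀ v → A u v * weight v ≡ 0
      vanish v = cong (_* weight v) (ℕₚ.n≤0⇒n≡0 (subst (A u v ≤_) du (A≤degree u v)))
    bound (suc d′) du = begin
      d u * weight u + rest  ≡⟨ cong₂ (λ x y → x * y + rest) d≡D w≡D ⟩
      D * D + rest           ≤⟨ ℕₚ.+-cancelʳ-≤ (2 * D) _ _ merris ⟩
      c * D                  ≡⟨ cong (c *_) w≡D ⟨
      c * weight u           ∎
      where
      D = sum (A u)
      d≡D : d u ≡ D
      d≡D = d≡ u
      1≤d : 1 ≤ d u
      1≤d = subst (1 ≤_) (sym du) (s≤s z≤n)
      w≡D : weight u ≡ D
      w≡D = trans (ℕₚ.m≥n⇒m⊔n≡m 1≤d) d≡D
      merris : D * D + rest + 2 * D ≤ c * D + 2 * D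
      merris = begin
        D * D + rest + 2 * D
          ≡⟨ cong (λ z → D * D + z + 2 * D) (sum-cong-≗ (A*weight u)) ⟩
        D * D + sum (λ v → A u v * sum (A v)) + 2 * D
          ≤⟨ DegreeSum.merris-bound A (λ u v → 𝟙≤1 (adj G u v)) (λ u v → cong 𝟙 (adj-sym G u v)) (λ u → cong 𝟙 (adj-irr G u)) few u
               (subst (1 ≤_) d≡D 1≤d) ⟩
        2 * k * D
          ≡⟨ cong (_* D) c+2≡2k ⟨
        (c + 2) * D
          ≡⟨ ℕₚ.*-distribʳ-+ D c 2 ⟩
        c * D + 2 * D ∎

  spectralRadius≤ : ∀ ρ → IsSpectralRadiusS G ρ → ¬ (fromℕ c <ᴿ ρ)
  spectralRadius≤ ρ (eigen , _) = eigenvalue≤ (signlessLaplacian G) (λ u v → degreeMatrix G u v + A u v) (λ _ _ _ → refl) weight c 1≤weight row≤ ρ eigen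

-- There are `k * k + k` ordered pairs of distinct vertices, and more than `k * k ∸ k` of them are
-- adjacent.
size-missing< : ∀ {k} (G : Graph (suc k)) → ¬ (size (adj G) + k ≤ k * k) → size (missing G) < 2 * k
size-missing< {k} G many = ℕₚ.+-cancelˡ-< (k * k + suc k) _ _ (begin-strict
    k * k + suc k + size (missing G)                    ≡⟨ e₁ k (size (missing G)) ⟩
    (suc k + size (missing G)) + k * k                  <⟨ ℕₚ.+-monoʳ-< (suc k + size (missing G)) (ℕₚ.≰⇒> many) ⟩
    (suc k + size (missing G)) + (size (adj G) + k)     ≡⟨ e₂ k (size (missing G)) (size (adj G)) ⟩
    (suc k + size (adj G) + size (missing G)) + k       ≡⟨ cong (_+ k) (size-missing G) ⟩
    suc k * suc k + k                                   ≡⟨ e₃ k ⟩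
    k * k + suc k + 2 * k                               ∎)
  where
  open ℕₚ.≤-Reasoning
  e₁ : ∀ k m → k * k + (1 + k) + m ≡ ((1 + k) + m) + k * k
  e₁ = solve-∀
  e₂ : ∀ k m a → (1 + k + m) + (a + k) ≡ (1 + k + a + m) + k
  e₂ = solve-∀
  e₃ : ∀ k → (1 + k) * (1 + k) + k ≡ k * k + (1 + k) + 2 * k
  e₃ = solve-∀

few-missing : ∀ {k} (G : Graph (suc (suc k))) ρ → IsSpectralRadiusS G ρ →
  fromℕ (2 * suc (suc k) ∸ 4) <ᴿ ρ → size (missing G) < 2 * suc k
few-missing {k} G ρ isρ c<ρ =
  size-missing< G (λ few → spectralRadius≤ G few (2 * suc (suc k) ∸ 4) c+2≡2k ρ isρ c<ρ)
  where
  c+2≡2k : 2 * suc (suc k) ∸ 4 + 2 ≡ 2 * suc k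
  c+2≡2k = trans (cong (λ z → z ∸ 4 + 2) (e₁ k)) (e₂ k)
    where
    e₁ : ∀ x → 2 * suc (suc x) ≡ 4 + 2 * x
    e₁ = solve-∀
    e₂ : ∀ x → 2 * x + 2 ≡ 2 * suc x
    e₂ = solve-∀

-- Labelled paths and cycles

module _ {A : Set} where
  open import Algebra.Solver.CommutativeMonoid (Permₚ.++-commutativeMonoid {A = A}) public
    using (solve; _⊕_; _⊜_)

module _ {n} (Ok : Fin n → Fin n → Fin n → Set) where

  -- Path a b vs ls: from a to b through the vertices vs, in this order and
  -- with both ends included, along edges labelled by ls.
  data Path : Fin n → Fin n → List (Fin n) → List (Fin n) → Set where
    stop : ∀ {x} → Path x x (x ∷ []) []
    step : ∀ {x y z vs ls} l → Ok l x y → Path y z vs ls → Path x z (x ∷ vs) (l ∷ ls)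

  record HamiltonCycle : Set where
    constructor cycle
    field
      {start end}    : Fin n
      {vertices labels} : List (Fin n)
      path           : Path start end vertices labels
      last           : Fin n
      closing        : Ok last end start
      allVertices    : vertices ↭ allFin n
      allLabels      : last ∷ labels ↭ allFin n

module _ {n} {Ok : Fin n → Fin n → Fin n → Set} where

  join : ∀ {a b c d vs vs′ ls ls′} → Path Ok a b vs ls → ∀ l → Ok l b c →
    Path Ok c d vs′ ls′ → Path Ok a d (vs ++ vs′) (ls ++ l ∷ ls′)
  join stop          l ok q = step l ok q
  join (step k ok′ p) l ok q = step k ok′ (join p l ok q)

  reverse : (∀ {l x y} → Ok l x y → Ok l y x) → ∀ {a b vs ls} → Path Ok a b vs ls →
    ∃[ vs′ ] ∃[ ls′ ] (Path Ok b a vs′ ls′ × vs′ ↭ vs × ls′ ↭ ls)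
  reverse Ok-sym stop = _ , _ , stop , ↭-refl , ↭-refl
  reverse Ok-sym (step {x} {vs = vs} {ls = ls} l ok p) with reverse Ok-sym p
  ... | vs′ , ls′ , p′ , vs′↭ , ls′↭ = vs′ ++ x ∷ [] , ls′ ++ l ∷ []
      , join p′ l (Ok-sym ok) stop
      , ↭-trans (↭-sym (Permₚ.∷↭∷ʳ x vs′)) (prep x vs′↭)
      , ↭-trans (↭-sym (Permₚ.∷↭∷ʳ l ls′)) (prep l ls′↭)

  start∈ : ∀ {a b vs ls} → Path Ok a b vs ls → a ∈ vs
  start∈ stop         = here refl
  start∈ (step _ _ _) = here refl

  end∈ : ∀ {a b vs ls} → Path Ok a b vs ls → b ∈ vs
  end∈ stop         = here refl
  end∈ (step _ _ p) = there (end∈ p)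

  -- The path is cut at the edge entering `u`, which exists unless `u` is the start.
  data Split (u a b : Fin n) : List (Fin n) → List (Fin n) → Set where
    atStart : ∀ {vs ls} → u ≡ a → Split u a b vs ls
    inside  : ∀ {c vs₁ vs₂ ls₁ ls₂} → Path Ok a c vs₁ ls₁ → ∀ l → Ok l c u →
      Path Ok u b vs₂ ls₂ → Split u a b (vs₁ ++ vs₂) (ls₁ ++ l ∷ ls₂)

  split : ∀ {u a b vs ls} → Path Ok a b vs ls → u ∈ vs → Split u a b vs ls
  split stop          (here u≡a) = atStart u≡a
  split (step _ _ _)  (here u≡a) = atStart u≡a
  split (step l ok p) (there u∈) with split p u∈
  ... | atStart refl      = inside stop l ok p
  ... | inside q k ok′ p′ = inside (step l ok q) k ok′ p′

  -- The cycle with its edges entering `v` and `u` singled out: each arc contains its own start and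
  -- is linked to the start of the other one.
  record Arcs (u v : Fin n) : Set where
    constructor arcs
    field
      {end₁ end₂}   : Fin n
      {vs₁ vs₂ ls₁ ls₂} : List (Fin n)
      path₁         : Path Ok u end₁ vs₁ ls₁
      label₁        : Fin n
      ok₁           : Ok label₁ end₁ v
      path₂         : Path Ok v end₂ vs₂ ls₂
      label₂        : Fin n
      ok₂           : Ok label₂ end₂ u
      allVertices   : vs₁ ++ vs₂ ↭ allFin n
      allLabels     : label₁ ∷ label₂ ∷ ls₁ ++ ls₂ ↭ allFin n

  startingAt : ∀ u → HamiltonCycle Ok →
    ∃[ b ] ∃[ vs ] ∃[ ls ] ∃[ l ] (Path Ok u b vs ls × Ok l b u × vs ↭ allFin n × l ∷ ls ↭ allFin n)
  startingAt u (cycle p l ok vs↭ ls↭)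
    with split p (Permₚ.∈-resp-↭ (↭-sym vs↭) (∈-allFin u))
  ... | atStart refl = _ , _ , _ , _ , p , ok , vs↭ , ls↭
  ... | inside {vs₁ = vs₁} {vs₂} {ls₁} {ls₂} q k ok′ r =
    _ , _ , _ , k , join r l ok q , ok′
    , ↭-trans (Permₚ.++-comm vs₂ vs₁) vs↭
    , ↭-trans (solve 4 (λ k b l a → k ⊕ (b ⊕ (l ⊕ a)) ⊜ l ⊕ (a ⊕ (k ⊕ b))) ↭-refl (k ∷ []) ls₂ (l ∷ []) ls₁) ls↭

  cutAt : ∀ {u v} → u ≢ v → HamiltonCycle Ok → Arcs u v
  cutAt {u} {v} u≢v C with startingAt u C
  ... | b , vs , ls , l₀ , p , ok₀ , vs↭ , ls↭
    with split p (Permₚ.∈-resp-↭ (↭-sym vs↭) (∈-allFin v))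
  ... | atStart v≡u = contradiction (sym v≡u) u≢v
  ... | inside {ls₁ = ls₁} {ls₂} q l ok r = arcs q l ok r l₀ ok₀ vs↭
    (↭-trans (solve 4 (λ l l₀ a b → l ⊕ (l₀ ⊕ (a ⊕ b)) ⊜ l₀ ⊕ (a ⊕ (l ⊕ b))) ↭-refl (l ∷ []) (l₀ ∷ []) ls₁ ls₂) ls↭)

mapPath : ∀ {n} {Ok Ok′ : Fin n → Fin n → Fin n → Set} {a b vs ls} →
  (∀ {l x y} → x ∈ vs → y ∈ vs → Ok l x y → Ok′ l x y) → Path Ok a b vs ls → Path Ok′ a b vs ls
mapPath f stop          = stop
mapPath f (step l ok p) =
  step l (f (here refl) (there (start∈ p)) ok) (mapPath (λ x∈ y∈ → f (there x∈) (there y∈)) p)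

Unique-resp-↭ : ∀ {A : Set} {xs ys : List A} → xs ↭ ys → Unique xs → Unique ys
Unique-resp-↭ xs↭ys = PermₛProperties.Unique-resp-↭ (setoid _) (↭⇒↭ₛ xs↭ys)

↭allFin⇒Unique : ∀ {n} {xs : List (Fin n)} → xs ↭ allFin n → Unique xs
↭allFin⇒Unique {n} xs↭ = Unique-resp-↭ (↭-sym xs↭) (allFin⁺ n)

-- Ok′ plays the role of the Kelmans transform of Ok: u keeps only the common
-- neighbours of u and v, and v gains the other neighbours of u.
module Surgery {n} {Ok Ok′ : Fin n → Fin n → Fin n → Set}
  (Ok-sym : ∀ {l x y} → Ok l x y → Ok l y x) (Ok′-sym : ∀ {l x y} → Ok′ l x y → Ok′ l y x)
  {u v : Fin n} (u≢v : u ≢ v)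
  (at-u : ∀ {l w} → w ≢ u → w ≢ v → Ok′ l u w → Ok l u w × Ok l v w)
  (at-v : ∀ {l w} → w ≢ u → w ≢ v → Ok′ l v w → Ok l u w ⊎ Ok l v w)
  (at-uv : ∀ {l} → Ok′ l u v → Ok l u v)
  (off-uv : ∀ {l x y} → x ≢ u → x ≢ v → y ≢ u → y ≢ v → Ok′ l x y → Ok l x y) where

  Both Either : Fin n → Fin n → Set
  Both l w   = Ok l u w × Ok l v w
  Either l w = Ok l u w ⊎ Ok l v w

  -- The given cycle is `u Q v P`. The edges labelled `j` and `l₀`, formerly at `u`, fit both `u`
  -- and `v`; those labelled `l` and `k`, formerly at `v`, fit one of the two. If both fit `v`, the
  -- order stays; if both fit `u`, the two vertices are exchanged; if they disagree, `P` is
  -- reversed, so that `l` and `l₀` meet at one of the two vertices and `k` and `j` at the other.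
  rebuild : ∀ {q₁ q₂ p₁ p₂ vq vp lq lp} j l k l₀ →
    Path Ok q₁ q₂ vq lq → Path Ok p₁ p₂ vp lp →
    Both j q₁ → Either l q₂ → Either k p₁ → Both l₀ p₂ →
    u ∷ vq ++ v ∷ vp ↭ allFin n → l ∷ l₀ ∷ j ∷ lq ++ k ∷ lp ↭ allFin n → HamiltonCycle Ok
  rebuild {vq = vq} {vp} {lq} {lp} j l k l₀ Q P (uq , vq₁) q₂ p₁ (up , vp₂) vs↭ ls↭ with q₂ | p₁
  ... | inj₁ uq₂ | inj₁ up₁ =
    cycle (step j vq₁ (join Q l (Ok-sym uq₂) (step k up₁ P))) l₀ (Ok-sym vp₂)
      (↭-trans (solve 4 (λ u q v p → v ⊕ (q ⊕ (u ⊕ p)) ⊜ u ⊕ (q ⊕ (v ⊕ p))) ↭-refl (u ∷ []) vq (v ∷ []) vp) vs↭)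
      (↭-trans (solve 6 (λ j l k z q p → z ⊕ (j ⊕ (q ⊕ (l ⊕ (k ⊕ p)))) ⊜ l ⊕ (z ⊕ (j ⊕ (q ⊕ (k ⊕ p))))) ↭-refl (j ∷ []) (l ∷ []) (k ∷ []) (l₀ ∷ []) lq lp) ls↭)
  ... | inj₂ vq₂ | inj₂ vp₁ =
    cycle (step j uq (join Q l (Ok-sym vq₂) (step k vp₁ P))) l₀ (Ok-sym up)
      vs↭
      (↭-trans (solve 6 (λ j l k z q p → z ⊕ (j ⊕ (q ⊕ (l ⊕ (k ⊕ p)))) ⊜ l ⊕ (z ⊕ (j ⊕ (q ⊕ (k ⊕ p))))) ↭-refl (j ∷ []) (l ∷ []) (k ∷ []) (l₀ ∷ []) lq lp) ls↭)
  ... | inj₂ vq₂ | inj₁ up₁ with reverse Ok-sym P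
  ...   | vp′ , lp′ , P′ , vp′↭ , lp′↭ =
    cycle (join Q l (Ok-sym vq₂) (step l₀ vp₂ (join P′ k (Ok-sym up₁) stop))) j uq
      (↭-trans (Permₚ.++⁺ˡ vq (prep v (Permₚ.++⁺ʳ (u ∷ []) vp′↭)))
        (↭-trans (solve 4 (λ u q v p → q ⊕ (v ⊕ (p ⊕ u)) ⊜ u ⊕ (q ⊕ (v ⊕ p))) ↭-refl (u ∷ []) vq (v ∷ []) vp) vs↭))
      (↭-trans (prep j (Permₚ.++⁺ˡ lq (prep l (prep l₀ (Permₚ.++⁺ʳ (k ∷ []) lp′↭)))))
        (↭-trans (solve 6 (λ j l k z q p → j ⊕ (q ⊕ (l ⊕ (z ⊕ (p ⊕ k)))) ⊜ l ⊕ (z ⊕ (j ⊕ (q ⊕ (k ⊕ p))))) ↭-refl (j ∷ []) (l ∷ []) (k ∷ []) (l₀ ∷ []) lq lp) ls↭))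
  rebuild {vq = vq} {vp} {lq} {lp} j l k l₀ Q P (uq , vq₁) q₂ p₁ (up , vp₂) vs↭ ls↭ | inj₁ uq₂ | inj₂ vp₁ with reverse Ok-sym P
  ...   | vp′ , lp′ , P′ , vp′↭ , lp′↭ =
    cycle (join Q l (Ok-sym uq₂) (step l₀ up (join P′ k (Ok-sym vp₁) stop))) j vq₁
      (↭-trans (Permₚ.++⁺ˡ vq (prep u (Permₚ.++⁺ʳ (v ∷ []) vp′↭)))
        (↭-trans (solve 4 (λ u q v p → q ⊕ (u ⊕ (p ⊕ v)) ⊜ u ⊕ (q ⊕ (v ⊕ p))) ↭-refl (u ∷ []) vq (v ∷ []) vp) vs↭))
      (↭-trans (prep j (Permₚ.++⁺ˡ lq (prep l (prep l₀ (Permₚ.++⁺ʳ (k ∷ []) lp′↭)))))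
        (↭-trans (solve 6 (λ j l k z q p → j ⊕ (q ⊕ (l ⊕ (z ⊕ (p ⊕ k)))) ⊜ l ⊕ (z ⊕ (j ⊕ (q ⊕ (k ⊕ p))))) ↭-refl (j ∷ []) (l ∷ []) (k ∷ []) (l₀ ∷ []) lq lp) ls↭))

  Off : List (Fin n) → Set
  Off vs = ∀ {x} → x ∈ vs → x ≢ u × x ≢ v

  off-path : ∀ {a b vs ls} → Off vs → Path Ok′ a b vs ls → Path Ok a b vs ls
  off-path off = mapPath λ x∈ y∈ →
    off-uv (proj₁ (off x∈)) (proj₂ (off x∈)) (proj₁ (off y∈)) (proj₂ (off y∈))

  both : ∀ {l w} → w ≢ u × w ≢ v → Ok′ l u w → Both l w
  both (w≢u , w≢v) = at-u w≢u w≢v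

  either : ∀ {l w} → w ≢ u × w ≢ v → Ok′ l v w → Either l w
  either (w≢u , w≢v) = at-v w≢u w≢v

  ≢-head : ∀ {x y : Fin n} {xs ys} → All (x ≢_) (xs ++ ys) → y ∈ xs → y ≢ x
  ≢-head {xs = xs} x∉ y∈ y≡x = All.lookup x∉ (∈-++⁺ˡ y∈) (sym y≡x)

  ≢-tail : ∀ {x y : Fin n} xs {ys} → All (x ≢_) (xs ++ ys) → y ∈ ys → y ≢ x
  ≢-tail xs x∉ y∈ y≡x = All.lookup x∉ (∈-++⁺ʳ xs y∈) (sym y≡x)

  -- A one-vertex arc means that `u` and `v` are consecutive on the cycle. The edge `uv` survives
  -- the transformation, so only one edge formerly at `v` decides whether the two are exchanged.
  -- When both arcs have one vertex, there are no further vertices and nothing has to be decided.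
  transfer : Arcs {Ok = Ok′} u v → HamiltonCycle Ok
  transfer (arcs stop l ok₁ stop l₀ ok₂ vs↭ ls↭) =
    cycle (step l (at-uv ok₁) stop) l₀ (Ok-sym (at-uv (Ok′-sym ok₂))) vs↭
      (↭-trans (_↭_.swap l₀ l _↭_.refl) ls↭)
  transfer (arcs {ls₂ = k ∷ lp} stop l ok₁ (step {vs = vp} k vp₁ P) l₀ ok₂ vs↭ ls↭)
    with ↭allFin⇒Unique vs↭
  ... | u∉ ∷ v∉ ∷ _ = finish (either (off (start∈ P)) vp₁)
    where
    off : Off vp
    off x∈ = ≢-tail (v ∷ []) u∉ x∈ , ≢-tail [] v∉ x∈
    up₂ = both (off (end∈ P)) (Ok′-sym ok₂)
    finish : Either k _ → HamiltonCycle Ok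
    finish (inj₁ up₁) = cycle (step l (Ok-sym (at-uv ok₁)) (step k up₁ (off-path off P))) l₀ (Ok-sym (proj₂ up₂))
      (↭-trans (_↭_.swap v u _↭_.refl) vs↭)
      (↭-trans (_↭_.swap l₀ l _↭_.refl) ls↭)
    finish (inj₂ vp₁) = cycle (step l (at-uv ok₁) (step k vp₁ (off-path off P))) l₀ (Ok-sym (proj₁ up₂))
      vs↭ (↭-trans (_↭_.swap l₀ l _↭_.refl) ls↭)
  transfer (arcs {ls₁ = j ∷ lq} (step {vs = vq} j uq₁ Q) l ok₁ stop l₀ ok₂ vs↭ ls↭)
    with ↭allFin⇒Unique (↭-trans (_↭_.swap v u _↭_.refl) (↭-trans (prep u (Permₚ.∷↭∷ʳ v vq)) vs↭))
  ... | v∉ ∷ u∉ ∷ _ = finish (either (off (end∈ Q)) (Ok′-sym ok₁))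
    where
    off : Off vq
    off x∈ = ≢-tail [] u∉ x∈ , ≢-tail (u ∷ []) v∉ x∈
    uq = both (off (start∈ Q)) uq₁
    relabel : l₀ ∷ j ∷ lq ++ l ∷ [] ↭ allFin n
    relabel = ↭-trans (solve 4 (λ l z j q → z ⊕ (j ⊕ (q ⊕ l)) ⊜ l ⊕ (z ⊕ (j ⊕ q))) ↭-refl (l ∷ []) (l₀ ∷ []) (j ∷ []) lq)
      (subst (λ z → l ∷ l₀ ∷ j ∷ z ↭ allFin n) (Listₚ.++-identityʳ lq) ls↭)
    finish : Either l _ → HamiltonCycle Ok
    finish (inj₁ uq₂) = cycle (step j (proj₂ uq) (join (off-path off Q) l (Ok-sym uq₂) stop)) l₀ (at-uv (Ok′-sym ok₂))
      (↭-trans (solve 3 (λ u q v → v ⊕ (q ⊕ u) ⊜ u ⊕ (q ⊕ v)) ↭-refl (u ∷ []) vq (v ∷ [])) vs↭) relabel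
    finish (inj₂ vq₂) = cycle (step j (proj₁ uq) (join (off-path off Q) l (Ok-sym vq₂) stop)) l₀ (Ok-sym (at-uv (Ok′-sym ok₂)))
      vs↭ relabel
  transfer (arcs {ls₁ = j ∷ lq} {ls₂ = k ∷ lp} (step {vs = vq} j uq₁ Q) l ok₁ (step {vs = vp} k vp₁ P) l₀ ok₂ vs↭ ls↭)
    with ↭allFin⇒Unique (↭-trans (solve 4 (λ u v q p → v ⊕ (u ⊕ (q ⊕ p)) ⊜ u ⊕ (q ⊕ (v ⊕ p))) ↭-refl (u ∷ []) (v ∷ []) vq vp) vs↭)
  ... | (_ ∷ v∉) ∷ u∉ ∷ _ =
    rebuild j l k l₀ (off-path offQ Q) (off-path offP P)
      (both (offQ (start∈ Q)) uq₁) (either (offQ (end∈ Q)) (Ok′-sym ok₁))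
      (either (offP (start∈ P)) vp₁) (both (offP (end∈ P)) (Ok′-sym ok₂)) vs↭ ls↭
    where
    offQ : Off vq
    offQ x∈ = ≢-head u∉ x∈ , ≢-head v∉ x∈
    offP : Off vp
    offP x∈ = ≢-tail vq u∉ x∈ , ≢-tail vq v∉ x∈

  surgery : HamiltonCycle Ok′ → HamiltonCycle Ok
  surgery C = transfer (cutAt u≢v C)

-- Kelmans transformations

sum-mono-< : ∀ {n} {f g : Fin n → ℕ} → (∀ i → f i ≤ g i) → ∀ i → f i < g i → sum f < sum g
sum-mono-< f≤g zero    fi<gi = ℕₚ.+-mono-<-≤ fi<gi (sum-mono (f≤g ∘ suc))
sum-mono-< f≤g (suc i) fi<gi = ℕₚ.+-mono-≤-< (f≤g zero) (sum-mono-< (f≤g ∘ suc) i fi<gi)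

record IsSimple {n} (h : Fin n → Fin n → Bool) : Set where
  field
    h-sym : ∀ x y → h x y ≡ h y x
    h-irr : ∀ x → h x x ≡ false


open IsSimple

module _ {n} (i j : Fin n) where

  transpose-i : transpose i j ⟨$⟩ʳ i ≡ j
  transpose-i with i ≟ i
  ... | yes _  = refl
  ... | no i≢i = contradiction refl i≢i

  transpose-j : transpose i j ⟨$⟩ʳ j ≡ i
  transpose-j with j ≟ i
  ... | yes j≡i = j≡i
  ... | no _ with j ≟ j
  ...   | yes _  = refl
  ...   | no j≢j = contradiction refl j≢j

  transpose-other : ∀ {w} → w ≢ i → w ≢ j → transpose i j ⟨$⟩ʳ w ≡ w
  transpose-other {w} w≢i w≢j with w ≟ i
  ... | yes w≡i = contradiction w≡i w≢i
  ... | no _ with w ≟ j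
  ...   | yes w≡j = contradiction w≡j w≢j
  ...   | no _    = refl

weightedSize : ∀ {n} → (Fin n → Fin n → ℕ) → (Fin n → Fin n → Bool) → ℕ
weightedSize φ g = sum (λ x → sum (λ y → 𝟙 (g x y) * φ x y))

-- The Kelmans transformation of the complements: edges at v are moved to u.
module Shift {n} (u v : Fin n) (u≢v : u ≢ v) where

  τ : Fin n → Fin n
  τ = transpose u v ⟨$⟩ʳ_

  -- `τ` pairs `uw` with `vw`; the disjunction goes to `uw` and the conjunction stays at `vw`. On
  -- `uv` and on pairs avoiding both vertices, `τ` fixes the unordered pair, so for symmetric `h`
  -- idempotence leaves the value unchanged and one formula covers all cases.
  shift : (Fin n → Fin n → Bool) → Fin n → Fin n → Bool
  shift h x y = if ⌊ x ≟ u ⌋ ∨ᵇ ⌊ y ≟ u ⌋ then h x y ∨ᵇ h (τ x) (τ y) else h x y ∧ h (τ x) (τ y)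

  τu : τ u ≡ v
  τu = transpose-i u v

  τv : τ v ≡ u
  τv = transpose-j u v

  τw : ∀ {w} → w ≢ u → w ≢ v → τ w ≡ w
  τw = transpose-other u v

  data View (x : Fin n) : Set where
    is-u  : x ≡ u → View x
    is-v  : x ≡ v → View x
    other : x ≢ u → x ≢ v → View x

  view : ∀ x → View x
  view x with x ≟ u | x ≟ v
  ... | yes x≡u | _       = is-u x≡u
  ... | no _    | yes x≡v = is-v x≡v
  ... | no x≢u  | no x≢v  = other x≢u x≢v

  module _ {h : Fin n → Fin n → Bool} (simple : IsSimple h) where

    shift-u : ∀ y → shift h u y ≡ h u y ∨ᵇ h v (τ y)
    shift-u y with u ≟ u
    ... | yes _  = refl
    ... | no u≢u = contradiction refl u≢u

    shift-uw : ∀ {w} → w ≢ u → w ≢ v → shift h u w ≡ h u w ∨ᵇ h v w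
    shift-uw w≢u w≢v = trans (shift-u _) (cong (λ z → h u _ ∨ᵇ h v z) (τw w≢u w≢v))

    shift-≢u : ∀ {x y} → x ≢ u → y ≢ u → shift h x y ≡ h x y ∧ h (τ x) (τ y)
    shift-≢u {x} {y} x≢u y≢u with x ≟ u | y ≟ u
    ... | yes x≡u | _       = contradiction x≡u x≢u
    ... | no _    | yes y≡u = contradiction y≡u y≢u
    ... | no _    | no _    = refl

    shift-vw : ∀ {w} → w ≢ u → w ≢ v → shift h v w ≡ h v w ∧ h u w
    shift-vw w≢u w≢v = trans (shift-≢u (u≢v ∘ sym) w≢u) (cong₂ (λ y z → h v _ ∧ h y z) τv (τw w≢u w≢v))

    shift-uv : shift h u v ≡ h u v
    shift-uv = trans (shift-u v) (trans (cong (λ z → h u v ∨ᵇ h v z) τv)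
      (trans (cong (h u v ∨ᵇ_) (h-sym simple v u)) (Boolₚ.∨-idem (h u v))))

    shift-off : ∀ {x y} → x ≢ u → x ≢ v → y ≢ u → y ≢ v → shift h x y ≡ h x y
    shift-off x≢u x≢v y≢u y≢v = trans (shift-≢u x≢u y≢u)
      (trans (cong₂ (λ a b → h _ _ ∧ h a b) (τw x≢u x≢v) (τw y≢u y≢v)) (Boolₚ.∧-idem (h _ _)))

    shift-sym : ∀ x y → shift h x y ≡ shift h y x
    shift-sym x y rewrite h-sym simple x y | h-sym simple (τ x) (τ y)
      | Boolₚ.∨-comm ⌊ x ≟ u ⌋ ⌊ y ≟ u ⌋ = refl

    shift-irr : ∀ x → shift h x x ≡ false
    shift-irr x rewrite h-irr simple x | h-irr simple (τ x) with ⌊ x ≟ u ⌋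
    ... | true  = refl
    ... | false = refl

    shift-simple : IsSimple (shift h)
    shift-simple = record { h-sym = shift-sym ; h-irr = shift-irr }

    module Weighted (φ : Fin n → Fin n → ℕ) (φ-sym : ∀ x y → φ x y ≡ φ y x)
      (φu≤φv : ∀ w → φ u w ≤ φ v w) where

      total : (Fin n → Fin n → Bool) → ℕ
      total = weightedSize φ

      -- `shift` moves edges only within the orbits of `τ` on pairs. Summing over each orbit makes
      -- the weights comparable term by term, at the price of counting everything twice.
      orbit : (Fin n → Fin n → Bool) → Fin n → Fin n → ℕ
      orbit g x y = 𝟙 (g x y) * φ x y + 𝟙 (g (τ x) (τ y)) * φ (τ x) (τ y)

      sum-orbit : ∀ g → sum (λ x → sum (orbit g x)) ≡ total g + total g
      sum-orbit g = begin
        sum (λ x → sum (orbit g x))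
          ≡⟨ sum-cong-≗ (λ x → ∑-distrib-+ (t x) (t (τ x) ∘ τ)) ⟩
        sum (λ x → sum (t x) + sum (t (τ x) ∘ τ))
          ≡⟨ ∑-distrib-+ (λ x → sum (t x)) (λ x → sum (t (τ x) ∘ τ)) ⟩
        total g + sum (λ x → sum (t (τ x) ∘ τ))
          ≡⟨ cong (total g +_) (sum-cong-≗ (λ x → sym (∑-permute (t (τ x)) (transpose u v)))) ⟩
        total g + sum (λ x → sum (t (τ x)))
          ≡⟨ cong (total g +_) (∑-permute (λ x → sum (t x)) (transpose u v)) ⟨
        total g + total g ∎
        where
        open ≡-Reasoning
        t : Fin n → Fin n → ℕ
        t x y = 𝟙 (g x y) * φ x y

      exchange : ∀ a b {p q} → p ≤ q → 𝟙 (a ∨ᵇ b) * p + 𝟙 (b ∧ a) * q ≤ 𝟙 a * p + 𝟙 b * q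
      exchange true  true  p≤q = ℕₚ.≤-refl
      exchange true  false p≤q = ℕₚ.≤-refl
      exchange false false p≤q = ℕₚ.≤-refl
      exchange false true  {p} {q} p≤q = ℕₚ.≤-trans (ℕₚ.≤-reflexive (ℕₚ.+-identityʳ (p + 0))) (ℕₚ.+-monoˡ-≤ 0 p≤q)

      orbit-uw : ∀ {w} → w ≢ u → w ≢ v → ∀ g → orbit g u w ≡ 𝟙 (g u w) * φ u w + 𝟙 (g v w) * φ v w
      orbit-uw w≢u w≢v g rewrite τu | τw w≢u w≢v = refl

      orbit-vw : ∀ {w} → w ≢ u → w ≢ v → ∀ g → orbit g v w ≡ 𝟙 (g u w) * φ u w + 𝟙 (g v w) * φ v w
      orbit-vw w≢u w≢v g rewrite τv | τw w≢u w≢v = ℕₚ.+-comm _ (𝟙 (g u _) * φ u _)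

      orbit-sym : ∀ {g} → IsSimple g → ∀ x y → orbit g x y ≡ orbit g y x
      orbit-sym g-simple x y rewrite h-sym g-simple x y | h-sym g-simple (τ x) (τ y)
        | φ-sym x y | φ-sym (τ x) (τ y) = refl

      uw≤ : ∀ {w} → w ≢ u → w ≢ v →
        𝟙 (shift h u w) * φ u w + 𝟙 (shift h v w) * φ v w ≤ 𝟙 (h u w) * φ u w + 𝟙 (h v w) * φ v w
      uw≤ {w} w≢u w≢v rewrite shift-uw w≢u w≢v | shift-vw w≢u w≢v = exchange (h u w) (h v w) (φu≤φv w)

      orbit-uw≤ : ∀ {w} → w ≢ u → w ≢ v → orbit (shift h) u w ≤ orbit h u w
      orbit-uw≤ w≢u w≢v = subst₂ _≤_ (sym (orbit-uw w≢u w≢v (shift h))) (sym (orbit-uw w≢u w≢v h)) (uw≤ w≢u w≢v)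

      orbit-vw≤ : ∀ {w} → w ≢ u → w ≢ v → orbit (shift h) v w ≤ orbit h v w
      orbit-vw≤ w≢u w≢v = subst₂ _≤_ (sym (orbit-vw w≢u w≢v (shift h))) (sym (orbit-vw w≢u w≢v h)) (uw≤ w≢u w≢v)

      orbit≤-sym : ∀ x y → orbit (shift h) x y ≤ orbit h x y → orbit (shift h) y x ≤ orbit h y x
      orbit≤-sym x y = subst₂ _≤_ (orbit-sym shift-simple x y) (orbit-sym simple x y)

      pointwise : ∀ {x y} → shift h x y ≡ h x y → shift h (τ x) (τ y) ≡ h (τ x) (τ y) →
        orbit (shift h) x y ≤ orbit h x y
      pointwise {x} {y} e₁ e₂ rewrite e₁ | e₂ = ℕₚ.≤-refl

      orbit≤ : ∀ x y → orbit (shift h) x y ≤ orbit h x y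
      orbit≤ x y with view x | view y
      ... | is-u refl | is-u refl = pointwise (trans (shift-irr x) (sym (h-irr simple x))) (trans (shift-irr (τ x)) (sym (h-irr simple (τ x))))
      ... | is-v refl | is-v refl = pointwise (trans (shift-irr x) (sym (h-irr simple x))) (trans (shift-irr (τ x)) (sym (h-irr simple (τ x))))
      ... | is-u refl | is-v refl = pointwise shift-uv (subst₂ (λ a b → shift h a b ≡ h a b) (sym τu) (sym τv) shift-vu)
        where
        shift-vu : shift h v u ≡ h v u
        shift-vu = trans (shift-sym v u) (trans shift-uv (h-sym simple u v))
      ... | is-v refl | is-u refl = pointwise (trans (shift-sym v u) (trans shift-uv (h-sym simple u v))) (subst₂ (λ a b → shift h a b ≡ h a b) (sym τv) (sym τu) shift-uv)
      ... | is-u refl | other y≢u y≢v = orbit-uw≤ y≢u y≢v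
      ... | is-v refl | other y≢u y≢v = orbit-vw≤ y≢u y≢v
      ... | other x≢u x≢v | is-u refl = orbit≤-sym u x (orbit-uw≤ x≢u x≢v)
      ... | other x≢u x≢v | is-v refl = orbit≤-sym v x (orbit-vw≤ x≢u x≢v)
      ... | other x≢u x≢v | other y≢u y≢v = pointwise (shift-off x≢u x≢v y≢u y≢v)
        (subst₂ (λ a b → shift h a b ≡ h a b) (sym (τw x≢u x≢v)) (sym (τw y≢u y≢v)) (shift-off x≢u x≢v y≢u y≢v))

      halve-≤ : ∀ {a b} → a + a ≤ b + b → a ≤ b
      halve-≤ {a} {b} 2a≤2b = ℕₚ.≮⇒≥ (λ b<a → ℕₚ.<⇒≱ (ℕₚ.+-mono-< b<a b<a) 2a≤2b)

      halve-< : ∀ {a b} → a + a < b + b → a < b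
      halve-< {a} {b} 2a<2b = ℕₚ.≰⇒> (λ b≤a → ℕₚ.<⇒≱ 2a<2b (ℕₚ.+-mono-≤ b≤a b≤a))

      total-≤ : total (shift h) ≤ total h
      total-≤ = halve-≤ (subst₂ _≤_ (sum-orbit (shift h)) (sum-orbit h)
        (sum-mono (λ x → sum-mono (orbit≤ x))))

      -- The edge `vw` really moves to the lighter pair `uw`, so the orbit of `vw` loses weight and
      -- no other gains any.
      total-< : ∀ {w} → w ≢ u → w ≢ v → h v w ≡ true → h u w ≡ false → φ u w < φ v w → total (shift h) < total h
      total-< {w} w≢u w≢v hvw huw φu<φv = halve-< (subst₂ _<_ (sum-orbit (shift h)) (sum-orbit h)
        (sum-mono-< (λ x → sum-mono (orbit≤ x)) v (sum-mono-< (orbit≤ v) w strict)))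
        where
        vw< : 𝟙 (shift h u w) * φ u w + 𝟙 (shift h v w) * φ v w < 𝟙 (h u w) * φ u w + 𝟙 (h v w) * φ v w
        vw< rewrite shift-uw w≢u w≢v | shift-vw w≢u w≢v | hvw | huw
          | ℕₚ.+-identityʳ (φ u w + 0) = ℕₚ.+-monoˡ-< 0 φu<φv
        strict : orbit (shift h) v w < orbit h v w
        strict = subst₂ _<_ (sym (orbit-vw w≢u w≢v (shift h))) (sym (orbit-vw w≢u w≢v h)) vw<

Present : ∀ {n} → (Fin n → Fin n → Fin n → Bool) → Fin n → Fin n → Fin n → Set
Present h l x y = h l x y ≡ false

module _ {n} {u v : Fin n} (u≢v : u ≢ v) (h : Fin n → Fin n → Fin n → Bool) (simple : ∀ l → IsSimple (h l)) where
  open Shift u v u≢v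

  unshift-cycle : HamiltonCycle (Present (shift ∘ h)) → HamiltonCycle (Present h)
  unshift-cycle = Surgery.surgery (λ {l} {x} {y} → trans (h-sym (simple l) y x))
    (λ {l} {x} {y} → trans (shift-sym (simple l) y x)) u≢v
    (λ {l} {w} w≢u w≢v p → ∨-false (h l u w) (trans (sym (shift-uw (simple l) w≢u w≢v)) p))
    (λ {l} {w} w≢u w≢v p → ∧-false (h l v w) (trans (sym (shift-vw (simple l) w≢u w≢v)) p))
    (λ {l} p → trans (sym (shift-uv (simple l))) p)
    (λ {l} x≢u x≢v y≢u y≢v p → trans (sym (shift-off (simple l) x≢u x≢v y≢u y≢v)) p)
    where
    ∨-false : ∀ a {b} → a ∨ᵇ b ≡ false → a ≡ false × b ≡ false
    ∨-false false p = refl , p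
    ∧-false : ∀ a {b} → a ∧ b ≡ false → b ≡ false ⊎ a ≡ false
    ∧-false false p = inj₂ refl
    ∧-false true  p = inj₁ p

-- Hamiltonian cycles from lists, and their cyclic orders

module _ {A : Set} where

  nth : List A → ℕ → A → A
  nth []       _       d = d
  nth (x ∷ xs) zero    d = x
  nth (x ∷ xs) (suc k) d = nth xs k d

  nth-lookup : ∀ xs i (d : A) → lookup xs i ≡ nth xs (toℕ i) d
  nth-lookup (x ∷ xs) zero    d = refl
  nth-lookup (x ∷ xs) (suc i) d = nth-lookup xs i d

  nth-length : ∀ xs (d : A) → nth xs (length xs) d ≡ d
  nth-length []       d = refl
  nth-length (x ∷ xs) d = nth-length xs d

  nth-∷ʳ : ∀ xs l k (d : A) → k ≤ length xs → nth (xs ∷ʳ l) k d ≡ nth xs k l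
  nth-∷ʳ []       l zero    d _       = refl
  nth-∷ʳ (x ∷ xs) l zero    d _       = refl
  nth-∷ʳ (x ∷ xs) l (suc k) d (s≤s k≤) = nth-∷ʳ xs l k d k≤

length-allFin : ∀ n → length (allFin n) ≡ n
length-allFin n = Listₚ.length-tabulate {n = n} (λ i → i)

listPermutation : ∀ {n} {xs : List (Fin n)} → xs ↭ allFin n →
  Σ[ π ∈ Permutation′ n ] (∀ k d → π ⟨$⟩ʳ k ≡ nth xs (toℕ k) d)
listPermutation {n} {xs} xs↭ = cast-id n≡ ∘ₚ (π₀ ∘ₚ cast-id (length-allFin n)) , correct
  where
  n≡ : n ≡ length xs
  n≡ = trans (sym (length-allFin n)) (sym (Permₚ.↭-length xs↭))
  π₀ : Permutation (length xs) (length (allFin n))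
  π₀ = Homogeneous.onIndices (↭⇒↭ₛ xs↭)
  correct : ∀ k d → cast (length-allFin n) (π₀ ⟨$⟩ʳ cast n≡ k) ≡ nth xs (toℕ k) d
  correct k d = begin
    cast (length-allFin n) (π₀ ⟨$⟩ʳ cast n≡ k)
      ≡⟨ Listₚ.lookup-tabulate (λ i → i) (cast (length-allFin n) (π₀ ⟨$⟩ʳ cast n≡ k)) ⟨
    lookup (allFin n) (cast (sym (length-allFin n)) (cast (length-allFin n) (π₀ ⟨$⟩ʳ cast n≡ k)))
      ≡⟨ cong (lookup (allFin n)) (Finₚ.cast-involutive (sym (length-allFin n)) (length-allFin n) (π₀ ⟨$⟩ʳ cast n≡ k)) ⟩
    lookup (allFin n) (π₀ ⟨$⟩ʳ cast n≡ k)
      ≡⟨ PermₛProperties.onIndices-lookup (setoid (Fin n)) (↭⇒↭ₛ xs↭) (cast n≡ k) ⟨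
    lookup xs (cast n≡ k)
      ≡⟨ nth-lookup xs (cast n≡ k) d ⟩
    nth xs (toℕ (cast n≡ k)) d
      ≡⟨ cong (λ z → nth xs z d) (Finₚ.toℕ-cast n≡ k) ⟩
    nth xs (toℕ k) d ∎
    where open ≡-Reasoning

toℕ-next : ∀ {m} (i : Fin (suc m)) → toℕ (next i) ≡ suc (toℕ i) DivMod.% suc m
toℕ-next i = Finₚ.toℕ-fromℕ< _

toℕ-next-< : ∀ {m} (i : Fin (suc m)) → suc (toℕ i) < suc m → toℕ (next i) ≡ suc (toℕ i)
toℕ-next-< i lt = trans (toℕ-next i) (DivMod.m<n⇒m%n≡m lt)

toℕ-next-≡ : ∀ {m} (i : Fin (suc m)) → suc (toℕ i) ≡ suc m → toℕ (next i) ≡ 0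
toℕ-next-≡ {m} i eq = trans (toℕ-next i) (trans (cong (DivMod._% suc m) eq) (DivMod.n%n≡0 (suc m)))

next-≢ : ∀ {m} (i : Fin (suc (suc m))) → next i ≢ i
next-≢ i eq with ℕₚ.m≤n⇒m<n∨m≡n (Finₚ.toℕ<n i)
... | inj₁ lt = ℕₚ.1+n≢n (trans (sym (toℕ-next-< i lt)) (cong toℕ eq))
... | inj₂ i≡ = ℕₚ.1+n≢0 (trans (sym (ℕₚ.suc-injective i≡)) (trans (cong toℕ (sym eq)) (toℕ-next-≡ i i≡)))

module _ {n} {Ok : Fin n → Fin n → Fin n → Set} where

  path-lengths : ∀ {a b vs ls} → Path Ok a b vs ls → length vs ≡ suc (length ls)
  path-lengths stop         = refl
  path-lengths (step _ _ p) = cong suc (path-lengths p)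

  nth-start : ∀ {a b vs ls} → Path Ok a b vs ls → ∀ d → nth vs 0 d ≡ a
  nth-start stop         d = refl
  nth-start (step _ _ _) d = refl

  -- The default values carry the closing edge: reading one place past the end gives its label `l`
  -- and its target `c`, so the last edge is no exception.
  nth-edge : ∀ {a b c l vs ls} → Path Ok a b vs ls → Ok l b c → ∀ k → k ≤ length ls →
    Ok (nth ls k l) (nth vs k c) (nth vs (suc k) c)
  nth-edge stop            ok zero    _        = ok
  nth-edge {c = c} (step l ok′ p) ok zero _    = subst (Ok l _) (sym (nth-start p c)) ok′
  nth-edge (step l ok′ p)  ok (suc k) (s≤s k≤) = nth-edge p ok k k≤

cyclicOrder : ∀ {m} {Ok : Fin (suc m) → Fin (suc m) → Fin (suc m) → Set} → HamiltonCycle Ok →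
  Σ[ σ ∈ Permutation′ (suc m) ] Σ[ τ ∈ Permutation′ (suc m) ]
    (∀ i → Ok i (σ ⟨$⟩ʳ (τ ⟨$⟩ʳ i)) (σ ⟨$⟩ʳ next (τ ⟨$⟩ʳ i)))
-- `λs` gives the label at each position, whereas the position of each label is wanted; hence its
-- inverse.
cyclicOrder {m} {Ok} (cycle {a} {b} {vs} {ls} p l ok vs↭ ls↭) = σ , flip λs , edge
  where
  σ = proj₁ (listPermutation vs↭)
  σ≡ = proj₂ (listPermutation vs↭)
  -- The label of the closing edge moves to the end, the position of the last vertex.
  ls∷ʳ↭ : ls ∷ʳ l ↭ allFin (suc m)
  ls∷ʳ↭ = ↭-trans (↭-sym (Permₚ.∷↭∷ʳ l ls)) ls↭
  λs = proj₁ (listPermutation ls∷ʳ↭)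
  λs≡ = proj₂ (listPermutation ls∷ʳ↭)
  ∣vs∣ : length vs ≡ suc m
  ∣vs∣ = trans (Permₚ.↭-length vs↭) (length-allFin (suc m))
  ∣ls∣ : length ls ≡ m
  ∣ls∣ = ℕₚ.suc-injective (trans (sym (path-lengths p)) ∣vs∣)
  -- At the last position `next` returns to 0, and the default value `a` is the start of the path.
  wrap : ∀ k → nth vs (toℕ (next k)) a ≡ nth vs (suc (toℕ k)) a
  wrap k with ℕₚ.m≤n⇒m<n∨m≡n (Finₚ.toℕ<n k)
  ... | inj₁ lt = cong (λ z → nth vs z a) (toℕ-next-< k lt)
  ... | inj₂ eq = trans (cong (λ z → nth vs z a) (toℕ-next-≡ k eq))
    (trans (nth-start p a) (sym (trans (cong (λ z → nth vs z a) (trans eq (sym ∣vs∣))) (nth-length vs a))))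
  position : ∀ k → Ok (λs ⟨$⟩ʳ k) (σ ⟨$⟩ʳ k) (σ ⟨$⟩ʳ next k)
  position k = subst (λ z → Ok z _ _) (sym (trans (λs≡ k a) (nth-∷ʳ ls l (toℕ k) a k≤)))
    (subst₂ (Ok (nth ls (toℕ k) l)) (sym (σ≡ k a)) (sym (trans (σ≡ (next k) a) (wrap k)))
      (nth-edge p ok (toℕ k) k≤))
    where
    k≤ : toℕ k ≤ length ls
    k≤ = subst (toℕ k ≤_) (sym ∣ls∣) (Finₚ.toℕ≤pred[n] k)
  edge : ∀ i → Ok i (σ ⟨$⟩ʳ (λs ⟨$⟩ˡ i)) (σ ⟨$⟩ʳ next (λs ⟨$⟩ˡ i))
  edge i = subst (λ z → Ok z (σ ⟨$⟩ʳ (λs ⟨$⟩ˡ i)) (σ ⟨$⟩ʳ next (λs ⟨$⟩ˡ i))) (inverseʳ λs) (position (λs ⟨$⟩ˡ i))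

-- Cycles with all labels but two unrestricted.

extract : ∀ {A : Set} {x : A} {xs} → x ∈ xs → ∃[ ys ] x ∷ ys ↭ xs
extract {x = x} x∈ with ∈-∃++ x∈
... | ys , zs , refl = ys ++ zs , ↭-sym (Permₚ.shift x ys zs)

extractAll : ∀ {A : Set} {ps xs : List A} → Unique ps → (∀ {p} → p ∈ ps → p ∈ xs) → ∃[ rest ] ps ++ rest ↭ xs
extractAll []          _  = _ , ↭-refl
extractAll {ps = p ∷ ps} (p∉ ∷ ps-unique) ⊆xs with extract (⊆xs (here refl))
... | xs′ , xs′↭ with extractAll ps-unique (λ q∈ → remaining q∈ (Permₚ.∈-resp-↭ (↭-sym xs′↭) (⊆xs (there q∈))))
  where
  remaining : ∀ {q} → q ∈ ps → q ∈ p ∷ xs′ → q ∈ xs′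
  remaining q∈ (here refl) = contradiction refl (All.lookup p∉ q∈)
  remaining q∈ (there q∈′) = q∈′
...   | rest , rest↭ = rest , ↭-trans (prep p rest↭) xs′↭

completion : ∀ {n} {ps : List (Fin n)} → Unique ps → ∃[ rest ] ps ++ rest ↭ allFin n
completion ps-unique = extractAll ps-unique (λ {p} _ → ∈-allFin p)

lastOf : ∀ {A : Set} → A → List A → A
lastOf x []       = x
lastOf x (y ∷ ys) = lastOf y ys

lastOf-∷ʳ : ∀ {A : Set} (x : A) ys z → lastOf x (ys ∷ʳ z) ≡ z
lastOf-∷ʳ x []       z = refl
lastOf-∷ʳ x (y ∷ ys) z = lastOf-∷ʳ y ys z

module _ {n} {Ok : Fin n → Fin n → Fin n → Set} where

  linkedPath : ∀ {x xs ls} → Linked (λ x y → ∀ l → Ok l x y) (x ∷ xs) → length ls ≡ length xs →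
    Path Ok x (lastOf x xs) (x ∷ xs) ls
  linkedPath {xs = []}     {[]}     _        _  = stop
  linkedPath {xs = y ∷ xs} {l ∷ ls} (r ∷ rs) eq = step l (r l) (linkedPath rs (ℕₚ.suc-injective eq))

  -- The edges inside the two segments are good for every label, so once `i` and `j` are assigned to
  -- the linking edges, the other labels can be dealt out in any order: the first segment takes as
  -- many as it has edges, the second the rest.
  twoSpecialEdges : ∀ {i j x xs y ys} → i ≢ j →
    Linked (λ x y → ∀ l → Ok l x y) (x ∷ xs) → Linked (λ x y → ∀ l → Ok l x y) (y ∷ ys) →
    Ok j (lastOf x xs) y → Ok i (lastOf y ys) x →
    (x ∷ xs) ++ (y ∷ ys) ↭ allFin n → HamiltonCycle Ok
  twoSpecialEdges {i} {j} {x} {xs} {y} {ys} i≢j linked₁ linked₂ ok₁ ok₂ vs↭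
    with completion {ps = i ∷ j ∷ []} ((i≢j ∷ []) ∷ [] ∷ [])
  ... | ms , ms↭ = cycle (join (linkedPath linked₁ ∣take∣) j ok₁ (linkedPath linked₂ ∣drop∣)) i ok₂ vs↭ labels↭
    where
    a = length xs
    labels↭ : i ∷ take a ms ++ j ∷ drop a ms ↭ allFin n
    labels↭ = ↭-trans (prep i (Permₚ.shift j (take a ms) (drop a ms)))
      (subst (λ z → i ∷ j ∷ z ↭ allFin n) (sym (Listₚ.take++drop≡id a ms)) ms↭)
    ∣ms∣ : length ms ≡ a + length ys
    ∣ms∣ = ℕₚ.suc-injective (ℕₚ.suc-injective (begin
      2 + length ms               ≡⟨ Permₚ.↭-length ms↭ ⟩
      length (allFin n)           ≡⟨ Permₚ.↭-length vs↭ ⟨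
      suc (length (xs ++ y ∷ ys)) ≡⟨ cong suc (Listₚ.length-++ xs) ⟩
      suc (a + suc (length ys))   ≡⟨ cong suc (ℕₚ.+-suc a (length ys)) ⟩
      2 + (a + length ys)         ∎))
      where open ≡-Reasoning
    ∣take∣ : length (take a ms) ≡ a
    ∣take∣ = trans (Listₚ.length-take a ms) (ℕₚ.m≤n⇒m⊓n≡m (subst (a ≤_) (sym ∣ms∣) (ℕₚ.m≤m+n a _)))
    ∣drop∣ : length (drop a ms) ≡ length ys
    ∣drop∣ = trans (Listₚ.length-drop a ms) (trans (cong (ℕ._∸ a) ∣ms∣) (ℕₚ.m+n∸m≡n a (length ys)))

-- Compressed families

-- For the relation of missing edges this describes the extremal graph: `p` is the pendant vertex
-- and `q` its only neighbour.
record IsStar {n} (p q : Fin n) (g : Fin n → Fin n → Bool) : Set where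
  field
    leaf  : ∀ {w} → w ≢ p → w ≢ q → g p w ≡ true
    missed : g p q ≡ false
    off   : ∀ {x y} → x ≢ p → y ≢ p → g x y ≡ false

_when_ : ∀ {P : Set} → ℕ → Dec P → ℕ
a when yes _ = a
a when no  _ = 0

ascending : ∀ {n} → (Fin n → Fin n → Bool) → Fin n → Fin n → ℕ
ascending g x y = 𝟙 (g x y) when (toℕ x ℕₚ.<? toℕ y)

edges : ∀ {n} → (Fin n → Fin n → Bool) → ℕ
edges g = sum (λ x → sum (ascending g x))

size≡edges+edges : ∀ {n} {g : Fin n → Fin n → Bool} → IsSimple g → size g ≡ edges g + edges g
size≡edges+edges {n} {g} simple = begin
  size g
    ≡⟨ sum-cong-≗ (λ x → sum-cong-≗ (pointwise x)) ⟩
  sum (λ x → sum (λ y → ascending g x y + ascending g y x))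
    ≡⟨ sum-cong-≗ (λ x → ∑-distrib-+ (ascending g x) (λ y → ascending g y x)) ⟩
  sum (λ x → sum (ascending g x) + sum (λ y → ascending g y x))
    ≡⟨ ∑-distrib-+ (λ x → sum (ascending g x)) (λ x → sum (λ y → ascending g y x)) ⟩
  edges g + sum (λ x → sum (λ y → ascending g y x))
    ≡⟨ cong (edges g +_) (∑-comm (λ x y → ascending g y x)) ⟩
  edges g + edges g ∎
  where
  open ≡-Reasoning
  pointwise : ∀ x y → 𝟙 (g x y) ≡ ascending g x y + ascending g y x
  pointwise x y with toℕ x ℕₚ.<? toℕ y | toℕ y ℕₚ.<? toℕ x
  ... | yes x<y | yes y<x = contradiction y<x (ℕₚ.<-asym x<y)
  ... | yes _   | no _    = sym (ℕₚ.+-identityʳ _)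
  ... | no _    | yes _   = cong 𝟙 (h-sym simple x y)
  ... | no x≮y  | no y≮x  with Finₚ.toℕ-injective (ℕₚ.≤-antisym (ℕₚ.≮⇒≥ y≮x) (ℕₚ.≮⇒≥ x≮y))
  ...   | refl = cong 𝟙 (h-irr simple x)

ascending-true : ∀ {n} {g : Fin n → Fin n → Bool} {x y} → toℕ x < toℕ y → g x y ≡ true → 1 ≤ ascending g x y
ascending-true {x = x} {y} x<y gxy with toℕ x ℕₚ.<? toℕ y
... | yes _  = ℕₚ.≤-reflexive (cong 𝟙 (sym gxy))
... | no x≮y = contradiction x<y x≮y

interval≤sum : ∀ {n} (f : Fin n → ℕ) a b → b ≤ n → (∀ y → a ≤ toℕ y → toℕ y < b → 1 ≤ f y) → b ∸ a ≤ sum f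
interval≤sum {n}     f a       zero    _         _   = subst (_≤ sum f) (sym (ℕₚ.0∸n≡0 a)) z≤n
interval≤sum {suc n} f zero    (suc b) (s≤s b≤n) f≥1 =
  ℕₚ.+-mono-≤ (f≥1 zero z≤n (s≤s z≤n)) (interval≤sum (f ∘ suc) zero b b≤n (λ y _ y<b → f≥1 (suc y) z≤n (s≤s y<b)))
interval≤sum {suc n} f (suc a) (suc b) (s≤s b≤n) f≥1 =
  ℕₚ.≤-trans (interval≤sum (f ∘ suc) a b b≤n (λ y a≤y y<b → f≥1 (suc y) (s≤s a≤y) (s≤s y<b))) (ℕₚ.m≤n+m _ (f zero))

-- A compressed relation is a threshold graph whose vertex 0 has the largest degree.
Compressed : ∀ {n} → (Fin n → Fin n → Bool) → Set
Compressed g = ∀ {u v w} → toℕ u < toℕ v → w ≢ u → w ≢ v → g v w ≡ true → g u w ≡ true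

pattern 0F = zero
pattern 1F = suc zero
pattern 2F = suc (suc zero)

module CompressedGraph {m} (m≥3 : 3 ≤ m) {g : Fin (3 + m) → Fin (3 + m) → Bool} (simple : IsSimple g)
  (compressed : Compressed g) (few : size g < 2 * (2 + m)) where

  k : ℕ
  k = 2 + m

  row : Fin (3 + m) → ℕ
  row x = sum (ascending g x)

  edges<k : edges g < k
  edges<k = ℕₚ.≰⇒> (λ k≤e → ℕₚ.<⇒≱ few (subst₂ _≤_ (cong (k +_) (sym (ℕₚ.+-identityʳ k))) (sym (size≡edges+edges simple)) (ℕₚ.+-mono-≤ k≤e k≤e)))

  <⇒≢ : ∀ {x y : Fin (3 + m)} → toℕ x < toℕ y → x ≢ y
  <⇒≢ x<y refl = ℕₚ.<-irrefl refl x<y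

  -- The smaller end is lowered first: in the other order the intermediate pair of `x` and `y′`
  -- could be a loop.
  lower : ∀ {x y x′ y′} → toℕ x′ < toℕ y′ → toℕ x < toℕ y → toℕ x′ ≤ toℕ x → toℕ y′ ≤ toℕ y →
    g x y ≡ true → g x′ y′ ≡ true
  lower {x} {y} {x′} {y′} x′<y′ x<y x′≤x y′≤y gxy = trans (h-sym simple x′ y′) (lowerʳ (ℕₚ.m≤n⇒m<n∨m≡n y′≤y))
    where
    x′<y : toℕ x′ < toℕ y
    x′<y = ℕₚ.<-≤-trans x′<y′ y′≤y
    lowerˡ : toℕ x′ < toℕ x ⊎ toℕ x′ ≡ toℕ x → g x′ y ≡ true
    lowerˡ (inj₁ x′<x) = compressed x′<x (<⇒≢ x′<y ∘ sym) (<⇒≢ x<y ∘ sym) gxy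
    lowerˡ (inj₂ x′≡x) = subst (λ z → g z y ≡ true) (sym (Finₚ.toℕ-injective x′≡x)) gxy
    gyx′ : g y x′ ≡ true
    gyx′ = trans (h-sym simple y x′) (lowerˡ (ℕₚ.m≤n⇒m<n∨m≡n x′≤x))
    lowerʳ : toℕ y′ < toℕ y ⊎ toℕ y′ ≡ toℕ y → g y′ x′ ≡ true
    lowerʳ (inj₁ y′<y) = compressed y′<y (<⇒≢ x′<y′) (<⇒≢ x′<y) gyx′
    lowerʳ (inj₂ y′≡y) = subst (λ z → g z x′ ≡ true) (sym (Finₚ.toℕ-injective y′≡y)) gyx′

  row≥ : ∀ {x y} z → toℕ x < toℕ y → toℕ z ≤ toℕ x → g x y ≡ true → toℕ y ∸ toℕ z ≤ row z
  row≥ {x} {y} z x<y z≤x gxy = interval≤sum (ascending g z) (suc (toℕ z)) (suc (toℕ y)) (Finₚ.toℕ<n y)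
    (λ w z<w w≤y → ascending-true {g = g} z<w (lower z<w x<y z≤x (ℕₚ.≤-pred w≤y) gxy))

  -- An edge x y forces the edges from 0 and from 1 to all vertices up to q = toℕ y,
  -- so 2 q - 1 < k; then x ≥ 2, and the edges from 2 push the count up to k.
  heavy-pair-ordered : ∀ {x y} → 1 ≤ toℕ x → toℕ x < toℕ y → k ≤ suc (toℕ x + toℕ y) → g x y ≡ false
  heavy-pair-ordered {x} {y} 1≤x x<y k≤ = Boolₚ.¬-not λ gxy → impossible gxy
    where
    open ℕₚ.≤-Reasoning
    q = toℕ y
    rest : Fin m → ℕ
    rest z = row (suc (suc (suc z)))
    impossible : g x y ≢ true
    impossible gxy = ℕₚ.<-irrefl refl (begin-strict
      q + (q ∸ 1) + (q ∸ 2)                       ≤⟨ ℕₚ.+-mono-≤ (ℕₚ.+-mono-≤ (row≥ 0F x<y z≤n gxy) (row≥ 1F x<y 1≤x gxy)) (row≥ 2F x<y 2≤x gxy) ⟩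
      row 0F + row 1F + row 2F                    ≤⟨ ℕₚ.m≤m+n _ (sum rest) ⟩
      row 0F + row 1F + row 2F + sum rest         ≡⟨ reassociate (row 0F) (row 1F) (row 2F) (sum rest) ⟩
      edges g                                     <⟨ edges<k ⟩
      k                                           ≤⟨ k≤q+q-1+q-2 ⟩
      q + (q ∸ 1) + (q ∸ 2)                       ∎)
      where
      reassociate : ∀ a b c d → a + b + c + d ≡ a + (b + (c + d))
      reassociate = solve-∀
      -- This is where `n ≥ 6` enters: it gives `k ≥ 5`, while `q ≤ 2` would give `k ≤ 4`.
      q≥3 : 3 ≤ q
      q≥3 = ℕₚ.≰⇒> λ q≤2 → ℕₚ.<⇒≱ (s≤s (s≤s m≥3)) (begin
        k                       ≤⟨ k≤ ⟩
        suc (toℕ x + q)         ≡⟨⟩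
        suc (toℕ x) + q         ≤⟨ ℕₚ.+-mono-≤ x<y ℕₚ.≤-refl ⟩
        q + q                   ≤⟨ ℕₚ.+-mono-≤ q≤2 q≤2 ⟩
        4                       ∎)
      k≤q+q : k ≤ q + q
      k≤q+q = ℕₚ.≤-trans k≤ (ℕₚ.+-monoˡ-≤ q x<y)
      k≤q+q-1+q-2 : k ≤ q + (q ∸ 1) + (q ∸ 2)
      k≤q+q-1+q-2 = ℕₚ.≤-trans k≤q+q (lemma q≥3)
        where
        lemma : ∀ {q} → 3 ≤ q → q + q ≤ q + (q ∸ 1) + (q ∸ 2)
        lemma {suc (suc (suc r))} _ = ℕₚ.≤-trans (ℕₚ.m≤m+n _ r) (ℕₚ.≤-reflexive (e r))
          where
          e : ∀ r → 3 + r + (3 + r) + r ≡ 3 + r + (2 + r) + (1 + r)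
          e = solve-∀
        lemma {suc (suc zero)} (s≤s (s≤s ()))
        lemma {suc zero} (s≤s ())
      2≤x : 2 ≤ toℕ x
      2≤x = ℕₚ.≰⇒> λ x≤1 → ℕₚ.<-irrefl refl (begin-strict
        q + (q ∸ 1)              ≤⟨ ℕₚ.+-mono-≤ (row≥ 0F x<y z≤n gxy) (row≥ 1F x<y 1≤x gxy) ⟩
        row 0F + row 1F          ≤⟨ ℕₚ.+-monoʳ-≤ (row 0F) (ℕₚ.m≤m+n (row 1F) _) ⟩
        edges g                  <⟨ edges<k ⟩
        k                        ≤⟨ k≤ ⟩
        suc (toℕ x + q)          ≤⟨ s≤s (ℕₚ.+-monoˡ-≤ q x≤1) ⟩
        2 + q                    ≡⟨ ℕₚ.+-comm 2 q ⟩
        q + 2                    ≤⟨ ℕₚ.+-monoʳ-≤ q (ℕₚ.∸-monoˡ-≤ 1 q≥3) ⟩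
        q + (q ∸ 1)              ∎)

  heavy-pair : ∀ {x y} → 1 ≤ toℕ x → 1 ≤ toℕ y → toℕ x ≢ toℕ y → k ≤ suc (toℕ x + toℕ y) → g x y ≡ false
  heavy-pair {x} {y} 1≤x 1≤y x≢y k≤ with ℕₚ.<-cmp (toℕ x) (toℕ y)
  ... | tri< x<y _ _ = heavy-pair-ordered 1≤x x<y k≤
  ... | tri≈ _ x≡y _ = contradiction x≡y x≢y
  ... | tri> _ _ y<x = trans (h-sym simple x y)
    (heavy-pair-ordered 1≤y y<x (subst (k ≤_) (cong suc (ℕₚ.+-comm (toℕ x) (toℕ y))) k≤))

  -- Missing the edge from 0 to the last vertex would mean missing all `k` edges at 0, one more than
  -- allowed.
  zero-last : ∀ {y} → k ≤ toℕ y → g 0F y ≡ false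
  zero-last {y} k≤y = Boolₚ.¬-not λ g0y → ℕₚ.<⇒≱ edges<k
    (ℕₚ.≤-trans k≤y (ℕₚ.≤-trans (row≥ {0F} {y} 0F (ℕₚ.<-≤-trans (s≤s z≤n) k≤y) z≤n g0y) (≤sum row 0F)))

  -- Here `y` is the last vertex but one. The missing edge `0 y` forces `k ∸ 1` missing edges at 0,
  -- which exhausts the allowance and leaves none elsewhere.
  star : ∀ {y q} → suc (toℕ y) ≡ k → toℕ q ≡ k → g 0F y ≡ true → IsStar 0F q g
  star {y} {q} y≡ q≡ g0y = record
    { leaf   = λ w≢0 w≢q → lower (ℕₚ.n≢0⇒n>0 (w≢0 ∘ Finₚ.toℕ-injective)) 0<y z≤n (w≤y w≢q) g0y
    ; missed = zero-last (ℕₚ.≤-reflexive (sym q≡))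
    ; off    = λ {x′} {y′} x≢0 y≢0 → off x≢0 y≢0
    }
    where
    0<y : 0 < toℕ y
    0<y = ℕₚ.≤-pred (subst (2 ≤_) (sym y≡) (s≤s (s≤s z≤n)))
    w≤y : ∀ {w} → w ≢ q → toℕ w ≤ toℕ y
    w≤y {w} w≢q = ℕₚ.≤-pred (subst (toℕ w <_) (sym y≡) (ℕₚ.≤∧≢⇒< (Finₚ.toℕ≤pred[n] w) (λ w≡k → w≢q (Finₚ.toℕ-injective (trans w≡k (sym q≡))))))
    no-other : ∀ x y′ → toℕ (suc x) < toℕ y′ → g (suc x) y′ ≡ false
    no-other x y′ x<y′ = Boolₚ.¬-not λ gxy → ℕₚ.<⇒≱ edges<k (begin
      k                         ≡⟨ y≡ ⟨
      suc (toℕ y)               ≡⟨ ℕₚ.+-comm 1 (toℕ y) ⟩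
      toℕ y + 1                 ≤⟨ ℕₚ.+-mono-≤ (row≥ {0F} {y} 0F 0<y z≤n g0y) (ascending-true {g = g} x<y′ gxy) ⟩
      row 0F + ascending g (suc x) y′ ≤⟨ ℕₚ.+-monoʳ-≤ (row 0F) (ℕₚ.≤-trans (≤sum (ascending g (suc x)) y′) (≤sum (row ∘ suc) x)) ⟩
      edges g                   ∎)
      where open ℕₚ.≤-Reasoning
    off : ∀ {x y} → x ≢ 0F → y ≢ 0F → g x y ≡ false
    off {0F}    {_}     x≢0 _ = contradiction refl x≢0
    off {suc _} {0F}    _ y≢0 = contradiction refl y≢0
    off {suc x} {suc y} _ _ with ℕₚ.<-cmp (toℕ x) (toℕ y)
    ... | tri< x<y _ _ = no-other x (suc y) (s≤s x<y)
    ... | tri> _ _ y<x = trans (h-sym simple (suc x) (suc y)) (no-other y (suc x) (s≤s y<x))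
    ... | tri≈ _ x≡y _ = subst (λ z → g (suc x) z ≡ false) (cong suc (Finₚ.toℕ-injective x≡y)) (h-irr simple (suc x))

-- a, a + len - 1, a + 1, a + len - 2, …
zigzag : ℕ → ℕ → List ℕ
zigzag a 0             = []
zigzag a 1             = a ∷ []
zigzag a (suc (suc l)) = a ∷ suc (l + a) ∷ zigzag (suc a) l

iterate-suc : ∀ a l → (l + a) ∷ iterate suc a l ↭ iterate suc a (suc l)
iterate-suc a zero    = ↭-refl
iterate-suc a (suc l) = ↭-trans (swap (suc (l + a)) a ↭-refl)
  (prep a (↭-trans (↭-reflexive (cong (_∷ iterate suc (suc a) l) (sym (ℕₚ.+-suc l a)))) (iterate-suc (suc a) l)))

zigzag↭ : ∀ a l → zigzag a l ↭ iterate suc a l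
zigzag↭ a 0             = ↭-refl
zigzag↭ a 1             = ↭-refl
zigzag↭ a (suc (suc l)) = prep a (↭-trans (prep _ (zigzag↭ (suc a) l))
  (↭-trans (↭-reflexive (cong (_∷ iterate suc (suc a) l) (sym (ℕₚ.+-suc l a)))) (iterate-suc (suc a) l)))

tabulate≡map-iterate : ∀ {A : Set} {n} (f : ℕ → A) a (g : Fin n → A) → (∀ i → g i ≡ f (a + toℕ i)) →
  tabulate g ≡ map f (iterate suc a n)
tabulate≡map-iterate {n = zero}  f a g g≡f = refl
tabulate≡map-iterate {n = suc n} f a g g≡f = cong₂ _∷_ (trans (g≡f zero) (cong f (ℕₚ.+-identityʳ a)))
  (tabulate≡map-iterate f (suc a) (g ∘ suc) (λ i → trans (g≡f (suc i)) (cong f (ℕₚ.+-suc a (toℕ i)))))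

-- The zigzag cycle of a compressed family.

module CompressedFamily {m} (m≥3 : 3 ≤ m) (h : Fin (3 + m) → Fin (3 + m) → Fin (3 + m) → Bool)
  (simple : ∀ l → IsSimple (h l)) (compressed : ∀ l → Compressed (h l))
  (few : ∀ l → size (h l) < 2 * (2 + m)) where

  open module Member l = CompressedGraph m≥3 (simple l) (compressed l) (few l)
    using (heavy-pair; zero-last; star)

  k : ℕ
  k = 2 + m

  vertex : ℕ → Fin (suc k)
  vertex a = a mod suc k

  toℕ-vertex : ∀ {a} → a ≤ k → toℕ (vertex a) ≡ a
  toℕ-vertex {a} a≤k = trans (Finₚ.toℕ-fromℕ< _) (m<n⇒m%n≡m (s≤s a≤k))

  Linkable : ℕ → ℕ → Set
  Linkable a b = ∀ l → Present h l (vertex a) (vertex b)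

  heavy : ∀ {a b} → 1 ≤ a → a ≤ k → 1 ≤ b → b ≤ k → a ≢ b → k ≤ suc (a + b) → Linkable a b
  heavy {a} {b} 1≤a a≤k 1≤b b≤k a≢b k≤ l = heavy-pair l
    (subst (1 ≤_) (sym a≡) 1≤a) (subst (1 ≤_) (sym b≡) 1≤b)
    (λ eq → a≢b (trans (sym a≡) (trans eq b≡)))
    (subst (k ≤_) (sym (cong suc (cong₂ _+_ a≡ b≡))) k≤)
    where
    a≡ = toℕ-vertex a≤k
    b≡ = toℕ-vertex b≤k

  zigzag-first : ∀ len {a c} → a + a + suc len ≡ k → 1 ≤ a → a + suc len ≤ c → c ≤ k → Linkable c a
  zigzag-first len {a} {c} sum≡ 1≤a a≤c c≤k = heavy (ℕₚ.≤-trans 1≤a (ℕₚ.<⇒≤ a<c)) c≤k 1≤a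
    (ℕₚ.≤-trans (ℕₚ.<⇒≤ a<c) c≤k) (ℕₚ.<⇒≢ a<c ∘ sym) (ℕₚ.m≤n⇒m≤1+n (begin
      k                   ≡⟨ sum≡ ⟨
      a + a + suc len     ≡⟨ ℕₚ.+-assoc a a (suc len) ⟩
      a + (a + suc len)   ≤⟨ ℕₚ.+-monoʳ-≤ a a≤c ⟩
      a + c               ≡⟨ ℕₚ.+-comm a c ⟩
      c + a               ∎))
    where
    open ℕₚ.≤-Reasoning
    a<c : a < c
    a<c = ℕₚ.<-≤-trans (ℕₚ.m<m+n a (s≤s z≤n)) a≤c

  to-end : ∀ {c} → 1 ≤ c → c ≤ k → c ≢ suc m → Linkable c (suc m)
  to-end {c} 1≤c c≤k c≢ = heavy 1≤c c≤k (s≤s z≤n) (ℕₚ.n≤1+n _) c≢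
    (ℕₚ.≤-trans (ℕₚ.m≤n+m k c) (ℕₚ.≤-reflexive (ℕₚ.+-suc c (suc m))))

  -- `c` is the vertex just before the segment from `a` to `a + len ∸ 1`. The invariant
  -- `a + a + len ≡ k` makes the index sum of the two ends of the segment `k ∸ 1`, the least that
  -- `heavy` admits, and the sum of `c` and `a` at least `k`.
  zigzag-linked : ∀ len a c → a + a + len ≡ k → 1 ≤ a → a + len ≤ c → c ≤ k → c ≢ suc m →
    Linked Linkable (c ∷ zigzag a len ++ suc m ∷ [])
  zigzag-linked 0 a c sum≡ 1≤a a≤c c≤k c≢ =
    to-end (ℕₚ.≤-trans 1≤a (ℕₚ.≤-trans (ℕₚ.m≤m+n a 0) a≤c)) c≤k c≢ ∷ [-]
  zigzag-linked 1 a c sum≡ 1≤a a≤c c≤k c≢ =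
    zigzag-first 0 sum≡ 1≤a a≤c c≤k ∷ to-end 1≤a (ℕₚ.m≤n⇒m≤1+n (ℕₚ.<⇒≤ a<1+m)) (ℕₚ.<⇒≢ a<1+m) ∷ [-]
    where
    open ℕₚ.≤-Reasoning
    a<1+m : a < suc m
    a<1+m = begin-strict
      a           <⟨ ℕₚ.m<m+n a 1≤a ⟩
      a + a       ≡⟨ ℕₚ.suc-injective (trans (ℕₚ.+-comm 1 (a + a)) sum≡) ⟩
      suc m       ∎
  zigzag-linked (suc (suc len)) a c sum≡ 1≤a a≤c c≤k c≢ =
    zigzag-first (suc len) sum≡ 1≤a a≤c c≤k
    ∷ heavy 1≤a (ℕₚ.≤-trans (ℕₚ.<⇒≤ a<b) b≤k) (s≤s z≤n) b≤k (ℕₚ.<⇒≢ a<b) (ℕₚ.≤-reflexive (trans (sym sum≡) (e a len)))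
    ∷ zigzag-linked len (suc a) (suc (len + a)) (trans (e′ a len) sum≡) (s≤s z≤n)
        (ℕₚ.≤-reflexive (cong suc (ℕₚ.+-comm a len))) b≤k (ℕₚ.<⇒≢ b<1+m)
    where
    e : ∀ a len → a + a + (2 + len) ≡ suc (a + suc (len + a))
    e = solve-∀
    e′ : ∀ a len → suc a + suc a + len ≡ a + a + (2 + len)
    e′ = solve-∀
    a<b : a < suc (len + a)
    a<b = s≤s (ℕₚ.m≤n+m a len)
    b<1+m : suc (len + a) < suc m
    b<1+m = begin-strict
      suc (len + a)       <⟨ ℕₚ.m<n+m (suc (len + a)) 1≤a ⟩
      a + suc (len + a)   ≡⟨ ℕₚ.suc-injective (trans (sym (e a len)) sum≡) ⟩
      suc m               ∎
      where open ℕₚ.≤-Reasoning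
    b≤k : suc (len + a) ≤ k
    b≤k = ℕₚ.m≤n⇒m≤1+n (ℕₚ.<⇒≤ b<1+m)

  order↭ : vertex 0 ∷ map vertex (k ∷ zigzag 1 m ++ suc m ∷ []) ↭ allFin (suc k)
  order↭ = ↭-trans (Permₚ.map⁺ vertex (prep 0 indices↭)) (↭-reflexive (sym
    (tabulate≡map-iterate vertex 0 (λ i → i) (λ i → Finₚ.toℕ-injective (sym (toℕ-vertex (Finₚ.toℕ≤pred[n] i)))))))
    where
    indices↭ : k ∷ zigzag 1 m ++ suc m ∷ [] ↭ iterate suc 1 k
    indices↭ = ↭-trans (prep k (↭-trans (↭-sym (Permₚ.∷↭∷ʳ (suc m) (zigzag 1 m))) (prep (suc m) (zigzag↭ 1 m))))
      (↭-trans (prep k (↭-trans (↭-reflexive (cong (_∷ iterate suc 1 m) (ℕₚ.+-comm 1 m))) (iterate-suc 1 m)))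
        (↭-trans (↭-reflexive (cong (_∷ iterate suc 1 (suc m)) (ℕₚ.+-comm 1 (suc m)))) (iterate-suc 1 (suc m))))

  -- Vertex 0 is a segment of its own because its two edges are the ones that `heavy` does not
  -- cover. The edge to the last vertex is present under every label; only the edge to
  -- `vertex (suc m)` depends on the choice of `i`.
  cycle-from-label : ∀ l → h l 0F (vertex (suc m)) ≡ false → HamiltonCycle (Present h)
  cycle-from-label i free = twoSpecialEdges {j = other i} (≢other i) [-]
    (Linkedₚ.map⁺ (zigzag-linked m 1 k refl (s≤s z≤n) (ℕₚ.n≤1+n (suc m)) ℕₚ.≤-refl ℕₚ.1+n≢n))
    (zero-last (other i) (ℕₚ.≤-reflexive (sym (toℕ-vertex ℕₚ.≤-refl))))
    (subst (λ z → h i z 0F ≡ false) (sym end≡) (trans (h-sym (simple i) _ _) free))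
    order↭
    where
    other : Fin (suc k) → Fin (suc k)
    other zero    = suc zero
    other (suc _) = zero
    ≢other : ∀ i → i ≢ other i
    ≢other zero    ()
    ≢other (suc _) ()
    end≡ : lastOf (vertex k) (map vertex (zigzag 1 m ++ suc m ∷ [])) ≡ vertex (suc m)
    end≡ = trans (cong (lastOf (vertex k)) (Listₚ.map-++ vertex (zigzag 1 m) (suc m ∷ [])))
      (lastOf-∷ʳ (vertex k) (map vertex (zigzag 1 m)) (vertex (suc m)))

  cycle-or-stars : HamiltonCycle (Present h) ⊎ (∃[ p ] ∃[ q ] (p ≢ q × ∀ l → IsStar p q (h l)))
  cycle-or-stars with Finₚ.any? (λ l → h l 0F (vertex (suc m)) Boolₚ.≟ false)
  ... | yes (l , free) = inj₁ (cycle-from-label l free)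
  ... | no none        = inj₂ (0F , vertex k , 0≢k , λ l →
      star l (cong suc (toℕ-vertex (ℕₚ.n≤1+n _))) (toℕ-vertex ℕₚ.≤-refl) (Boolₚ.¬-not (λ free → none (l , free))))
    where
    0≢k : 0F ≢ vertex k
    0≢k eq = ℕₚ.1+n≢0 (sym (trans (cong toℕ eq) (toℕ-vertex ℕₚ.≤-refl)))

open IsStar

-- Families that transform to equal stars

fresh : ∀ {n} (ps : List (Fin n)) → length ps < n → ∃[ x ] x ∉ ps
fresh {n} ps ∣ps∣<n with Finₚ.any? (λ x → ¬? (_∈?_ _≟_ x ps))
... | yes found = found
... | no none with extractAll {ps = allFin n} {ps} (allFin⁺ n) (λ {x} _ → covered x)
  where
  covered : ∀ x → x ∈ ps
  covered x with _∈?_ _≟_ x ps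
  ... | yes x∈ = x∈
  ... | no x∉  = contradiction (x , x∉) none
... | rest , rest↭ = contradiction (begin
    n                               ≡⟨ length-allFin n ⟨
    length (allFin n)               ≤⟨ ℕₚ.m≤m+n _ _ ⟩
    length (allFin n) + length rest ≡⟨ Listₚ.length-++ (allFin n) ⟨
    length (allFin n ++ rest)       ≡⟨ Permₚ.↭-length rest↭ ⟩
    length ps                       ∎) (ℕₚ.<⇒≱ ∣ps∣<n)
  where open ℕₚ.≤-Reasoning

All⇒Linked : ∀ {A : Set} {P : A → Set} {R : A → A → Set} → (∀ {x y} → P x → P y → R x y) →
  ∀ {xs} → All P xs → Linked R xs
All⇒Linked f []               = []
All⇒Linked f (_ ∷ [])         = [-]
All⇒Linked f (px ∷ py ∷ pxs)  = f px py ∷ All⇒Linked f (py ∷ pxs)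

-- The vertices off the segment `x ∷ xs` are joined to each other under all labels, so those other
-- than `w₁` and `w₂` may be visited in any order between these two.
cycleThrough : ∀ {n} {Ok : Fin n → Fin n → Fin n → Set} {i j x xs w₁ w₂} → i ≢ j →
  Linked (λ x y → ∀ l → Ok l x y) (x ∷ xs) → Unique (w₁ ∷ w₂ ∷ x ∷ xs) →
  (∀ {a b} → a ∉ x ∷ xs → b ∉ x ∷ xs → ∀ l → Ok l a b) →
  Ok j (lastOf x xs) w₂ → Ok i w₁ x → HamiltonCycle Ok
cycleThrough {Ok = Ok} {i} {j} {x} {xs} {w₁} {w₂} i≢j linked unique free ok₁ ok₂ with completion unique
... | rest , rest↭ = twoSpecialEdges i≢j linked (All⇒Linked free outside) ok₁
    (subst (λ z → Ok i z x) (sym (lastOf-∷ʳ w₂ rest w₁)) ok₂) order↭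
  where
  order↭ : (x ∷ xs) ++ (w₂ ∷ rest ∷ʳ w₁) ↭ allFin _
  order↭ = ↭-trans (solve 4 (λ p a b r → p ⊕ (b ⊕ (r ⊕ a)) ⊜ a ⊕ (b ⊕ (p ⊕ r))) ↭-refl (x ∷ xs) (w₁ ∷ []) (w₂ ∷ []) rest) rest↭
  outside : All (_∉ x ∷ xs) (w₂ ∷ rest ∷ʳ w₁)
  outside = All.tabulate λ a∈ a∈′ → disjoint (x ∷ xs) (↭allFin⇒Unique order↭) a∈′ a∈
    where
    disjoint : ∀ {a} (ys : List _) {zs} → Unique (ys ++ zs) → a ∈ ys → a ∉ zs
    disjoint (y ∷ ys) (y∉ ∷ _)  (here refl) a∈zs = contradiction refl (All.lookup (Allₚ.++⁻ʳ ys y∉) a∈zs)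
    disjoint (y ∷ ys) (_ ∷ ys-unique) (there a∈ys) a∈zs = disjoint ys ys-unique a∈ys a∈zs

-- q is the vertex that the relation leaves out if it is a star centred at u.
record IsDoubleStar {n} (u v q : Fin n) (g : Fin n → Fin n → Bool) : Set where
  field
    opposite  : ∀ {w} → w ≢ u → w ≢ v → w ≢ q → g v w ≡ not (g u w)
    u-missed  : g u q ≡ false
    v-missed  : q ≢ v → g v q ≡ false
    uv-joined : v ≢ q → g u v ≡ true
    off-uv    : ∀ {x y} → x ≢ u → x ≢ v → y ≢ u → y ≢ v → g x y ≡ false

module _ {n} {u v q : Fin n} {g : Fin n → Fin n → Bool} (simple : IsSimple g) (double : IsDoubleStar u v q g) where
  open IsDoubleStar double

  doubleStar⇒star : (∀ {w} → w ≢ u → w ≢ v → w ≢ q → g u w ≡ true) → IsStar u q g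
  doubleStar⇒star full = record { leaf = leaf-u _ ; missed = u-missed ; off = off-u _ _ }
    where
    leaf-u : ∀ w → w ≢ u → w ≢ q → g u w ≡ true
    leaf-u w w≢u w≢q with w ≟ v
    ... | yes refl = uv-joined w≢q
    ... | no w≢v   = full w≢u w≢v w≢q
    off-v : ∀ w → w ≢ u → w ≢ v → g v w ≡ false
    off-v w w≢u w≢v with w ≟ q
    ... | yes refl = v-missed w≢v
    ... | no w≢q   = trans (opposite w≢u w≢v w≢q) (cong not (full w≢u w≢v w≢q))
    off-u : ∀ x y → x ≢ u → y ≢ u → g x y ≡ false
    off-u x y x≢u y≢u with x ≟ v | y ≟ v
    ... | yes refl | yes refl = h-irr simple x
    ... | yes refl | no y≢v   = off-v y y≢u y≢v
    ... | no x≢v   | yes refl = trans (h-sym simple x y) (off-v x x≢u x≢v)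
    ... | no x≢v   | no y≢v   = off-uv x≢u x≢v y≢u y≢v

module _ {n} (n≥6 : 6 ≤ n) where

  2≤n : 2 ≤ n
  2≤n = ℕₚ.≤-trans (s≤s (s≤s z≤n)) n≥6

  -- A Boolean matrix that is not constant on the columns other than s, t, r has a
  -- false and a true entry there in different rows and different columns.
  module _ (b : Fin n → Fin n → Bool) (s t r : Fin n) where

    Free : Fin n → Set
    Free w = w ≢ s × w ≢ t × w ≢ r

    record Crossing : Set where
      constructor crossing
      field
        {i j w₁ w₂} : Fin n
        i≢j   : i ≢ j
        w₁≢w₂ : w₁ ≢ w₂
        free₁ : Free w₁
        free₂ : Free w₂
        low   : b i w₁ ≡ false
        high  : b j w₂ ≡ true

    -- Five columns have to be avoided, so a sixth is required.
    third : ∀ w w′ → ∃[ w″ ] (Free w″ × w″ ≢ w × w″ ≢ w′)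
    third w w′ with fresh (s ∷ t ∷ r ∷ w ∷ w′ ∷ []) n≥6
    ... | x , x∉ = x , ((λ { refl → x∉ (here refl) }) , (λ { refl → x∉ (there (here refl)) }) , (λ { refl → x∉ (there (there (here refl))) }))
      , (λ { refl → x∉ (there (there (there (here refl)))) }) , (λ { refl → x∉ (there (there (there (there (here refl))))) })

    otherRow : ∀ i → ∃[ k ] k ≢ i
    otherRow i with fresh (i ∷ []) 2≤n
    ... | k , k∉ = k , λ { refl → k∉ (here refl) }

    -- A two by two checkerboard contains no crossing, since its unequal entries share a row or a
    -- column; any third column supplies one.
    square : ∀ {i k w w′} → i ≢ k → Free w → Free w′ →
      b i w ≡ false → b i w′ ≡ true → b k w ≡ true → b k w′ ≡ false → Crossing
    square {i} {k} {w} {w′} i≢k Fw Fw′ iw iw′ kw kw′ with third w w′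
    ... | w″ , Fw″ , w″≢w , w″≢w′ with b i w″ in iw″
    ...   | false = crossing i≢k w″≢w Fw″ Fw iw″ kw
    ...   | true  = crossing (i≢k ∘ sym) (w″≢w′ ∘ sym) Fw′ Fw″ kw′ iw″

    sameRow : ∀ {i w w′} → Free w → Free w′ → b i w ≡ false → b i w′ ≡ true → Crossing
    sameRow {i} {w} {w′} Fw Fw′ iw iw′ with otherRow i
    ... | k , k≢i with b k w′ in kw′
    ...   | true  = crossing (k≢i ∘ sym) w≢w′ Fw Fw′ iw kw′
      where
      w≢w′ : w ≢ w′
      w≢w′ refl with trans (sym iw) iw′
      ... | ()
    ...   | false with b k w in kw
    ...     | false = crossing k≢i w≢w′ Fw Fw′ kw iw′
      where
      w≢w′ : w ≢ w′
      w≢w′ refl with trans (sym iw) iw′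
      ... | ()
    ...     | true  = square (k≢i ∘ sym) Fw Fw′ iw iw′ kw kw′

    cross : ∀ {i j w w′} → Free w → Free w′ → b i w ≡ false → b j w′ ≡ true → Crossing
    cross {i} {j} {w} {w′} Fw Fw′ iw jw′ with i ≟ j | w ≟ w′
    ... | yes refl | _        = sameRow Fw Fw′ iw jw′
    ... | no i≢j   | no w≢w′  = crossing i≢j w≢w′ Fw Fw′ iw jw′
    ... | no i≢j   | yes refl with third w w
    ...   | w″ , Fw″ , w″≢w , _ with b j w″ in jw″
    ...     | true  = crossing i≢j (w″≢w ∘ sym) Fw Fw″ iw jw″
    ...     | false with b i w″ in iw″
    ...       | false = crossing i≢j w″≢w Fw″ Fw iw″ jw′
    ...       | true  = square i≢j Fw Fw″ iw iw″ jw′ jw″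

    Constant : Bool → Set
    Constant c = ∀ {w} → Free w → ∀ i → b i w ≡ c

    constant? : ∀ c → Constant c ⊎ (∃[ i ] ∃[ w ] (Free w × b i w ≡ not c))
    constant? c with Finₚ.any? (λ i → Finₚ.any? (λ w → (¬? (w ≟ s) ×-dec (¬? (w ≟ t) ×-dec ¬? (w ≟ r))) ×-dec (b i w Boolₚ.≟ not c)))
    ... | yes (i , w , Fw , iw) = inj₂ (i , w , Fw , iw)
    ... | no none = inj₁ λ {w} Fw i → trans (Boolₚ.¬-not (λ iw → none (i , w , Fw , iw))) (Boolₚ.not-involutive c)

    crossing-or-constant : Crossing ⊎ (Constant true ⊎ Constant false)
    crossing-or-constant with constant? true | constant? false
    ... | inj₁ all-true | _              = inj₂ (inj₁ all-true)
    ... | inj₂ _        | inj₁ all-false = inj₂ (inj₂ all-false)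
    ... | inj₂ (i , w , Fw , iw) | inj₂ (j , w′ , Fw′ , jw′) = inj₁ (cross Fw Fw′ iw jw′)

  Stars : (Fin n → Fin n → Fin n → Bool) → Set
  Stars h = ∃[ p ] ∃[ q ] (p ≢ q × ∀ l → IsStar p q (h l))

  module _ {u v : Fin n} (u≢v : u ≢ v) (h : Fin n → Fin n → Fin n → Bool) (simple : ∀ l → IsSimple (h l)) where
    open Shift u v u≢v

    -- Consider the matrix of missing edges at `u`, with labels as rows. If it is constant, all
    -- leaves lie at one centre, and the family consists of equal stars. A crossing says that `w₁ u`
    -- is present under `i` and, `v` being opposite to `u`, that `v w₂` is present under `j`. The
    -- path `u ∷ xs` joins `u` to `v` by edges that are never missing: the edge `uv` itself if
    -- `q ≡ v`, and the detour through `q` otherwise.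
    doubleStars : ∀ {q r xs} → (∀ l → IsDoubleStar u v q (h l)) → (∀ l → IsDoubleStar v u r (h l)) →
      q ≢ u → r ≢ v → (∀ {w} → w ≢ u → w ≢ v → w ≢ q → w ∉ u ∷ xs) → u ∈ u ∷ xs → v ∈ u ∷ xs →
      (∀ {w} → w ≢ u → w ≢ v → w ≢ r → w ≢ q) → Unique (u ∷ xs) →
      Linked (λ x y → ∀ l → Present h l x y) (u ∷ xs) → lastOf u xs ≡ v →
      HamiltonCycle (Present h) ⊎ Stars h
    doubleStars {q} {r} {xs} double double′ q≢u r≢v outside u∈ v∈ r⇒q unique linked last≡
      with crossing-or-constant (λ l w → h l u w) u v q
    ... | inj₂ (inj₁ all-true) = inj₂ (u , q , q≢u ∘ sym , λ l →
      doubleStar⇒star (simple l) (double l) (λ w≢u w≢v w≢q → all-true (w≢u , w≢v , w≢q) l))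
    ... | inj₂ (inj₂ all-false) = inj₂ (v , r , r≢v ∘ sym , λ l →
      doubleStar⇒star (simple l) (double′ l) (λ w≢v w≢u w≢r →
        trans (IsDoubleStar.opposite (double l) w≢u w≢v (r⇒q w≢u w≢v w≢r)) (cong not (all-false (w≢u , w≢v , r⇒q w≢u w≢v w≢r) l))))
    ... | inj₁ (crossing {i} {j} {w₁} {w₂} i≢j w₁≢w₂ free₁ free₂ low high) =
      inj₁ (cycleThrough i≢j linked
        ((w₁≢w₂ ∷ avoids free₁) ∷ avoids free₂ ∷ unique)
        (λ a∉ b∉ l → IsDoubleStar.off-uv (double l) (∉⇒≢ a∉ u∈) (∉⇒≢ a∉ v∈) (∉⇒≢ b∉ u∈) (∉⇒≢ b∉ v∈))
        (subst (λ z → h j z w₂ ≡ false) (sym last≡)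
          (trans (IsDoubleStar.opposite (double j) (proj₁ free₂) (proj₁ (proj₂ free₂)) (proj₂ (proj₂ free₂))) (cong not high)))
        (trans (h-sym (simple i) w₁ u) low))
      where
      ∉⇒≢ : ∀ {a b : Fin n} {ys} → a ∉ ys → b ∈ ys → a ≢ b
      ∉⇒≢ a∉ b∈ refl = a∉ b∈
      avoids : ∀ {w} → w ≢ u × w ≢ v × w ≢ q → All (w ≢_) (u ∷ xs)
      avoids (w≢u , w≢v , w≢q) = All.tabulate (∉⇒≢ (outside w≢u w≢v w≢q))

    module _ {p q} (p≢q : p ≢ q) (stars : ∀ l → IsStar p q (shift (h l))) where

      ∧-false∨-true : ∀ {a b} → b ∧ a ≡ false → a ∨ᵇ b ≡ true → b ≡ not a
      ∧-false∨-true {true}  {false} _ _ = refl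
      ∧-false∨-true {false} {true}  _ _ = refl

      ∨-false : ∀ {a b} → a ∨ᵇ b ≡ false → a ≡ false × b ≡ false
      ∨-false {false} {false} _ = refl , refl

      ∧-true : ∀ {a b} → a ∧ b ≡ true → a ≡ true × b ≡ true
      ∧-true {true} {true} _ = refl , refl

      module CentreU (p≡u : p ≡ u) where

        star-u : ∀ l → IsStar u q (shift (h l))
        star-u l = subst (λ z → IsStar z q (shift (h l))) p≡u (stars l)

        q≢u : q ≢ u
        q≢u q≡u = p≢q (trans p≡u (sym q≡u))

        -- The star has the disjunction at `uw` true and the conjunction at `vw` false, so exactly
        -- one of the two edges was missing.
        opposite : ∀ l {w} → w ≢ u → w ≢ v → w ≢ q → h l v w ≡ not (h l u w)
        opposite l w≢u w≢v w≢q = ∧-false∨-true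
          (trans (sym (shift-vw (simple l) w≢u w≢v)) (off (star-u l) (u≢v ∘ sym) w≢u))
          (trans (sym (shift-uw (simple l) w≢u w≢v)) (leaf (star-u l) w≢u w≢q))

        opposite′ : ∀ l {w} → w ≢ u → w ≢ v → w ≢ q → h l u w ≡ not (h l v w)
        opposite′ l w≢u w≢v w≢q = trans (sym (Boolₚ.not-involutive _)) (cong not (sym (opposite l w≢u w≢v w≢q)))

        off-uv : ∀ l {x y} → x ≢ u → x ≢ v → y ≢ u → y ≢ v → h l x y ≡ false
        off-uv l x≢u x≢v y≢u y≢v = trans (sym (shift-off (simple l) x≢u x≢v y≢u y≢v)) (off (star-u l) x≢u y≢u)

        q≡v-case : q ≡ v → HamiltonCycle (Present h) ⊎ Stars h
        q≡v-case q≡v = doubleStars {v} {u} {v ∷ []}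
          (λ l → record
            { opposite  = λ w≢u w≢v _ → opposite l w≢u w≢v (w≢v ∘ λ w≡q → trans w≡q q≡v)
            ; u-missed  = uv l
            ; v-missed  = λ v≢v → contradiction refl v≢v
            ; uv-joined = λ v≢v → contradiction refl v≢v
            ; off-uv    = off-uv l })
          (λ l → record
            { opposite  = λ w≢v w≢u _ → opposite′ l w≢u w≢v (w≢v ∘ λ w≡q → trans w≡q q≡v)
            ; u-missed  = trans (h-sym (simple l) v u) (uv l)
            ; v-missed  = λ u≢u → contradiction refl u≢u
            ; uv-joined = λ u≢u → contradiction refl u≢u
            ; off-uv    = λ x≢v x≢u y≢v y≢u → off-uv l x≢u x≢v y≢u y≢v })
          (u≢v ∘ sym) u≢v
          (λ { w≢u _ _ (here w≡u) → w≢u w≡u ; _ w≢v _ (there (here w≡v)) → w≢v w≡v })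
          (here refl) (there (here refl)) (λ _ w≢v _ → w≢v)
          ((u≢v ∷ []) ∷ [] ∷ []) (uv ∷ [-]) refl
          where
          uv : ∀ l → h l u v ≡ false
          uv l = trans (sym (shift-uv (simple l))) (subst (λ z → shift (h l) u z ≡ false) q≡v (missed (star-u l)))

        q≢v-case : q ≢ v → HamiltonCycle (Present h) ⊎ Stars h
        q≢v-case q≢v = doubleStars {q} {q} {q ∷ v ∷ []}
          (λ l → record
            { opposite  = opposite l
            ; u-missed  = uq l
            ; v-missed  = λ _ → vq l
            ; uv-joined = λ _ → uv l
            ; off-uv    = off-uv l })
          (λ l → record
            { opposite  = λ w≢v w≢u w≢q → opposite′ l w≢u w≢v w≢q
            ; u-missed  = vq l
            ; v-missed  = λ _ → uq l
            ; uv-joined = λ _ → trans (h-sym (simple l) v u) (uv l)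
            ; off-uv    = λ x≢v x≢u y≢v y≢u → off-uv l x≢u x≢v y≢u y≢v })
          q≢u q≢v
          (λ { w≢u _ _ (here w≡u) → w≢u w≡u ; _ _ w≢q (there (here w≡q)) → w≢q w≡q
             ; _ w≢v _ (there (there (here w≡v))) → w≢v w≡v })
          (here refl) (there (there (here refl))) (λ _ _ w≢q → w≢q)
          (((q≢u ∘ sym) ∷ u≢v ∷ []) ∷ (q≢v ∷ []) ∷ [] ∷ [])
          (uq ∷ (λ l → trans (h-sym (simple l) q v) (vq l)) ∷ [-]) refl
          where
          both : ∀ l → h l u q ≡ false × h l v q ≡ false
          both l = ∨-false (trans (sym (shift-uw (simple l) q≢u q≢v)) (missed (star-u l)))
          uq : ∀ l → h l u q ≡ false
          uq l = proj₁ (both l)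
          vq : ∀ l → h l v q ≡ false
          vq l = proj₂ (both l)
          uv : ∀ l → h l u v ≡ true
          uv l = trans (sym (shift-uv (simple l))) (leaf (star-u l) (u≢v ∘ sym) (q≢v ∘ sym))

      module CentreOther (p≢u : p ≢ u) (p≢v : p ≢ v) where

        off-u : ∀ l {w} → w ≢ u → w ≢ v → w ≢ p → h l u w ≡ false × h l v w ≡ false
        off-u l w≢u w≢v w≢p = ∨-false (trans (sym (shift-uw (simple l) w≢u w≢v)) (off (stars l) (p≢u ∘ sym) w≢p))

        off-p : ∀ l {x y} → x ≢ p → y ≢ p → h l x y ≡ false
        off-p l {x} {y} x≢p y≢p with view x | view y
        ... | is-u refl | is-u refl = h-irr (simple l) x
        ... | is-v refl | is-v refl = h-irr (simple l) x
        ... | is-u refl | is-v refl = trans (sym (shift-uv (simple l))) (off (stars l) x≢p y≢p)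
        ... | is-v refl | is-u refl = trans (h-sym (simple l) x y) (trans (sym (shift-uv (simple l))) (off (stars l) y≢p x≢p))
        ... | is-u refl | other y≢u y≢v = proj₁ (off-u l y≢u y≢v y≢p)
        ... | is-v refl | other y≢u y≢v = proj₂ (off-u l y≢u y≢v y≢p)
        ... | other x≢u x≢v | is-u refl = trans (h-sym (simple l) x y) (proj₁ (off-u l x≢u x≢v x≢p))
        ... | other x≢u x≢v | is-v refl = trans (h-sym (simple l) x y) (proj₂ (off-u l x≢u x≢v x≢p))
        ... | other x≢u x≢v | other y≢u y≢v = trans (sym (shift-off (simple l) x≢u x≢v y≢u y≢v)) (off (stars l) x≢p y≢p)

        -- After the shift the entry at `pv` is a conjunction, so a leaf `v` shows that `pu` and
        -- `pv` were both missing before; this is why the shift changes nothing in this case.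
        both-joined : ∀ l → v ≢ q → h l p u ≡ true × h l p v ≡ true
        both-joined l v≢q with ∧-true (trans (sym (shift-vw (simple l) p≢u p≢v)) (trans (shift-sym (simple l) v p) (leaf (stars l) (p≢v ∘ sym) v≢q)))
        ... | vp , up = trans (h-sym (simple l) p u) up , trans (h-sym (simple l) p v) vp

        q≢u : Fin n → v ≢ q → q ≢ u
        q≢u l v≢q refl with both-joined l v≢q
        ... | pu , _ with trans (sym (missed (stars l))) (trans (shift-sym (simple l) p u) (trans (shift-uw (simple l) p≢u p≢v) (cong (_∨ᵇ h l v p) (trans (h-sym (simple l) u p) pu))))
        ...   | ()

        unchanged : v ≢ q → Stars h
        unchanged v≢q = p , q , p≢q , λ l → record { leaf = leaf-p l _ ; missed = missed-q l ; off = off-p l }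
          where
          missed-q : ∀ l → h l p q ≡ false
          missed-q l = trans (sym (shift-off (simple l) p≢u p≢v (q≢u l v≢q) (v≢q ∘ sym))) (missed (stars l))
          leaf-p : ∀ l w → w ≢ p → w ≢ q → h l p w ≡ true
          leaf-p l w w≢p w≢q with view w
          ... | is-u refl     = proj₁ (both-joined l v≢q)
          ... | is-v refl     = proj₂ (both-joined l v≢q)
          ... | other w≢u w≢v = trans (sym (shift-off (simple l) p≢u p≢v w≢u w≢v)) (leaf (stars l) w≢p w≢q)

        leaf-other : ∀ l {w} → w ≢ p → w ≢ u → w ≢ v → v ≡ q → h l p w ≡ true
        leaf-other l w≢p w≢u w≢v v≡q = trans (sym (shift-off (simple l) p≢u p≢v w≢u w≢v))
          (leaf (stars l) w≢p (w≢v ∘ λ w≡q → trans w≡q (sym v≡q)))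

        pv≡ : v ≡ q → ∀ l → h l p v ≡ not (h l p u)
        pv≡ v≡q l = trans (h-sym (simple l) p v) (trans (∧-false∨-true vp∧up up∨vp) (cong not (h-sym (simple l) u p)))
          where
          vp∧up : h l v p ∧ h l u p ≡ false
          vp∧up = trans (sym (shift-vw (simple l) p≢u p≢v)) (trans (shift-sym (simple l) v p)
            (subst (λ z → shift (h l) p z ≡ false) (sym v≡q) (missed (stars l))))
          up∨vp : h l u p ∨ᵇ h l v p ≡ true
          up∨vp = trans (sym (shift-uw (simple l) p≢u p≢v)) (trans (shift-sym (simple l) u p)
            (leaf (stars l) (p≢u ∘ sym) (u≢v ∘ λ u≡q → trans u≡q (sym v≡q))))

        -- Each label misses exactly one of `pu` and `pv`. If all labels agree on which, the family
        -- was already one of equal stars; if not, a cycle passes through `u p v` with two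
        -- disagreeing labels, all edges off `p` being present.
        pendant : v ≡ q → HamiltonCycle (Present h) ⊎ Stars h
        pendant refl with Finₚ.any? (λ l → h l p u Boolₚ.≟ false) | Finₚ.any? (λ l → h l p u Boolₚ.≟ true)
        ... | yes (i , pu) | yes (j , pu′) = inj₁ (cycleThrough {i = i} {j} {p} {[]} {u} {v} i≢j [-]
          ((u≢v ∷ (p≢u ∘ sym) ∷ []) ∷ ((p≢v ∘ sym) ∷ []) ∷ [] ∷ [])
          (λ a∉ b∉ l → off-p l (a∉ ∘ here) (b∉ ∘ here))
          (trans (pv≡ refl j) (cong not pu′)) (trans (h-sym (simple i) u p) pu))
          where
          i≢j : i ≢ j
          i≢j refl with trans (sym pu) pu′
          ... | ()
        ... | no none | _ = inj₂ (p , v , p≢v , λ l → record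
          { leaf = leaf-p l _ ; missed = trans (pv≡ refl l) (cong not (pu l)) ; off = off-p l })
          where
          pu : ∀ l → h l p u ≡ true
          pu l = Boolₚ.¬-not (λ pu → none (l , pu))
          leaf-p : ∀ l w → w ≢ p → w ≢ v → h l p w ≡ true
          leaf-p l w w≢p w≢v with w ≟ u
          ... | yes refl = pu l
          ... | no w≢u   = leaf-other l w≢p w≢u w≢v refl
        ... | yes _ | no none = inj₂ (p , u , p≢u , λ l → record
          { leaf = leaf-p l _ ; missed = pu l ; off = off-p l })
          where
          pu : ∀ l → h l p u ≡ false
          pu l = Boolₚ.¬-not (λ pu → none (l , pu))
          leaf-p : ∀ l w → w ≢ p → w ≢ u → h l p w ≡ true
          leaf-p l w w≢p w≢u with w ≟ v
          ... | yes refl = trans (pv≡ refl l) (cong not (pu l))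
          ... | no w≢v   = leaf-other l w≢p w≢u w≢v refl

      -- The shift leaves at `vw` only what it also puts at `uw`, so a leaf at `v` would bring a
      -- missing edge at `u`, off the centre.
      centre≢v : p ≢ v
      centre≢v refl with fresh (u ∷ v ∷ q ∷ []) (ℕₚ.≤-trans (s≤s (s≤s (s≤s (s≤s z≤n)))) n≥6)
      -- `w` serves both as a leaf and as the label under which the contradiction is read off.
      ... | w , w∉ with trans (sym (off (stars w) u≢v w≢v)) (trans (shift-uw (simple w) w≢u w≢v) (cong (_∨ᵇ h w v w) uw))
        where
        w≢u : w ≢ u
        w≢u w≡u = w∉ (here w≡u)
        w≢v : w ≢ v
        w≢v w≡v = w∉ (there (here w≡v))
        uw : h w u w ≡ true
        uw = proj₂ (∧-true (trans (sym (shift-vw (simple w) w≢u w≢v)) (leaf (stars w) w≢v (λ w≡q → w∉ (there (there (here w≡q)))))))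
      ...   | ()

      unshift-stars : HamiltonCycle (Present h) ⊎ Stars h
      unshift-stars with view p | q ≟ v
      ... | is-u p≡u      | yes q≡v = CentreU.q≡v-case p≡u q≡v
      ... | is-u p≡u      | no q≢v  = CentreU.q≢v-case p≡u q≢v
      ... | is-v p≡v      | _       = contradiction p≡v centre≢v
      ... | other p≢u p≢v | yes q≡v = CentreOther.pendant p≢u p≢v (sym q≡v)
      ... | other p≢u p≢v | no q≢v  = inj₂ (CentreOther.unchanged p≢u p≢v (q≢v ∘ sym))

-- The main theorem

indexSum : ∀ {n} → Fin n → Fin n → ℕ
indexSum x y = toℕ x + toℕ y

size≡weighted : ∀ {n} (g : Fin n → Fin n → Bool) → size g ≡ weightedSize (λ _ _ → 1) g
size≡weighted g = sum-cong-≗ (λ x → sum-cong-≗ (λ y → sym (ℕₚ.*-identityʳ (𝟙 (g x y)))))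

module _ {m} (m≥3 : 3 ≤ m) where

  -- The numbers of missing edges are preserved, so termination needs a weight that sees positions:
  -- moving an edge from `v` to a smaller `u` lowers its index sum.
  potential : (Fin (3 + m) → Fin (3 + m) → Fin (3 + m) → Bool) → ℕ
  potential h = sum (λ l → weightedSize indexSum (h l))

  Uncompressed : (Fin (3 + m) → Fin (3 + m) → Fin (3 + m) → Bool) → Set
  Uncompressed h = ∃[ u ] ∃[ v ] (toℕ u < toℕ v ×
    ∃[ l ] ∃[ w ] (w ≢ u × w ≢ v × h l v w ≡ true × h l u w ≡ false))

  uncompressed? : ∀ h → Dec (Uncompressed h)
  uncompressed? h = Finₚ.any? λ u → Finₚ.any? λ v → (toℕ u ℕₚ.<? toℕ v) ×-dec
    Finₚ.any? λ l → Finₚ.any? λ w → ¬? (w ≟ u) ×-dec ¬? (w ≟ v) ×-dec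
      (h l v w Boolₚ.≟ true) ×-dec (h l u w Boolₚ.≟ false)

  -- One uncompressed member suffices to shift the whole family along the same pair `u`, `v`, as
  -- `unshift-cycle` demands; the weights of the other members do not grow.
  cycle-or-stars : ∀ h → (∀ l → IsSimple (h l)) → (∀ l → size (h l) < 2 * (2 + m)) →
    Acc _<_ (potential h) → HamiltonCycle (Present h) ⊎ (∃[ p ] ∃[ q ] (p ≢ q × ∀ l → IsStar p q (h l)))
  cycle-or-stars h simple few (acc rec) with uncompressed? h
  ... | no compressed = CompressedFamily.cycle-or-stars m≥3 h simple
    (λ l u<v w≢u w≢v hvw → Boolₚ.¬-not λ huw → compressed (_ , _ , u<v , l , _ , w≢u , w≢v , hvw , huw)) few
  ... | yes (u , v , u<v , l , w , w≢u , w≢v , hvw , huw) =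
    [ inj₁ ∘ unshift-cycle u≢v h simple
    , (λ { (p , q , p≢q , stars) → unshift-stars (s≤s (s≤s (s≤s m≥3))) u≢v h simple p≢q stars })
    ]′ (cycle-or-stars (shift ∘ h) (λ l → shift-simple (simple l)) few′ (rec potential<))
    where
    u≢v : u ≢ v
    u≢v refl = ℕₚ.<-irrefl refl u<v
    open Shift u v u≢v
    few′ : ∀ l → size (shift (h l)) < 2 * (2 + m)
    few′ l = ℕₚ.≤-<-trans (subst₂ _≤_ (sym (size≡weighted (shift (h l)))) (sym (size≡weighted (h l)))
      (Weighted.total-≤ (simple l) (λ _ _ → 1) (λ _ _ → refl) (λ _ → ℕₚ.≤-refl))) (few l)
    module ByIndex l = Weighted (simple l) indexSum (λ x y → ℕₚ.+-comm (toℕ x) (toℕ y))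
      (λ w → ℕₚ.+-monoˡ-≤ (toℕ w) (ℕₚ.<⇒≤ u<v))
    potential< : potential (shift ∘ h) < potential h
    potential< = sum-mono-< (ByIndex.total-≤) l (ByIndex.total-< l w≢u w≢v hvw huw (ℕₚ.+-monoˡ-< (toℕ w) u<v))

-- Stars of missing edges and the extremal graph.

⟨$⟩ʳ-injective : ∀ {m n} (π : Permutation m n) {x y} → π ⟨$⟩ʳ x ≡ π ⟨$⟩ʳ y → x ≡ y
⟨$⟩ʳ-injective π eq = trans (sym (inverseˡ π)) (trans (cong (π ⟨$⟩ˡ_) eq) (inverseˡ π))

-- Stated along a permutation so that it yields isomorphism with the extremal graph and, for the
-- identity, equality of two members.
star-determined : ∀ {m n} {g : Fin m → Fin m → Bool} {g′ : Fin n → Fin n → Bool} →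
  IsSimple g → IsSimple g′ → ∀ {p q} (π : Permutation m n) → IsStar p q g → IsStar (π ⟨$⟩ʳ p) (π ⟨$⟩ʳ q) g′ →
  ∀ x y → g x y ≡ g′ (π ⟨$⟩ʳ x) (π ⟨$⟩ʳ y)
star-determined {g = g} {g′} simple simple′ {p} {q} π star star′ x y with x ≟ p | y ≟ p
... | yes refl | _        = fromCentre y
  where
  fromCentre : ∀ y → g p y ≡ g′ (π ⟨$⟩ʳ p) (π ⟨$⟩ʳ y)
  fromCentre y with y ≟ p | y ≟ q
  ... | yes refl | _        = trans (h-irr simple y) (sym (h-irr simple′ _))
  ... | no _     | yes refl = trans (missed star) (sym (missed star′))
  ... | no y≢p   | no y≢q   = trans (leaf star y≢p y≢q) (sym (leaf star′ (y≢p ∘ ⟨$⟩ʳ-injective π) (y≢q ∘ ⟨$⟩ʳ-injective π)))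
... | no x≢p   | yes refl = trans (h-sym simple x y) (trans fromCentre (h-sym simple′ (π ⟨$⟩ʳ y) (π ⟨$⟩ʳ x)))
  where
  fromCentre : g y x ≡ g′ (π ⟨$⟩ʳ y) (π ⟨$⟩ʳ x)
  fromCentre with x ≟ q
  ... | yes refl = trans (missed star) (sym (missed star′))
  ... | no x≢q   = trans (leaf star x≢p x≢q) (sym (leaf star′ (x≢p ∘ ⟨$⟩ʳ-injective π) (x≢q ∘ ⟨$⟩ʳ-injective π)))
... | no x≢p   | no y≢p   = trans (off star x≢p y≢p) (sym (off star′ (x≢p ∘ ⟨$⟩ʳ-injective π) (y≢p ∘ ⟨$⟩ʳ-injective π)))

missing-simple : ∀ {n} (G : Graph n) → IsSimple (missing G)
missing-simple G = record { h-sym = missing-sym G ; h-irr = missing-irr G }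

adj-from-missing : ∀ {n} (G : Graph n) x y → adj G x y ≡ not ⌊ x ≟ y ⌋ ∧ not (missing G x y)
adj-from-missing G x y with x ≟ y
... | yes refl = adj-irr G x
... | no _     = sym (Boolₚ.not-involutive (adj G x y))

missing-determines : ∀ {m n} (G : Graph m) (H : Graph n) (π : Permutation m n) →
  (∀ x y → missing G x y ≡ missing H (π ⟨$⟩ʳ x) (π ⟨$⟩ʳ y)) →
  ∀ x y → adj G x y ≡ adj H (π ⟨$⟩ʳ x) (π ⟨$⟩ʳ y)
missing-determines G H π same x y = begin
  adj G x y
    ≡⟨ adj-from-missing G x y ⟩
  not ⌊ x ≟ y ⌋ ∧ not (missing G x y)
    ≡⟨ cong₂ (λ a b → not a ∧ not b) ≟-same (same x y) ⟩
  not ⌊ π ⟨$⟩ʳ x ≟ π ⟨$⟩ʳ y ⌋ ∧ not (missing H (π ⟨$⟩ʳ x) (π ⟨$⟩ʳ y))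
    ≡⟨ adj-from-missing H (π ⟨$⟩ʳ x) (π ⟨$⟩ʳ y) ⟨
  adj H (π ⟨$⟩ʳ x) (π ⟨$⟩ʳ y) ∎
  where
  open ≡-Reasoning
  ≟-same : ⌊ x ≟ y ⌋ ≡ ⌊ π ⟨$⟩ʳ x ≟ π ⟨$⟩ʳ y ⌋
  ≟-same with x ≟ y | π ⟨$⟩ʳ x ≟ π ⟨$⟩ʳ y
  ... | yes _    | yes _  = refl
  ... | no _     | no _   = refl
  ... | yes refl | no neq = contradiction refl neq
  ... | no x≢y   | yes eq = contradiction (⟨$⟩ʳ-injective π eq) x≢y

module _ (m : ℕ) where

  Extremal : Graph (1 + (m + 1))
  Extremal = K 1 ∨ (K m ∪ K 1)

  -- The vertex of the last `K 1`; its only neighbour is `zero`, the vertex of the first.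
  pendantVertex : Fin (1 + (m + 1))
  pendantVertex = suc (m ↑ʳ zero)

  missing-adj : ∀ {x y} → adj Extremal x y ≡ true → missing Extremal x y ≡ false
  missing-adj {x} {y} a rewrite a = Boolₚ.∧-zeroʳ (not ⌊ x ≟ y ⌋)

  missing-nonadj : ∀ {x y} → x ≢ y → adj Extremal x y ≡ false → missing Extremal x y ≡ true
  missing-nonadj {x} {y} x≢y a with x ≟ y
  ... | yes x≡y = contradiction x≡y x≢y
  ... | no _    = cong not a

  extremal-star : IsStar pendantVertex zero (missing Extremal)
  extremal-star = record
    { leaf   = λ {w} w≢p w≢0 → missing-nonadj (w≢p ∘ sym) (leaf-nonadj w w≢p w≢0)
    ; missed = missing-adj {pendantVertex} {zero} refl
    ; off    = λ {x} {y} → off-p x y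
    }
    where
    leaf-nonadj : ∀ w → w ≢ pendantVertex → w ≢ zero → adj Extremal pendantVertex w ≡ false
    leaf-nonadj zero    _   w≢0 = contradiction refl w≢0
    leaf-nonadj (suc w) w≢p _ rewrite Finₚ.splitAt-↑ʳ m 1 zero with splitAt m w in eq
    ... | inj₁ _    = refl
    ... | inj₂ zero = refl
    off-p : ∀ x y → x ≢ pendantVertex → y ≢ pendantVertex → missing Extremal x y ≡ false
    off-p zero    zero    _ _ = missing-irr Extremal zero
    off-p zero    (suc y) _ _ = missing-adj {zero} {suc y} refl
    off-p (suc x) zero    _ _ = missing-adj {suc x} {zero} refl
    off-p (suc x) (suc y) x≢p y≢p with suc x ≟ suc y
    ... | yes _  = refl
    ... | no x≢y with splitAt m x in eqx | splitAt m y in eqy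
    ...   | inj₂ zero | _         = contradiction (cong suc (sym (Finₚ.splitAt⁻¹-↑ʳ eqx))) x≢p
    ...   | inj₁ _    | inj₂ zero = contradiction (cong suc (sym (Finₚ.splitAt⁻¹-↑ʳ eqy))) y≢p
    ...   | inj₁ i    | inj₁ j with i ≟ j
    ...     | no _     = refl
    ...     | yes refl = contradiction (cong suc (trans (sym (Finₚ.splitAt⁻¹-↑ˡ eqx)) (Finₚ.splitAt⁻¹-↑ˡ eqy))) x≢y

  module _ {p q : Fin (2 + m)} (p≢q : p ≢ q) where

    private
      eq : 2 + m ≡ 1 + (m + 1)
      eq = cong suc (ℕₚ.+-comm 1 m)
      π₁ : Permutation (2 + m) (1 + (m + 1))
      π₁ = cast-id eq ∘ₚ transpose (cast eq p) pendantVertex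
      q₁ = π₁ ⟨$⟩ʳ q

    -- `π₁` carries `p` to the pendant vertex; the second transposition then carries the image of
    -- `q` to `zero` and moves neither `pendantVertex` nor, therefore, the image of `p`.
    relabelling : Permutation (2 + m) (1 + (m + 1))
    relabelling = π₁ ∘ₚ transpose q₁ zero

    relabelling-q : relabelling ⟨$⟩ʳ q ≡ zero
    relabelling-q = transpose-i q₁ zero

    relabelling-p : relabelling ⟨$⟩ʳ p ≡ pendantVertex
    relabelling-p = trans (cong (transpose q₁ zero ⟨$⟩ʳ_) π₁p)
      (transpose-other q₁ zero (λ p₁≡q₁ → p≢q (⟨$⟩ʳ-injective π₁ (trans π₁p p₁≡q₁))) λ ())
      where
      π₁p : π₁ ⟨$⟩ʳ p ≡ pendantVertex
      π₁p = transpose-i (cast eq p) pendantVertex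

  star⇒≅ : ∀ (G : Graph (2 + m)) {p q} → p ≢ q → IsStar p q (missing G) → G ≅ Extremal
  star⇒≅ G {p} {q} p≢q star = relabelling p≢q , missing-determines G Extremal (relabelling p≢q)
    (star-determined (missing-simple G) (missing-simple Extremal) (relabelling p≢q) star
      (subst₂ (λ a b → IsStar a b (missing Extremal)) (sym (relabelling-p p≢q)) (sym (relabelling-q p≢q)) extremal-star))

star⇒≐ : ∀ {n} (G H : Graph n) {p q} → IsStar p q (missing G) → IsStar p q (missing H) → G ≐ H
star⇒≐ G H star star′ = missing-determines G H Perm.id
  (star-determined (missing-simple G) (missing-simple H) Perm.id star star′)

rainbow : ∀ {m} (G : Fin (2 + m) → Graph (2 + m)) → HamiltonCycle (Present (missing ∘ G)) → RainbowHamiltonianCycle G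
rainbow G C with cyclicOrder C
... | σ , τ , present = σ , τ , λ i → adj-missing (G i) (λ eq → next-≢ _ (sym (⟨$⟩ʳ-injective σ eq))) (present i)

rainbow-or-extremal : ∀ {m} → 3 ≤ m → (G : Fin (3 + m) → Graph (3 + m)) →
  (∀ i → size (missing (G i)) < 2 * (2 + m)) →
  RainbowHamiltonianCycle G ⊎ ((∀ i j → G i ≐ G j) × (∀ i → G i ≅ K 1 ∨ (K (suc m) ∪ K 1)))
rainbow-or-extremal {m} m≥3 G few with cycle-or-stars m≥3 (missing ∘ G) (missing-simple ∘ G) few (<-wellFounded _)
... | inj₁ C = inj₁ (rainbow G C)
... | inj₂ (p , q , p≢q , stars) = inj₂
  ((λ i j → star⇒≐ (G i) (G j) (stars i) (stars j)) , λ i → star⇒≅ (suc m) (G i) p≢q (stars i))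

mainTheorem3 : ∀ (n : ℕ) → 6 ≤ n → (G : Fin n → Graph n) →
    (ρ : Fin n → ℝ) → (∀ i → IsSpectralRadiusS (G i) (ρ i)) →
    (∀ i → fromℕ (2 * n ∸ 4) <ᴿ ρ i) →
    RainbowHamiltonianCycle G
    ⊎ ((∀ i j → G i ≐ G j) × (∀ i → G i ≅ K 1 ∨ (K (n ∸ 2) ∪ K 1)))
mainTheorem3 (suc (suc (suc m))) (s≤s (s≤s (s≤s m≥3))) G ρ isρ c<ρ =
  rainbow-or-extremal m≥3 G (λ i → few-missing (G i) (ρ i) (isρ i) (c<ρ i))
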